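{- Let $m>0$ and $k>1$ be integers. If $\Delta_{k-1}^p\,\mathbf{\Delta}\,\mathrm{DIFF}_m(\Sigma_k^p) = \Sigma_{k-1}^p\,\mathbf{\Delta}\,\mathrm{DIFF}_m(\Sigma_k^p)$, then $\mathrm{DIFF}_m(\Sigma_k^p) = \mathrm{coDIFF}_m(\Sigma_k^p)$.
   Context: Polynomial hierarchy: $\Sigma_0^p=\mathrm{P}$, $\Sigma_1^p=\mathrm{NP}$, $\Sigma_k^p=\mathrm{NP}^{\Sigma_{k-1}^p}$ for $k>1$; $\Delta_k^p = \mathrm{P}^{\Sigma_{k-1}^p}$ for $k\ge 1$. For sets $C,D$, $C\Delta D=(C-D)\cup(D-C)$, and for classes $\mathcal{C},\mathcal{D}$, $\mathcal{C}\,\mathbf{\Delta}\,\mathcal{D}=\{L\mid(\exists C\in\mathcal{C})(\exists D\in\mathcal{D})[L=C\Delta D]\}$. Boolean hierarchy over a class $\mathcal{C}$: $\mathrm{DIFF}_1(\mathcal{C})=\mathcal{C}$; for $j\ge1$, $\mathrm{DIFF}_{j+1}(\mathcal{C})=\{L\mid (\exists L_1\in\mathcal{C})(\exists L_2\in\mathrm{DIFF}_j(\mathcal{C}))[L=L_1-L_2]\}$; $\mathrm{coDIFF}_j(\mathcal{C})=\{L\mid \overline{L}\in\mathrm{DIFF}_j(\mathcal{C})\}$. -}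

module Defs where

-- Polynomial hierarchy via nondeterministic / deterministic oracle Turing
-- machines (one bi-infinite work tape + one write-only oracle query tape),
-- languages over {0,1}, Boolean hierarchy, and class symmetric difference.

open import Data.Nat using (ℕ; zero; suc; _+_; _*_; _^_; _≤_)
open import Data.Fin using (Fin)
open import Data.Bool using (Bool; true; false; _∧_; not; _xor_; if_then_else_)
open import Data.List using (List; []; _∷_; _++_; map; length; [_])
open import Data.List.Relation.Unary.All using (All)
open import Data.List.Membership.Propositional using (_∈_)
open import Data.Maybe using (Maybe; just; nothing)
open import Data.Product using (Σ; _×_; _,_)
open import Relation.Binary.PropositionalEquality using (_≡_)

Lang : Set
Lang = List Bool → Bool

Class : Set₁
Class = Lang → Set

data Move : Set where
  moveL moveR stay : Move

-- Control states.  'st q' are ordinary states (st zero is the start state),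
-- 'acc'/'rej' are halting states, 'ask q₁ q₀' is the query state: the oracle
-- is asked about the current query-tape content, the query tape is erased,
-- and the machine continues in q₁ (answer yes) or q₀ (answer no).
data Ctrl (nQ : ℕ) : Set where
  st  : Fin (suc nQ) → Ctrl nQ
  acc : Ctrl nQ
  rej : Ctrl nQ
  ask : Fin (suc nQ) → Fin (suc nQ) → Ctrl nQ

-- Tape alphabet: Fin (3 + g); 0 = blank, 1 = bit 0, 2 = bit 1, rest extra.
Sym : ℕ → Set
Sym g = Fin (suc (suc (suc g)))

blank : ∀ {g} → Sym g
blank = Fin.zero

encBit : ∀ {g} → Bool → Sym g
encBit false = Fin.suc Fin.zero
encBit true  = Fin.suc (Fin.suc Fin.zero)

-- A (nondeterministic) transition: new control state, symbol written on the
-- work tape, head move, and optionally a bit appended to the query tape.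
Action : ℕ → ℕ → Set
Action nQ g = Ctrl nQ × Sym g × Move × Maybe Bool

record OTM : Set where
  field
    nQ : ℕ
    g  : ℕ
    δ  : Fin (suc nQ) → Sym g → List (Action nQ g)

record Config (nQ g : ℕ) : Set where
  constructor config
  field
    ctrl  : Ctrl nQ
    left  : List (Sym g)   -- reversed, nearest cell first
    hd    : Sym g
    right : List (Sym g)
    qry   : List Bool

module Run (M : OTM) where
  open OTM M
  Conf : Set
  Conf = Config nQ g

  moveTape : Move → List (Sym g) → Sym g → List (Sym g) → Conf → Conf
  moveTape moveL []      h r (config c _ _ _ q) = config c [] blank (h ∷ r) q
  moveTape moveL (a ∷ l) h r (config c _ _ _ q) = config c l a (h ∷ r) q
  moveTape moveR l h []      (config c _ _ _ q) = config c (h ∷ l) blank [] q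
  moveTape moveR l h (a ∷ r) (config c _ _ _ q) = config c (h ∷ l) a r q
  moveTape stay  l h r       (config c _ _ _ q) = config c l h r q

  appendQ : List Bool → Maybe Bool → List Bool
  appendQ q nothing  = q
  appendQ q (just b) = q ++ [ b ]

  apply : Conf → Action nQ g → Conf
  apply (config _ l _ r q) (c' , b , mv , w) =
    moveTape mv l b r (config c' l b r (appendQ q w))

  successors : Lang → Conf → List Conf
  successors A (config (st p) l h r q) = map (apply (config (st p) l h r q)) (δ p h)
  successors A (config acc l h r q) = []
  successors A (config rej l h r q) = []
  successors A (config (ask p₁ p₀) l h r q) =
    config (st (if A q then p₁ else p₀)) l h r [] ∷ []

  initial : List Bool → Conf
  initial []      = config (st Fin.zero) [] blank [] []
  initial (b ∷ x) = config (st Fin.zero) [] (encBit b) (map encBit x) []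

  HaltsWithin : Lang → ℕ → Conf → Set
  HaltsWithin A zero    c = successors A c ≡ []
  HaltsWithin A (suc t) c = All (HaltsWithin A t) (successors A c)

  data Accepts (A : Lang) : Conf → Set where
    here  : ∀ {c} → Config.ctrl c ≡ acc → Accepts A c
    there : ∀ {c c'} → c' ∈ successors A c → Accepts A c' → Accepts A c

  PolyTime : Lang → Set
  PolyTime A = Σ ℕ λ k → ∀ x → HaltsWithin A (k * length x ^ k + k) (initial x)

  Deterministic : Set
  Deterministic = ∀ p a → length (δ p a) ≤ 1

  Decides : Lang → Lang → Set
  Decides A L = ∀ x → (Accepts A (initial x) → L x ≡ true) × (L x ≡ true → Accepts A (initial x))

open Run

P^ : Lang → Class
P^ A L = Σ OTM λ M → Deterministic M × PolyTime M A × Decides M A L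

NP^ : Lang → Class
NP^ A L = Σ OTM λ M → PolyTime M A × Decides M A L

P^C : Class → Class
P^C C L = Σ Lang λ A → C A × P^ A L

NP^C : Class → Class
NP^C C L = Σ Lang λ A → C A × NP^ A L

-- the empty oracle (an oracle machine with the empty oracle = ordinary machine)
∅ : Lang
∅ _ = false

P : Class
P = P^ ∅

NP : Class
NP = NP^ ∅

Σp : ℕ → Class
Σp zero = P
Σp (suc zero) = NP
Σp (suc (suc k)) = NP^C (Σp (suc k))

-- Δ_k^p = P^{Σ_{k-1}^p} for k ≥ 1 (Δ_0 is set to P; never used)
Δp : ℕ → Class
Δp zero = P
Δp (suc k) = P^C (Σp k)

-- Boolean hierarchy (DIFF_0 is junk, set to C; never used)
DIFF : ℕ → Class → Class
DIFF zero C = C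
DIFF (suc zero) C = C
DIFF (suc (suc j)) C L =
  Σ Lang λ L₁ → Σ Lang λ L₂ → C L₁ × DIFF (suc j) C L₂ × (∀ x → L x ≡ (L₁ x ∧ not (L₂ x)))

coDIFF : ℕ → Class → Class
coDIFF j C L = DIFF j C (λ x → not (L x))

_𝚫_ : Class → Class → Class
(C 𝚫 D) L = Σ Lang λ A → Σ Lang λ B → C A × D B × (∀ x → L x ≡ (A x xor B x))

_≐_ : Class → Class → Set
C ≐ D = ∀ L → (C L → D L) × (D L → C L)

{-# OPTIONS --safe #-}
module Submission where

-- Let L ∈ DIFF_m(Σ_k) and let A ∈ Σ_{k-1} be one oracle for all levels of L.  Let
-- S ∈ Σ_{k-1} consist of the pairs z = ⟨q, u⟩ such that u is a prefix of a certificate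
-- of q ∈ A.  By hypothesis {⟨z, x⟩ | z ∈ S xor x ∈ L} = C Δ E with C ∈ Δ_{k-1} and
-- E ∈ DIFF_m(Σ_k).  If some short z has z ∈ S xor ⟨z, x⟩ ∈ C ("x is easy"), then x ∉ L iff
-- ⟨z, x⟩ ∈ E.  Otherwise ("x is hard") C(⟨·, x⟩) can replace the oracle A on all short
-- queries, so that L(x) is decided with Σ_{k-1} oracles.  S is self-reducible: hardness of
-- x is implied by a local condition on C(⟨·, x⟩), whose failure is a Σ_{k-1} property.
-- Hence the two cases can be told apart, and the complement of L is in DIFF_m(Σ_k).

open import Defs
open import Data.Nat using (ℕ; _<_; _∸_)

open import Data.Bool using (Bool; true; false; _∧_; _∨_; not; _xor_; if_then_else_)
open import Data.Bool.Properties using (∨-zeroʳ; ∨-identityʳ; not-involutive)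
open import Data.Empty using (⊥; ⊥-elim)
open import Data.Fin as Fin using (Fin; zero; suc; fromℕ<; splitAt; join; combine; remQuot; funToFin; finToFun)
open import Data.Fin.Properties using (splitAt-join; finToFun-funToFin; fromℕ<-injective; remQuot-combine)
open import Data.List using (List; []; _∷_; _++_; _∷ʳ_; [_]; map; length; reverse; foldl; foldr; _ʳ++_; replicate; drop)
open import Data.List.Properties using (++-assoc; ++-identityʳ; drop-drop; foldl-ʳ++; length-++; length-drop;
  length-replicate; length-reverse; length-ʳ++; reverse-involutive; unfold-reverse; ʳ++-defn; ʳ++-ʳ++)
open import Data.List.Membership.Propositional using (_∈_)
open import Data.List.Membership.Propositional.Properties using (∈-map⁺; ∈-map⁻)
open import Data.List.Relation.Unary.All as All using (All; []; _∷_)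
open import Data.List.Relation.Unary.Any using (here; there)
open import Data.Maybe using (Maybe; just; nothing)
open import Data.Nat using (zero; suc; _+_; _*_; _^_; _≤_; _<?_; _≟_; z≤n; s≤s; _⊔_)
open import Data.Nat.Properties
open import Data.Nat.Solver using (module +-*-Solver)
open import Data.Product using (∃; _×_; _,_; proj₁; proj₂)
open import Data.Sum using (_⊎_; inj₁; inj₂)
open import Data.Unit using (⊤; tt)
open import Function using (_∘_; flip)
open import Relation.Binary.PropositionalEquality hiding ([_])
open import Relation.Nullary using (Dec; yes; no)
open +-*-Solver using (solve; _:+_; _:*_; _:=_) renaming (con to κ)

-- Register programs and their compilation

-- Easiness itself, the existence of a short `z` with `S z xor C (pr z x)`, is only a Σ_k property,
-- and its failure, a Π_k property, has no place in a difference of the same length. The test by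
-- local consistency saves this alternation. It does not draw the same line: a consistent `x` may
-- have witnesses of easiness as well. No harm is done, because the value read off from `E` and the
-- value found by simulation are both the complement of `L`. The second obstacle is that `z` has to
-- be guessed, while the levels of `E` guess independently of each other and half of them occur
-- negatively. The difference survives because all witnesses of `x` give the same value of `E`. The
-- classes are defined by concrete machines. Two bridges connect them with closure arguments:
-- register programs are compiled to machines, and machines are simulated by programs. The simulated
-- oracle may depend on the input, and this is how `C(⟨·, x⟩)` takes the place of `A`.

Str : Set
Str = List Bool

Store : Set
Store = ℕ → Str

branch : {P : Set} → Dec P → Str → Str → Str
branch (yes _) x y = x
branch (no _)  x y = y

_[_≔_] : Store → ℕ → Str → Store
(s [ r ≔ x ]) i = branch (i ≟ r) x (s i)

upd-same : ∀ s r x → (s [ r ≔ x ]) r ≡ x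
upd-same s r x with r ≟ r
... | yes _ = refl
... | no ne = ⊥-elim (ne refl)

upd-other : ∀ s {r i} x → i ≢ r → (s [ r ≔ x ]) i ≡ s i
upd-other s {r} {i} x ne with i ≟ r
... | yes e = ⊥-elim (ne e)
... | no _  = refl

infixr 5 _⨾_

-- A register is a stack of bits; 'pop' and 'loop' remove
-- the top bit and branch on it, 'query' consumes a register as the oracle
-- query, 'choose' branches nondeterministically.
data Cmd : Set where
  skip   : Cmd
  halt   : Bool → Cmd
  _⨾_    : Cmd → Cmd → Cmd
  push   : ℕ → Bool → Cmd
  pop    : ℕ → Cmd → Cmd → Cmd → Cmd
  loop   : ℕ → Cmd → Cmd → Cmd
  query  : ℕ → Cmd → Cmd → Cmd
  choose : Cmd → Cmd → Cmd

Uses≤ : ℕ → Cmd → Set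
Uses≤ R skip          = ⊤
Uses≤ R (halt _)      = ⊤
Uses≤ R (c ⨾ d)       = Uses≤ R c × Uses≤ R d
Uses≤ R (push r _)    = r < R
Uses≤ R (pop r c d e) = r < R × Uses≤ R c × Uses≤ R d × Uses≤ R e
Uses≤ R (loop r c d)  = r < R × Uses≤ R c × Uses≤ R d
Uses≤ R (query r c d) = r < R × Uses≤ R c × Uses≤ R d
Uses≤ R (choose c d)  = Uses≤ R c × Uses≤ R d

Uses-mono : ∀ {R R'} c → R ≤ R' → Uses≤ R c → Uses≤ R' c
Uses-mono skip          le u = tt
Uses-mono (halt _)      le u = tt
Uses-mono (c ⨾ d)       le (u , v) = Uses-mono c le u , Uses-mono d le v
Uses-mono (push r _)    le u = ≤-trans u le
Uses-mono (pop r c d e) le (h , u , v , w) =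
  ≤-trans h le , Uses-mono c le u , Uses-mono d le v , Uses-mono e le w
Uses-mono (loop r c d)  le (h , u , v) = ≤-trans h le , Uses-mono c le u , Uses-mono d le v
Uses-mono (query r c d) le (h , u , v) = ≤-trans h le , Uses-mono c le u , Uses-mono d le v
Uses-mono (choose c d)  le (u , v) = Uses-mono c le u , Uses-mono d le v

Det : Cmd → Set
Det skip          = ⊤
Det (halt _)      = ⊤
Det (c ⨾ d)       = Det c × Det d
Det (push r _)    = ⊤
Det (pop r c d e) = Det c × Det d × Det e
Det (loop r c d)  = Det c × Det d
Det (query r c d) = Det c × Det d
Det (choose c d)  = ⊥

-- The registers are tracks of the cells to the right
-- of the resting position of the head, bottom of the stack first.

digit : Fin 3 → Maybe Bool
digit zero             = nothing
digit (suc zero)       = just false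
digit (suc (suc zero)) = just true

undigit : Maybe Bool → Fin 3
undigit nothing      = zero
undigit (just false) = suc zero
undigit (just true)  = suc (suc zero)

digit-undigit : ∀ v → digit (undigit v) ≡ v
digit-undigit nothing      = refl
digit-undigit (just false) = refl
digit-undigit (just true)  = refl

onTrack0 : ∀ {R} → Fin 3 → Fin R → Fin 3
onTrack0 d zero    = d
onTrack0 d (suc _) = zero

-- The three primitive symbols count as cells too: a blank is empty on every track, an input bit
-- lies on track 0. So the untouched input tape already represents a store.
tracks : ∀ {R} → Sym (3 ^ R) → Fin R → Fin 3
tracks zero                = λ _ → zero
tracks (suc zero)          = onTrack0 (suc zero)
tracks (suc (suc zero))    = onTrack0 (suc (suc zero))
tracks (suc (suc (suc j))) = finToFun j

putTrack : ∀ {R} → (Fin R → Fin 3) → Fin R → Fin 3 → Fin R → Fin 3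
putTrack f r d i with i Fin.≟ r
... | yes _ = d
... | no  _ = f i

get : ∀ R → ℕ → Sym (3 ^ R) → Maybe Bool
get R r a with r <? R
... | yes p = digit (tracks a (fromℕ< p))
... | no  _ = nothing

set : ∀ R → ℕ → Maybe Bool → Sym (3 ^ R) → Sym (3 ^ R)
set R r v a with r <? R
... | yes p = suc (suc (suc (funToFin (putTrack (tracks a) (fromℕ< p) (undigit v)))))
... | no  _ = a

get-set : ∀ R {r} v a → r < R → get R r (set R r v a) ≡ v
get-set R {r} v a lt with r <? R
... | no ¬p = ⊥-elim (¬p lt)
... | yes p rewrite finToFun-funToFin (putTrack (tracks a) (fromℕ< p) (undigit v)) (fromℕ< p)
  with fromℕ< p Fin.≟ fromℕ< p
... | yes _ = digit-undigit v
... | no ne = ⊥-elim (ne refl)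

get-set-other : ∀ R {r r'} v a → r' ≢ r → get R r' (set R r v a) ≡ get R r' a
get-set-other R {r} {r'} v a ne with r <? R
... | no ¬p = refl
... | yes p with r' <? R
... | no _ = refl
... | yes p' rewrite finToFun-funToFin (putTrack (tracks a) (fromℕ< p) (undigit v)) (fromℕ< p')
  with fromℕ< p' Fin.≟ fromℕ< p
... | yes e = ⊥-elim (ne (fromℕ<-injective _ _ p' p e))
... | no _ = refl

get-blank : ∀ R r → get R r blank ≡ nothing
get-blank R r with r <? R
... | yes _ = refl
... | no  _ = refl

get-input : ∀ R b → 0 < R → get R 0 (encBit b) ≡ just b
get-input (suc R) false lt = refl
get-input (suc R) true  lt = refl

get-input-other : ∀ R r b → get R (suc r) (encBit b) ≡ nothing
get-input-other R r b with suc r <? R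
get-input-other R       r b     | no _  = refl
get-input-other (suc R) r false | yes (s≤s p) = refl
get-input-other (suc R) r true  | yes (s≤s p) = refl

St : Cmd → Set
St skip          = Fin 1
St (halt _)      = Fin 1
St (c ⨾ d)       = St c ⊎ St d
St (push r _)    = Fin 3
St (pop r c d e) = Fin 5 ⊎ St c ⊎ St d ⊎ St e
St (loop r c d)  = Fin 5 ⊎ St c ⊎ St d
St (query r c d) = Fin 3 ⊎ St c ⊎ St d
St (choose c d)  = Fin 1 ⊎ St c ⊎ St d

entry : ∀ c → St c
entry skip          = zero
entry (halt _)      = zero
entry (c ⨾ d)       = inj₁ (entry c)
entry (push r _)    = zero
entry (pop r c d e) = inj₁ zero
entry (loop r c d)  = inj₁ zero
entry (query r c d) = inj₁ zero
entry (choose c d)  = inj₁ zero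

record Finite (A : Set) : Set where
  field
    size    : ℕ
    index   : A → Fin size
    element : Fin size → A
    element-index : ∀ a → element (index a) ≡ a

finFinite : ∀ n → Finite (Fin n)
finFinite n = record { size = n ; index = λ i → i ; element = λ i → i ; element-index = λ _ → refl }

infixr 1 _⊎ᶠ_

_⊎ᶠ_ : ∀ {A B} → Finite A → Finite B → Finite (A ⊎ B)
_⊎ᶠ_ {A} {B} F G = record
  { size = Finite.size F + Finite.size G ; index = ix ; element = el ∘ splitAt (Finite.size F) ; element-index = ok }
  where
  ix : A ⊎ B → Fin (Finite.size F + Finite.size G)
  ix (inj₁ a) = join (Finite.size F) (Finite.size G) (inj₁ (Finite.index F a))
  ix (inj₂ b) = join (Finite.size F) (Finite.size G) (inj₂ (Finite.index G b))
  el : Fin (Finite.size F) ⊎ Fin (Finite.size G) → A ⊎ B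
  el (inj₁ i) = inj₁ (Finite.element F i)
  el (inj₂ i) = inj₂ (Finite.element G i)
  ok : ∀ x → el (splitAt (Finite.size F) (ix x)) ≡ x
  ok (inj₁ a) rewrite splitAt-join (Finite.size F) (Finite.size G) (inj₁ (Finite.index F a)) = cong inj₁ (Finite.element-index F a)
  ok (inj₂ b) rewrite splitAt-join (Finite.size F) (Finite.size G) (inj₂ (Finite.index G b)) = cong inj₂ (Finite.element-index G b)

St-finite : ∀ c → Finite (St c)
St-finite skip          = finFinite 1
St-finite (halt _)      = finFinite 1
St-finite (c ⨾ d)       = St-finite c ⊎ᶠ St-finite d
St-finite (push r _)    = finFinite 3
St-finite (pop r c d e) = finFinite 5 ⊎ᶠ St-finite c ⊎ᶠ St-finite d ⊎ᶠ St-finite e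
St-finite (loop r c d)  = finFinite 5 ⊎ᶠ St-finite c ⊎ᶠ St-finite d
St-finite (query r c d) = finFinite 3 ⊎ᶠ St-finite c ⊎ᶠ St-finite d
St-finite (choose c d)  = finFinite 1 ⊎ᶠ St-finite c ⊎ᶠ St-finite d

-- Translation of commands into transition tables

module Compile (R nQ : ℕ) where

  Act : Set
  Act = Action nQ (3 ^ R)

  State : Set
  State = Fin (suc nQ)

  Cell : Set
  Cell = Sym (3 ^ R)

  right left sit : State → Cell → List Act
  right q a = [ (st q , a , moveR , nothing) ]
  left  q a = [ (st q , a , moveL , nothing) ]
  sit   q a = [ (st q , a , stay  , nothing) ]

  onBit : Maybe Bool → List Act → (Bool → List Act) → List Act
  onBit nothing  n j = n
  onBit (just b) n j = j b

  ifB : {A : Set} → Bool → A → A → A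
  ifB false x y = x
  ifB true  x y = y

  -- State 0 leaves the resting position, state 1 climbs to the first empty cell of the track, state
  -- 2 descends. The resting cell is blank, hence empty on every track, and this stops the descent.
  pushTr : ℕ → Bool → (Fin 3 → State) → State → Fin 3 → Cell → List Act
  pushTr r b inj e zero             a = right (inj (suc zero)) a
  pushTr r b inj e (suc zero)       a =
    onBit (get R r a) (left (inj (suc (suc zero))) (set R r (just b) a)) (λ _ → right (inj (suc zero)) a)
  pushTr r b inj e (suc (suc zero)) a =
    onBit (get R r a) (sit e a) (λ _ → left (inj (suc (suc zero))) a)

  -- The climb overshoots the top by one cell. If the cell below, inspected in state 2, is empty as
  -- well, it is the resting cell and the stack is empty. Otherwise the erased bit is remembered by
  -- descending in state 3 or in state 4.
  popTr : ℕ → (Fin 5 → State) → State → State → State → Fin 5 → Cell → List Act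
  popTr r inj e e₀ e₁ zero             a = right (inj (suc zero)) a
  popTr r inj e e₀ e₁ (suc zero)       a =
    onBit (get R r a) (left (inj (suc (suc zero))) a) (λ _ → right (inj (suc zero)) a)
  popTr r inj e e₀ e₁ (suc (suc zero)) a =
    onBit (get R r a) (sit e a)
      (λ b → left (inj (suc (suc (suc (ifB b zero (suc zero)))))) (set R r nothing a))
  popTr r inj e e₀ e₁ (suc (suc (suc b))) a =
    onBit (get R r a) (sit (pick b) a) (λ _ → left (inj (suc (suc (suc b)))) a)
    where
    pick : Fin 2 → State
    pick zero       = e₀
    pick (suc zero) = e₁

  -- Bits are emitted and erased during the descent, top of the stack first, so the query is the
  -- register read as a list.
  queryTr : ℕ → (Fin 3 → State) → State → State → Fin 3 → Cell → List Act
  queryTr r inj e₀ e₁ zero             a = right (inj (suc zero)) a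
  queryTr r inj e₀ e₁ (suc zero)       a =
    onBit (get R r a) (left (inj (suc (suc zero))) a) (λ _ → right (inj (suc zero)) a)
  queryTr r inj e₀ e₁ (suc (suc zero)) a =
    onBit (get R r a) [ (ask e₁ e₀ , a , stay , nothing) ]
      (λ b → [ (st (inj (suc (suc zero))) , set R r nothing a , moveL , just b) ])

  -- `inj` places the local states of the command in the machine, and `e` is the state entered when
  -- the command is done; a loop body gets the head of its loop as `e`.
  instr : ∀ c → (St c → State) → State → St c → Cell → List Act
  instr skip     inj e q a = sit e a
  instr (halt false) inj e q a = [ (rej , a , stay , nothing) ]
  instr (halt true)  inj e q a = [ (acc , a , stay , nothing) ]
  instr (c ⨾ d)  inj e (inj₁ q) a = instr c (inj ∘ inj₁) (inj (inj₂ (entry d))) q a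
  instr (c ⨾ d)  inj e (inj₂ q) a = instr d (inj ∘ inj₂) e q a
  instr (push r b) inj e q a = pushTr r b inj e q a
  instr (pop r c d f) inj e (inj₁ q) a =
    popTr r (inj ∘ inj₁) (inj (inj₂ (inj₁ (entry c)))) (inj (inj₂ (inj₂ (inj₁ (entry d)))))
      (inj (inj₂ (inj₂ (inj₂ (entry f))))) q a
  instr (pop r c d f) inj e (inj₂ (inj₁ q))        a = instr c (inj ∘ inj₂ ∘ inj₁) e q a
  instr (pop r c d f) inj e (inj₂ (inj₂ (inj₁ q))) a = instr d (inj ∘ inj₂ ∘ inj₂ ∘ inj₁) e q a
  instr (pop r c d f) inj e (inj₂ (inj₂ (inj₂ q))) a = instr f (inj ∘ inj₂ ∘ inj₂ ∘ inj₂) e q a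
  instr (loop r c d) inj e (inj₁ q) a =
    popTr r (inj ∘ inj₁) e (inj (inj₂ (inj₁ (entry c)))) (inj (inj₂ (inj₂ (entry d)))) q a
  instr (loop r c d) inj e (inj₂ (inj₁ q)) a = instr c (inj ∘ inj₂ ∘ inj₁) (inj (inj₁ zero)) q a
  instr (loop r c d) inj e (inj₂ (inj₂ q)) a = instr d (inj ∘ inj₂ ∘ inj₂) (inj (inj₁ zero)) q a
  instr (query r c d) inj e (inj₁ q) a =
    queryTr r (inj ∘ inj₁) (inj (inj₂ (inj₁ (entry c)))) (inj (inj₂ (inj₂ (entry d)))) q a
  instr (query r c d) inj e (inj₂ (inj₁ q)) a = instr c (inj ∘ inj₂ ∘ inj₁) e q a
  instr (query r c d) inj e (inj₂ (inj₂ q)) a = instr d (inj ∘ inj₂ ∘ inj₂) e q a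
  instr (choose c d) inj e (inj₁ q) a =
    (st (inj (inj₂ (inj₁ (entry c)))) , a , stay , nothing) ∷ sit (inj (inj₂ (inj₂ (entry d)))) a
  instr (choose c d) inj e (inj₂ (inj₁ q)) a = instr c (inj ∘ inj₂ ∘ inj₁) e q a
  instr (choose c d) inj e (inj₂ (inj₂ q)) a = instr d (inj ∘ inj₂ ∘ inj₂) e q a

  onBit-det : ∀ v {n j} → length n ≤ 1 → (∀ b → length (j b) ≤ 1) → length (onBit v n j) ≤ 1
  onBit-det nothing  p q = p
  onBit-det (just b) p q = q b

  one : 1 ≤ 1
  one = ≤-refl

  popTr-det : ∀ r inj e e₀ e₁ q a → length (popTr r inj e e₀ e₁ q a) ≤ 1
  popTr-det r inj e e₀ e₁ zero a = one
  popTr-det r inj e e₀ e₁ (suc zero) a = onBit-det (get R r a) one (λ _ → one)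
  popTr-det r inj e e₀ e₁ (suc (suc zero)) a = onBit-det (get R r a) one (λ _ → one)
  popTr-det r inj e e₀ e₁ (suc (suc (suc b))) a = onBit-det (get R r a) one (λ _ → one)

  instr-det : ∀ c inj e → Det c → ∀ q a → length (instr c inj e q a) ≤ 1
  instr-det skip     inj e D q a = one
  instr-det (halt false) inj e D q a = one
  instr-det (halt true)  inj e D q a = one
  instr-det (c ⨾ d)  inj e D (inj₁ q) a = instr-det c _ _ (proj₁ D) q a
  instr-det (c ⨾ d)  inj e D (inj₂ q) a = instr-det d _ _ (proj₂ D) q a
  instr-det (push r b) inj e D zero a = one
  instr-det (push r b) inj e D (suc zero) a = onBit-det (get R r a) one (λ _ → one)
  instr-det (push r b) inj e D (suc (suc zero)) a = onBit-det (get R r a) one (λ _ → one)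
  instr-det (pop r c d f) inj e D (inj₁ q) a = popTr-det r _ _ _ _ q a
  instr-det (pop r c d f) inj e D (inj₂ (inj₁ q)) a = instr-det c _ _ (proj₁ D) q a
  instr-det (pop r c d f) inj e D (inj₂ (inj₂ (inj₁ q))) a = instr-det d _ _ (proj₁ (proj₂ D)) q a
  instr-det (pop r c d f) inj e D (inj₂ (inj₂ (inj₂ q))) a = instr-det f _ _ (proj₂ (proj₂ D)) q a
  instr-det (loop r c d) inj e D (inj₁ q) a = popTr-det r _ _ _ _ q a
  instr-det (loop r c d) inj e D (inj₂ (inj₁ q)) a = instr-det c _ _ (proj₁ D) q a
  instr-det (loop r c d) inj e D (inj₂ (inj₂ q)) a = instr-det d _ _ (proj₂ D) q a
  instr-det (query r c d) inj e D (inj₁ zero) a = one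
  instr-det (query r c d) inj e D (inj₁ (suc zero)) a = onBit-det (get R r a) one (λ _ → one)
  instr-det (query r c d) inj e D (inj₁ (suc (suc zero))) a = onBit-det (get R r a) one (λ _ → one)
  instr-det (query r c d) inj e D (inj₂ (inj₁ q)) a = instr-det c _ _ (proj₁ D) q a
  instr-det (query r c d) inj e D (inj₂ (inj₂ q)) a = instr-det d _ _ (proj₂ D) q a

-- Registers as tape columns, and timed execution

idx : Str → ℕ → Maybe Bool
idx []       i       = nothing
idx (b ∷ bs) zero    = just b
idx (b ∷ bs) (suc i) = idx bs i

idx-∷ʳ-last : ∀ bs b → idx (bs ∷ʳ b) (length bs) ≡ just b
idx-∷ʳ-last []       b = refl
idx-∷ʳ-last (_ ∷ bs) b = idx-∷ʳ-last bs b

idx-∷ʳ-other : ∀ bs b i → i ≢ length bs → idx (bs ∷ʳ b) i ≡ idx bs i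
idx-∷ʳ-other []       b zero    ne = ⊥-elim (ne refl)
idx-∷ʳ-other []       b (suc i) ne = refl
idx-∷ʳ-other (_ ∷ bs) b zero    ne = refl
idx-∷ʳ-other (_ ∷ bs) b (suc i) ne = idx-∷ʳ-other bs b i (ne ∘ cong suc)

idx-inside : ∀ bs i → i < length bs → ∃ λ b → idx bs i ≡ just b
idx-inside (b ∷ bs) zero    lt       = b , refl
idx-inside (b ∷ bs) (suc i) (s≤s lt) = idx-inside bs i lt

idx-end : ∀ bs → idx bs (length bs) ≡ nothing
idx-end []       = refl
idx-end (_ ∷ bs) = idx-end bs

-- The bottom of the stack has index 0, so that a push or a pop changes a single cell.
col : Str → ℕ → Maybe Bool
col l = idx (reverse l)

col-top : ∀ b l → col (b ∷ l) (length l) ≡ just b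
col-top b l rewrite unfold-reverse b l | sym (length-reverse l) = idx-∷ʳ-last (reverse l) b

col-below : ∀ b l i → i ≢ length l → col (b ∷ l) i ≡ col l i
col-below b l i ne rewrite unfold-reverse b l | sym (length-reverse l) = idx-∷ʳ-other (reverse l) b i ne

col-inside : ∀ l i → i < length l → ∃ λ b → col l i ≡ just b
col-inside l i lt = idx-inside (reverse l) i (subst (i <_) (sym (length-reverse l)) lt)

col-end : ∀ l → col l (length l) ≡ nothing
col-end l = subst (λ n → col l n ≡ nothing) (length-reverse l) (idx-end (reverse l))

-- A common bound for one walk to the top of a stack of height `n` and back. It is exact for a
-- query: `2n` steps on the stack, and one each for leaving, turning, entering `ask` and being
-- answered.
cost : ℕ → ℕ
cost n = 4 + (n + n)

-- `weaken` takes the place of extensionality, stores being functions that are compared pointwise.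
-- `halt` and `choose` have no rule because they do not lead to one final store; they are treated
-- through the outcome of the machine.
data Exec (A : Lang) : Cmd → Store → ℕ → Store → Set where
  weaken : ∀ {c s₀ s t t' s' s''} → s₀ ≗ s → t ≤ t' → s' ≗ s'' →
           Exec A c s t s' → Exec A c s₀ t' s''
  skip   : ∀ {s} → Exec A skip s 1 s
  seq    : ∀ {c d s t s' t' s''} → Exec A c s t s' → Exec A d s' t' s'' →
           Exec A (c ⨾ d) s (t + t') s''
  push   : ∀ {r b s} → Exec A (push r b) s (cost (length (s r))) (s [ r ≔ b ∷ s r ])
  pop[]  : ∀ {r c d e s t s'} → s r ≡ [] → Exec A c s t s' →
           Exec A (pop r c d e) s (cost 0 + t) s'
  pop0   : ∀ {r c d e s t s' l} → s r ≡ false ∷ l → Exec A d (s [ r ≔ l ]) t s' →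
           Exec A (pop r c d e) s (cost (length (s r)) + t) s'
  pop1   : ∀ {r c d e s t s' l} → s r ≡ true ∷ l → Exec A e (s [ r ≔ l ]) t s' →
           Exec A (pop r c d e) s (cost (length (s r)) + t) s'
  loop[] : ∀ {r c d s} → s r ≡ [] → Exec A (loop r c d) s (cost 0) s
  loop0  : ∀ {r c d s t s' t' s'' l} → s r ≡ false ∷ l → Exec A c (s [ r ≔ l ]) t s' →
           Exec A (loop r c d) s' t' s'' →
           Exec A (loop r c d) s (cost (length (s r)) + (t + t')) s''
  loop1  : ∀ {r c d s t s' t' s'' l} → s r ≡ true ∷ l → Exec A d (s [ r ≔ l ]) t s' →
           Exec A (loop r c d) s' t' s'' →
           Exec A (loop r c d) s (cost (length (s r)) + (t + t')) s''
  query0 : ∀ {r c d s t s'} → A (s r) ≡ false → Exec A c (s [ r ≔ [] ]) t s' →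
           Exec A (query r c d) s (cost (length (s r)) + t) s'
  query1 : ∀ {r c d s t s'} → A (s r) ≡ true → Exec A d (s [ r ≔ [] ]) t s' →
           Exec A (query r c d) s (cost (length (s r)) + t) s'

assoc₃ : ∀ a b c d → a + (b + (c + d)) ≡ (a + (b + c)) + d
assoc₃ a b c d = sym (trans (+-assoc a (b + c) d) (cong (a +_) (+-assoc b c d)))

-- Outcomes of configurations, and correctness of the compilation

module Outcome (M : OTM) (A : Lang) where
  open Run M

  record Good (t : ℕ) (b : Bool) (c : Conf) : Set where
    constructor good
    field
      halts : HaltsWithin A t c
      only  : Accepts A c → b ≡ true
      does  : b ≡ true → Accepts A c

  halts-suc : ∀ t c → HaltsWithin A t c → HaltsWithin A (suc t) c
  halts-suc zero    c h rewrite h = []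
  halts-suc (suc t) c h = go _ h
    where
    go : ∀ cs → All (HaltsWithin A t) cs → All (HaltsWithin A (suc t)) cs
    go []       []       = []
    go (c ∷ cs) (h ∷ hs) = halts-suc t c h ∷ go cs hs

  halts-+ : ∀ {t} n c → HaltsWithin A t c → HaltsWithin A (n + t) c
  halts-+ zero    c h = h
  halts-+ (suc n) c h = halts-suc (n + _) c (halts-+ n c h)

  halts-mono : ∀ {t t'} c → t ≤ t' → HaltsWithin A t c → HaltsWithin A t' c
  halts-mono {t} {t'} c le h with m≤n⇒∃[o]m+o≡n le
  ... | o , refl = subst (λ n → HaltsWithin A n c) (+-comm o t) (halts-+ o c h)

  Good-mono : ∀ {t t' b c} → t ≤ t' → Good t b c → Good t' b c
  Good-mono le (good h o d) = good (halts-mono _ le h) o d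

  acc-stuck : ∀ c → Config.ctrl c ≡ acc → successors A c ≡ []
  acc-stuck (config acc _ _ _ _) refl = refl

  Good-step : ∀ {t b c c'} → successors A c ≡ c' ∷ [] → Good t b c' → Good (suc t) b c
  Good-step {t} {b} {c} {c'} eq (good h o d) =
    good (subst (All (HaltsWithin A t)) (sym eq) (h ∷ [])) only′
      (λ e → there (subst (c' ∈_) (sym eq) (here refl)) (d e))
    where
    only′ : Accepts A c → b ≡ true
    only′ (here e) with trans (sym (acc-stuck c e)) eq
    ... | ()
    only′ (there m p) with subst (_ ∈_) eq m
    ... | here refl = o p

  Good-branch : ∀ {t b₀ b₁ c c₀ c₁} → successors A c ≡ c₀ ∷ c₁ ∷ [] →
                Good t b₀ c₀ → Good t b₁ c₁ → Good (suc t) (b₀ ∨ b₁) c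
  Good-branch {t} {b₀} {b₁} {c} {c₀} {c₁} eq (good h₀ o₀ d₀) (good h₁ o₁ d₁) =
    good (subst (All (HaltsWithin A t)) (sym eq) (h₀ ∷ h₁ ∷ [])) only′ (does′ b₀ d₀)
    where
    only′ : Accepts A c → b₀ ∨ b₁ ≡ true
    only′ (here e) with trans (sym (acc-stuck c e)) eq
    ... | ()
    only′ (there m p) with subst (_ ∈_) eq m
    ... | here refl rewrite o₀ p = refl
    ... | there (here refl) rewrite o₁ p = ∨-zeroʳ b₀
    does′ : ∀ b₀ → (b₀ ≡ true → Accepts A c₀) → b₀ ∨ b₁ ≡ true → Accepts A c
    does′ true  d₀ e = there (subst (c₀ ∈_) (sym eq) (here refl)) (d₀ refl)
    does′ false d₀ e = there (subst (c₁ ∈_) (sym eq) (there (here refl))) (d₁ e)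

  Good-acc : ∀ {l h r q} → Good 0 true (config acc l h r q)
  Good-acc = good refl (λ _ → refl) (λ _ → here refl)

  Good-rej : ∀ {l h r q} → Good 0 false (config rej l h r q)
  Good-rej = good refl only′ (λ ())
    where
    only′ : ∀ {l h r q} → Accepts A (config rej l h r q) → false ≡ true
    only′ (here ())
    only′ (there () _)

module Sound (R nQ : ℕ) (δ : Fin (suc nQ) → Sym (3 ^ R) → List (Action nQ (3 ^ R))) (A : Lang) where
  M : OTM
  M = record { nQ = nQ ; g = 3 ^ R ; δ = δ }

  open Compile R nQ
  open Outcome M A public
  open Run M

  nth : List Cell → ℕ → Cell
  nth []      i       = blank
  nth (a ∷ T) zero    = a
  nth (a ∷ T) (suc i) = nth T i

  tl : List Cell → List Cell
  tl []      = []
  tl (a ∷ T) = T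

  nth-suc : ∀ T i → nth T (suc i) ≡ nth (tl T) i
  nth-suc []      i = refl
  nth-suc (_ ∷ T) i = refl

  -- Visiting a cell beyond the end of the list makes its blank explicit. This changes the list but
  -- not what `nth` sees, and tapes are only examined through `nth`.
  pad : List Cell → List Cell
  pad T = nth T 0 ∷ tl T

  nth-pad : ∀ T i → nth (pad T) i ≡ nth T i
  nth-pad []      zero    = refl
  nth-pad []      (suc i) = refl
  nth-pad (_ ∷ T) zero    = refl
  nth-pad (_ ∷ T) (suc i) = refl

  at : State → List Cell → List Cell → Str → Conf
  at q L T w = config (st q) L (nth T 0) (tl T) w

  back : State → Cell → List Cell → List Cell → Str → Conf
  back q l L T w = config (st q) L l T w

  moveR-at : ∀ {q L h l' h' r'} T w →
             moveTape moveR L h T (config (st q) l' h' r' w) ≡ at q (h ∷ L) T w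
  moveR-at []      w = refl
  moveR-at (_ ∷ _) w = refl

  go-right : ∀ {p q h L T w t b} → δ p h ≡ right q h → Good t b (at q (h ∷ L) T w) →
             Good (suc t) b (config (st p) L h T w)
  go-right {p} {q} {h} {L} {T} {w} eq = Good-step
    (trans (cong (map (apply (config (st p) L h T w))) eq) (cong (_∷ []) (moveR-at T w)))

  go-left : ∀ {p q h a l L T w t b} → δ p h ≡ left q a → Good t b (back q l L (a ∷ T) w) →
            Good (suc t) b (config (st p) (l ∷ L) h T w)
  go-left {p} {h = h} {l = l} {L} {T} {w} eq =
    Good-step (cong (map (apply (config (st p) (l ∷ L) h T w))) eq)

  go-sit : ∀ {p q h L T w t b} → δ p h ≡ sit q h → Good t b (config (st q) L h T w) →
           Good (suc t) b (config (st p) L h T w)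
  go-sit {p} {h = h} {L} {T} {w} eq = Good-step (cong (map (apply (config (st p) L h T w))) eq)

  modAt : ℕ → (List Cell → List Cell) → List Cell → List Cell
  modAt zero    f T = f T
  modAt (suc n) f T = nth T 0 ∷ modAt n f (tl T)

  dropT : ℕ → List Cell → List Cell
  dropT zero    T = T
  dropT (suc n) T = dropT n (tl T)

  nth-dropT : ∀ n T → nth (dropT n T) 0 ≡ nth T n
  nth-dropT zero    T = refl
  nth-dropT (suc n) T = trans (nth-dropT n (tl T)) (sym (nth-suc T n))

  ActsOnHead : (Cell → Cell) → (List Cell → List Cell) → Set
  ActsOnHead g f = ∀ T → nth (f T) 0 ≡ g (nth T 0) × (∀ i → nth (f T) (suc i) ≡ nth T (suc i))

  nth-modAt : ∀ {g f} → ActsOnHead g f → ∀ n T → nth (modAt n f T) n ≡ g (nth T n)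
  nth-modAt h zero    T = proj₁ (h T)
  nth-modAt {g} h (suc n) T = trans (nth-modAt {g} h n (tl T)) (cong g (sym (nth-suc T n)))

  nth-modAt-other : ∀ {g f} → ActsOnHead g f → ∀ n T i → i ≢ n → nth (modAt n f T) i ≡ nth T i
  nth-modAt-other h zero    T zero    ne = ⊥-elim (ne refl)
  nth-modAt-other h zero    T (suc i) ne = proj₂ (h T) i
  nth-modAt-other h (suc n) T zero    ne = refl
  nth-modAt-other {g} {f} h (suc n) T (suc i) ne =
    trans (nth-modAt-other {g} {f} h n (tl T) i (ne ∘ cong suc)) (sym (nth-suc T i))

  Turn : State → State → ℕ → (List Cell → List Cell) → List Cell → Set
  Turn p₁ p₂ k f T = ∀ l L t b → Good t b (back p₂ l L (f T) []) → Good (k + t) b (at p₁ (l ∷ L) T [])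

  -- Induction on the height: the lowest cell adds one step to the right before, and one step to the
  -- left after, the sweep of the cells above it. Push and pop differ only in the `k` steps at the
  -- turning point.
  sweep : ∀ {p₁ p₂ r f k} →
    (∀ a b → get R r a ≡ just b → δ p₁ a ≡ right p₁ a) →
    (∀ a b → get R r a ≡ just b → δ p₂ a ≡ left p₂ a) →
    ∀ n T {l L t b} → (∀ i → i < n → ∃ λ b → get R r (nth T i) ≡ just b) →
    Turn p₁ p₂ k f (dropT n T) →
    Good t b (back p₂ l L (modAt n f T) []) →
    Good (n + (k + (n + t))) b (at p₁ (l ∷ L) T [])
  sweep gr gl zero T full turn G = turn _ _ _ _ G
  sweep {p₁} {k = k} gr gl (suc n) T {l} {L} {t} {β} full turn G with full 0 (s≤s z≤n)
  ... | b , e = go-right (gr _ b e)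
    (subst (λ m → Good (n + (k + m)) β (at p₁ (nth T 0 ∷ l ∷ L) (tl T) [])) (+-suc n t)
      (sweep gr gl n (tl T)
        (λ i lt → proj₁ (full (suc i) (s≤s lt)) ,
          trans (cong (get R _) (sym (nth-suc T i))) (proj₂ (full (suc i) (s≤s lt))))
        turn (go-left (gl _ b e) G)))

  Rep : List Cell → Store → Set
  Rep T s = ∀ r → r < R → ∀ i → get R r (nth T i) ≡ col (s r) i

  Rep-cong : ∀ {T s s'} → s ≗ s' → Rep T s → Rep T s'
  Rep-cong eq rep r lt i = trans (rep r lt i) (cong (λ l → col l i) (eq r))

  Rep-upd : ∀ {T T' s r v l} n → r < R → Rep T s →
    nth T' n ≡ set R r v (nth T n) → (∀ i → i ≢ n → nth T' i ≡ nth T i) →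
    col l n ≡ v → (∀ i → i ≢ n → col l i ≡ col (s r) i) →
    Rep T' (s [ r ≔ l ])
  Rep-upd {T} {T'} {s} {r} {v} {l} n r<R rep en eo cn co r' lt i with r' ≟ r | i ≟ n
  ... | yes refl | yes refl = trans (cong (get R r) en) (trans (get-set R v _ r<R) (sym cn))
  ... | yes refl | no ne = trans (cong (get R r) (eo i ne)) (trans (rep r lt i) (sym (co i ne)))
  ... | no rne | yes refl = trans (cong (get R r') en) (trans (get-set-other R v _ rne) (rep r' lt i))
  ... | no rne | no ne = trans (cong (get R r') (eo i ne)) (rep r' lt i)

  -- A store does not determine its tape, as cells may be written with different symbols and
  -- trailing blanks may be explicit or not. Hence the outcome is required for every representing
  -- tape.
  record Ready (q : State) (s : Store) (t : ℕ) (b : Bool) : Set where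
    field
      from : ∀ T → Rep T s → Good t b (config (st q) [] blank T [])

  open Ready public

  Ready-mono : ∀ {q s t t' b} → t ≤ t' → Ready q s t b → Ready q s t' b
  Ready-mono le rd .from T rep = Good-mono le (from rd T rep)

  retime : ∀ q s b {t t'} → t ≡ t' → Ready q s t b → Ready q s t' b
  retime q s b refl rd = rd

  full-below : ∀ {T s r l} n → Rep T s → r < R → s r ≡ l → n ≤ length l →
               ∀ i → i < n → ∃ λ b → get R r (nth T i) ≡ just b
  full-below {r = r} {l} n rep lt refl le i i<n with col-inside l i (≤-trans i<n le)
  ... | b , e = b , trans (rep r lt i) e

  onBit-just : ∀ {v b n j} → v ≡ just b → onBit v n j ≡ j b
  onBit-just refl = refl

  onBit-nothing : ∀ {v n j} → v ≡ nothing → onBit v n j ≡ n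
  onBit-nothing refl = refl

  push-ready : ∀ {r b} (inj : Fin 3 → State) e → (∀ p a → δ (inj p) a ≡ pushTr r b inj e p a) →
    r < R → ∀ {s t β} → Ready e (s [ r ≔ b ∷ s r ]) t β →
    Ready (inj zero) s (cost (length (s r)) + t) β
  push-ready {r} {b} inj e code r<R {s} {t} rd .from T rep =
    Good-mono (time n t)
      (go-right (code zero blank)
        (sweep {k = 1}
          (λ a x eq → trans (code (suc zero) a) (onBit-just eq))
          (λ a x eq → trans (code (suc (suc zero)) a) (onBit-just eq))
          n T (full-below {T} {s} n rep r<R refl ≤-refl)
          (λ l L t β → go-left (trans (code (suc zero) _) (onBit-nothing at-end)))
          (go-sit (trans (code (suc (suc zero)) blank) (onBit-nothing (get-blank R r)))
            (from rd (modAt n f T)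
              (Rep-upd {T} {modAt n f T} n r<R rep (nth-modAt {g} {f} acts n T) (nth-modAt-other {g} {f} acts n T)
                (col-top b (s r)) (col-below b (s r)))))))
    where
    n = length (s r)
    g : Cell → Cell
    g = set R r (just b)
    f : List Cell → List Cell
    f T = g (nth T 0) ∷ tl T
    acts : ActsOnHead g f
    acts T = refl , λ i → sym (nth-suc T i)
    at-end : get R r (nth (dropT n T) 0) ≡ nothing
    at-end = trans (cong (get R r) (nth-dropT n T)) (trans (rep r r<R n) (col-end (s r)))
    time : ∀ n t → suc (n + (1 + (n + suc t))) ≤ cost n + t
    time n t = ≤-trans (n≤1+n _) (≤-reflexive (solve 2 (λ n t →
      κ 2 :+ (n :+ (κ 1 :+ (n :+ (κ 1 :+ t)))) := κ 4 :+ (n :+ n) :+ t) refl n t))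

  pop-ready-[] : ∀ {r} (inj : Fin 5 → State) e e₀ e₁ → (∀ p a → δ (inj p) a ≡ popTr r inj e e₀ e₁ p a) →
    r < R → ∀ {s t β} → s r ≡ [] → Ready e s t β → Ready (inj zero) s (cost 0 + t) β
  pop-ready-[] {r} inj e e₀ e₁ code r<R {s} {t} eq rd .from T rep =
    Good-mono (n≤1+n _)
      (go-right (code zero blank)
        (go-left (trans (code (suc zero) (nth T 0))
            (onBit-nothing (trans (rep r r<R 0) (cong (λ l → col l 0) eq))))
          (go-sit (trans (code (suc (suc zero)) blank) (onBit-nothing (get-blank R r)))
            (from rd (pad T) (λ r' lt i → trans (cong (get R r') (nth-pad T i)) (rep r' lt i))))))

  popExit : Bool → State → State → State
  popExit false e₀ e₁ = e₀
  popExit true  e₀ e₁ = e₁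

  pop-ready-∷ : ∀ {r} (inj : Fin 5 → State) e e₀ e₁ → (∀ p a → δ (inj p) a ≡ popTr r inj e e₀ e₁ p a) →
    r < R → ∀ {s t β b l} → s r ≡ b ∷ l → Ready (popExit b e₀ e₁) (s [ r ≔ l ]) t β →
    Ready (inj zero) s (cost (length (s r)) + t) β
  pop-ready-∷ {r} inj e e₀ e₁ code r<R {s} {t} {β} {b} {l} eq rd .from T rep rewrite cong length eq =
    Good-mono (time n t)
      (go-right (code zero blank)
        (sweep {k = 3}
          (λ a x eq → trans (code (suc zero) a) (onBit-just eq))
          (λ a x eq → trans (ret-code b a) (onBit-just eq))
          n T (full-below {T} {s} n rep r<R eq (n≤1+n _)) turn
          (go-sit (trans (ret-code b blank) (onBit-nothing (get-blank R r)))
            (from rd (modAt n f T)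
              (Rep-upd {T} {modAt n f T} n r<R rep (nth-modAt {g} {f} acts n T) (nth-modAt-other {g} {f} acts n T) (col-end l)
                (λ i ne → trans (sym (col-below b l i ne)) (cong (λ k → col k i) (sym eq))))))))
    where
    n = length l
    ret : Bool → State
    ret b = inj (suc (suc (suc (ifB b zero (suc zero)))))
    ret-code : ∀ b a → δ (ret b) a ≡ onBit (get R r a) (sit (popExit b e₀ e₁) a) (λ _ → left (ret b) a)
    ret-code false a = code (suc (suc (suc zero))) a
    ret-code true  a = code (suc (suc (suc (suc zero)))) a
    g : Cell → Cell
    g = set R r nothing
    f : List Cell → List Cell
    -- The cell above the top has been visited, which is what `pad` records.
    f T = g (nth T 0) ∷ pad (tl T)
    acts : ActsOnHead g f
    acts T = refl , λ i → trans (nth-pad (tl T) i) (sym (nth-suc T i))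
    here-b : get R r (nth (dropT n T) 0) ≡ just b
    here-b = trans (cong (get R r) (nth-dropT n T))
      (trans (rep r r<R n) (trans (cong (λ k → col k n) eq) (col-top b l)))
    next : get R r (nth (tl (dropT n T)) 0) ≡ nothing
    next = trans (cong (get R r) (trans (sym (nth-suc (dropT n T) 0)) (nth-drop-suc n T)))
      (trans (rep r r<R (suc n)) (trans (cong (λ k → col k (suc n)) eq) (col-end (b ∷ l))))
      where
      nth-drop-suc : ∀ n T → nth (dropT n T) 1 ≡ nth T (suc n)
      nth-drop-suc zero    T = refl
      nth-drop-suc (suc n) T = trans (nth-drop-suc n (tl T)) (sym (nth-suc T (suc n)))
    turn : Turn (inj (suc zero)) (ret b) 3 f (dropT n T)
    turn l' L t β G = go-right (trans (code (suc zero) _) (onBit-just here-b))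
      (go-left (trans (code (suc zero) _) (onBit-nothing next))
        (go-left (trans (code (suc (suc zero)) _) (onBit-just here-b)) G))
    time : ∀ n t → suc (n + (3 + (n + suc t))) ≤ cost (suc n) + t
    time n t = ≤-trans (n≤1+n _) (≤-reflexive (solve 2 (λ n t →
      κ 2 :+ (n :+ (κ 3 :+ (n :+ (κ 1 :+ t)))) := κ 4 :+ (κ 1 :+ n :+ (κ 1 :+ n)) :+ t) refl n t))

  eraseN : ℕ → ℕ → List Cell → List Cell
  eraseN r zero    T = pad T
  eraseN r (suc n) T = set R r nothing (nth T 0) ∷ eraseN r n (tl T)

  get-eraseN : ∀ {r} → r < R → ∀ bs T → (∀ i → get R r (nth T i) ≡ idx bs i) →
    ∀ i → get R r (nth (eraseN r (length bs) T) i) ≡ nothing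
  get-eraseN lt []       T h i       = trans (cong (get R _) (nth-pad T i)) (h i)
  get-eraseN lt (b ∷ bs) T h zero    = get-set R nothing _ lt
  get-eraseN lt (b ∷ bs) T h (suc i) = get-eraseN lt bs (tl T)
    (λ i → trans (cong (get R _) (sym (nth-suc T i))) (h (suc i))) i

  get-eraseN-other : ∀ {r r'} → r' ≢ r → ∀ n T i → get R r' (nth (eraseN r n T) i) ≡ get R r' (nth T i)
  get-eraseN-other ne zero    T i       = cong (get R _) (nth-pad T i)
  get-eraseN-other ne (suc n) T zero    = get-set-other R nothing _ ne
  get-eraseN-other ne (suc n) T (suc i) =
    trans (get-eraseN-other ne n (tl T) i) (cong (get R _) (sym (nth-suc T i)))

  query-ready : ∀ {r} (inj : Fin 3 → State) e₀ e₁ → (∀ p a → δ (inj p) a ≡ queryTr r inj e₀ e₁ p a) →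
    r < R → ∀ {s t β} → Ready (popExit (A (s r)) e₀ e₁) (s [ r ≔ [] ]) t β →
    Ready (inj zero) s (cost (length (s r)) + t) β
  query-ready {r} inj e₀ e₁ code r<R {s} {t} {β} rd .from T rep =
    Good-mono (time n t)
      (go-right (code zero blank)
        (emit (reverse (s r)) T (rep r r<R)
          (Good-step (cong (map _) (trans (code (suc (suc zero)) blank) (onBit-nothing (get-blank R r))))
            (Good-step (answer T')
              (subst (λ q → Good t β (config (st q) [] blank T' [])) (exits (A (s r))) (from rd T' rep'))))))
    where
    n = length (s r)
    T' : List Cell
    T' = eraseN r (length (reverse (s r))) T
    rep' : Rep T' (s [ r ≔ [] ])
    rep' r' lt i with r' ≟ r
    ... | yes refl = get-eraseN lt (reverse (s r)) T (rep r lt) i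
    ... | no ne = trans (get-eraseN-other ne (length (reverse (s r))) T i) (rep r' lt i)
    exits : ∀ b → popExit b e₀ e₁ ≡ (if b then e₁ else e₀)
    exits false = refl
    exits true  = refl
    answer : ∀ T' → successors A (config (ask e₁ e₀) [] blank T' (reverse (reverse (s r)))) ≡
             config (st (if A (s r) then e₁ else e₀)) [] blank T' [] ∷ []
    answer T' rewrite reverse-involutive (s r) = refl
    emit : ∀ bs T → (∀ i → get R r (nth T i) ≡ idx bs i) → ∀ {l L t b} →
      Good t b (back (inj (suc (suc zero))) l L (eraseN r (length bs) T) (reverse bs)) →
      Good (length bs + (1 + (length bs + t))) b (at (inj (suc zero)) (l ∷ L) T [])
    emit [] T h G = go-left (trans (code (suc zero) _) (onBit-nothing (h 0))) G
    emit (b ∷ bs) T h {l} {L} {t} {β} G rewrite unfold-reverse b bs =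
      go-right (trans (code (suc zero) _) (onBit-just (h 0)))
        (subst (λ m → Good (length bs + (1 + m)) β (at (inj (suc zero)) (nth T 0 ∷ l ∷ L) (tl T) [])) (+-suc (length bs) t)
          (emit bs (tl T) (λ i → trans (cong (get R r) (sym (nth-suc T i))) (h (suc i)))
            (Good-step (cong (map (apply (config (st (inj (suc (suc zero)))) (l ∷ L) (nth T 0)
                                           (eraseN r (length bs) (tl T)) (reverse bs))))
                         (trans (code (suc (suc zero)) _) (onBit-just (h 0)))) G)))
    time : ∀ n t → suc (length (reverse (s r)) + (1 + (length (reverse (s r)) + suc (suc t)))) ≤
                   cost (length (s r)) + t
    time _ t rewrite length-reverse (s r) = ≤-reflexive (solve 2 (λ n t →
      κ 1 :+ (n :+ (κ 1 :+ (n :+ (κ 2 :+ t)))) := κ 4 :+ (n :+ n) :+ t) refl n t)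

  -- The statement works backwards from the exit: an outcome known there is the outcome at the
  -- entry, at the price of the execution time. Commands in sequence then compose as implications,
  -- and any nondeterminism is hidden in the continuation.
  sound : ∀ c (inj : St c → State) e → (∀ p a → δ (inj p) a ≡ instr c inj e p a) → Uses≤ R c →
    ∀ {s t s' t' β} → Exec A c s t s' → Ready e s' t' β → Ready (inj (entry c)) s (t + t') β
  sound c inj e code u {t' = t''} (weaken {t = t} {t'} e₁ le e₂ ex) rd .from T rep =
    Good-mono (+-monoˡ-≤ t'' le)
      (from (sound c inj e code u ex rd′) T (Rep-cong {T} e₁ rep))
    where
    rd′ : Ready e _ t'' _
    rd′ .from T' rep' = from rd T' (Rep-cong {T'} e₂ rep')
  sound skip inj e code u skip rd .from T rep = go-sit (code zero blank) (from rd T rep)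
  sound (c ⨾ d) inj e code (u , v) {s} {t' = t''} {β} (seq {t = t} {t' = t'} x y) rd =
    retime (inj (entry (c ⨾ d))) s β (sym (+-assoc t t' t''))
      (sound c _ _ (code ∘ inj₁) u x (sound d _ _ (code ∘ inj₂) v y rd))
  sound (push r b) inj e code u push rd = push-ready inj e code u rd
  sound (pop r c d f) inj e code (h , u , v , w) {s} {t' = t'} {β} (pop[] {t = t} eq x) rd =
    retime (inj (inj₁ zero)) s β (sym (+-assoc (cost 0) t t'))
      (pop-ready-[] _ _ _ _ (code ∘ inj₁) h eq (sound c _ _ (code ∘ inj₂ ∘ inj₁) u x rd))
  sound (pop r c d f) inj e code (h , u , v , w) {s = s} {t' = t'} {β} (pop0 {t = t} eq x) rd =
    retime (inj (inj₁ zero)) s β (sym (+-assoc (cost (length (s r))) t t'))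
      (pop-ready-∷ _ _ _ _ (code ∘ inj₁) h eq (sound d _ _ (code ∘ inj₂ ∘ inj₂ ∘ inj₁) v x rd))
  sound (pop r c d f) inj e code (h , u , v , w) {s = s} {t' = t'} {β} (pop1 {t = t} eq x) rd =
    retime (inj (inj₁ zero)) s β (sym (+-assoc (cost (length (s r))) t t'))
      (pop-ready-∷ _ _ _ _ (code ∘ inj₁) h eq (sound f _ _ (code ∘ inj₂ ∘ inj₂ ∘ inj₂) w x rd))
  sound (loop r c d) inj e code (h , u , v) (loop[] eq) rd =
    pop-ready-[] _ _ _ _ (code ∘ inj₁) h eq rd
  sound (loop r c d) inj e code (h , u , v) {s = s} {t' = t''} {β} (loop0 {t = t} {t' = t'} eq x y) rd =
    retime (inj (inj₁ zero)) s β (assoc₃ (cost (length (s r))) t t' t'')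
      (pop-ready-∷ _ _ _ _ (code ∘ inj₁) h eq
        (sound c _ _ (code ∘ inj₂ ∘ inj₁) u x (sound (loop r c d) inj e code (h , u , v) y rd)))
  sound (loop r c d) inj e code (h , u , v) {s = s} {t' = t''} {β} (loop1 {t = t} {t' = t'} eq x y) rd =
    retime (inj (inj₁ zero)) s β (assoc₃ (cost (length (s r))) t t' t'')
      (pop-ready-∷ _ _ _ _ (code ∘ inj₁) h eq
        (sound d _ _ (code ∘ inj₂ ∘ inj₂) v x (sound (loop r c d) inj e code (h , u , v) y rd)))
  sound (query r c d) inj e code (h , u , v) {s = s} {t' = t'} {β} (query0 {t = t} eq x) rd =
    retime (inj (inj₁ zero)) s β (sym (+-assoc (cost (length (s r))) t t'))
      (query-ready (inj ∘ inj₁) (inj (inj₂ (inj₁ (entry c)))) (inj (inj₂ (inj₂ (entry d)))) (code ∘ inj₁) h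
        (subst (λ b → Ready (popExit b _ _) (s [ r ≔ [] ]) (t + t') β) (sym eq) (sound c _ _ (code ∘ inj₂ ∘ inj₁) u x rd)))
  sound (query r c d) inj e code (h , u , v) {s = s} {t' = t'} {β} (query1 {t = t} eq x) rd =
    retime (inj (inj₁ zero)) s β (sym (+-assoc (cost (length (s r))) t t'))
      (query-ready (inj ∘ inj₁) (inj (inj₂ (inj₁ (entry c)))) (inj (inj₂ (inj₂ (entry d)))) (code ∘ inj₁) h
        (subst (λ b → Ready (popExit b _ _) (s [ r ≔ [] ]) (t + t') β) (sym eq) (sound d _ _ (code ∘ inj₂ ∘ inj₂) v x rd)))

  choose-ready : ∀ c d (inj : St (choose c d) → State) e → (∀ p a → δ (inj p) a ≡ instr (choose c d) inj e p a) →
    ∀ {s t b₀ b₁} → Ready (inj (inj₂ (inj₁ (entry c)))) s t b₀ → Ready (inj (inj₂ (inj₂ (entry d)))) s t b₁ →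
    Ready (inj (entry (choose c d))) s (suc t) (b₀ ∨ b₁)
  choose-ready c d inj e code r₀ r₁ .from T rep =
    Good-branch (cong (map _) (code (inj₁ zero) blank)) (from r₀ T rep) (from r₁ T rep)

  halt-ready : ∀ b (inj : St (halt b) → State) e → (∀ p a → δ (inj p) a ≡ instr (halt b) inj e p a) →
    ∀ {s} → Ready (inj zero) s 1 b
  halt-ready false inj e code .from T rep = Good-step (cong (map _) (code zero blank)) Good-rej
  halt-ready true  inj e code .from T rep = Good-step (cong (map _) (code zero blank)) Good-acc

-- Functions computable in polynomial time

infixl 6 _⊞_
infixl 7 _⊠_

data Poly : Set where
  con  : ℕ → Poly
  var  : Poly
  _⊞_ _⊠_ _⟨_⟩ : Poly → Poly → Poly

⟦_⟧ : Poly → ℕ → ℕ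
⟦ con c ⟧   n = c
⟦ var ⟧     n = n
⟦ P ⊞ Q ⟧   n = ⟦ P ⟧ n + ⟦ Q ⟧ n
⟦ P ⊠ Q ⟧   n = ⟦ P ⟧ n * ⟦ Q ⟧ n
⟦ P ⟨ Q ⟩ ⟧ n = ⟦ P ⟧ (⟦ Q ⟧ n)

⟦⟧-mono : ∀ P {n n'} → n ≤ n' → ⟦ P ⟧ n ≤ ⟦ P ⟧ n'
⟦⟧-mono (con c)   le = ≤-refl
⟦⟧-mono var       le = le
⟦⟧-mono (P ⊞ Q)   le = +-mono-≤ (⟦⟧-mono P le) (⟦⟧-mono Q le)
⟦⟧-mono (P ⊠ Q)   le = *-mono-≤ (⟦⟧-mono P le) (⟦⟧-mono Q le)
⟦⟧-mono (P ⟨ Q ⟩) le = ⟦⟧-mono P (⟦⟧-mono Q le)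

pow : ℕ → Poly
pow zero    = con 1
pow (suc k) = var ⊠ pow k

⟦pow⟧ : ∀ k n → ⟦ pow k ⟧ n ≡ n ^ k
⟦pow⟧ zero    n = refl
⟦pow⟧ (suc k) n = cong (n *_) (⟦pow⟧ k n)

n<2^n : ∀ n → n < 2 ^ n
n<2^n zero    = s≤s z≤n
n<2^n (suc n) = begin-strict
  suc n             ≤⟨ n<2^n n ⟩
  2 ^ n             <⟨ m<m+n (2 ^ n) (≤-trans (s≤s z≤n) (n<2^n n)) ⟩
  2 ^ n + 2 ^ n     ≡⟨ cong (2 ^ n +_) (sym (+-identityʳ (2 ^ n))) ⟩
  2 ^ suc n         ∎
  where open ≤-Reasoning

-- n + 2 ≥ 2 lets a single power absorb sums and constants.
poly-degree : ∀ P → ∃ λ e → ∀ n → ⟦ P ⟧ n ≤ (2 + n) ^ e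
poly-degree (con c) = c , λ n → ≤-trans (<⇒≤ (n<2^n c)) (^-monoˡ-≤ c (m≤m+n 2 n))
poly-degree var = 1 , λ n → ≤-trans (m≤n+m n 2) (≤-reflexive (sym (*-identityʳ (2 + n))))
poly-degree (P ⊞ Q) with poly-degree P | poly-degree Q
... | a , p | b , q = suc (a + b) , λ n → begin
  ⟦ P ⟧ n + ⟦ Q ⟧ n                      ≤⟨ +-mono-≤ (p n) (q n) ⟩
  (2 + n) ^ a + (2 + n) ^ b              ≤⟨ +-mono-≤ (^-monoʳ-≤ (2 + n) (m≤m+n a b)) (^-monoʳ-≤ (2 + n) (m≤n+m b a)) ⟩
  (2 + n) ^ (a + b) + (2 + n) ^ (a + b)  ≡⟨ cong ((2 + n) ^ (a + b) +_) (sym (+-identityʳ _)) ⟩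
  2 * (2 + n) ^ (a + b)                  ≤⟨ *-monoˡ-≤ ((2 + n) ^ (a + b)) (m≤m+n 2 n) ⟩
  (2 + n) ^ suc (a + b)                  ∎
  where open ≤-Reasoning
poly-degree (P ⊠ Q) with poly-degree P | poly-degree Q
... | a , p | b , q = a + b , λ n → ≤-trans (*-mono-≤ (p n) (q n))
  (≤-reflexive (sym (^-distribˡ-+-* (2 + n) a b)))
poly-degree (P ⟨ Q ⟩) with poly-degree P | poly-degree Q
... | a , p | b , q = (2 + b) * a , λ n → begin
  ⟦ P ⟧ (⟦ Q ⟧ n)            ≤⟨ p (⟦ Q ⟧ n) ⟩
  (2 + ⟦ Q ⟧ n) ^ a          ≤⟨ ^-monoˡ-≤ a (absorb n) ⟩
  ((2 + n) ^ (2 + b)) ^ a    ≡⟨ ^-*-assoc (2 + n) (2 + b) a ⟩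
  (2 + n) ^ ((2 + b) * a)    ∎
  where
  open ≤-Reasoning
  absorb : ∀ n → 2 + ⟦ Q ⟧ n ≤ (2 + n) ^ (2 + b)
  absorb n = begin
    2 + ⟦ Q ⟧ n                ≤⟨ +-mono-≤ (≤-trans (^-monoʳ-≤ 2 {1} {1 + b} (s≤s z≤n)) (^-monoˡ-≤ (1 + b) (m≤m+n 2 n)))
                                         (≤-trans (q n) (^-monoʳ-≤ (2 + n) (n≤1+n b))) ⟩
    (2 + n) ^ suc b + (2 + n) ^ suc b  ≡⟨ cong ((2 + n) ^ suc b +_) (sym (+-identityʳ _)) ⟩
    2 * (2 + n) ^ suc b        ≤⟨ *-monoˡ-≤ ((2 + n) ^ suc b) (m≤m+n 2 n) ⟩
    (2 + n) ^ (2 + b)          ∎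

^-distribʳ-* : ∀ e m n → (m * n) ^ e ≡ m ^ e * n ^ e
^-distribʳ-* zero    m n = refl
^-distribʳ-* (suc e) m n = trans (cong (m * n *_) (^-distribʳ-* e m n))
  (solve 4 (λ m n x y → m :* n :* (x :* y) := m :* x :* (n :* y)) refl m n (m ^ e) (n ^ e))

-- `PolyTime` wants one number as factor, exponent and summand. `3 ^ e` is large enough for all
-- three: `2 + n` is at most `3 * n` for positive `n`, `e` is at most `3 ^ e`, and at `n = 0` the
-- value `2 ^ e` is below the summand.
poly-bound : ∀ P → ∃ λ k → ∀ n → ⟦ P ⟧ n ≤ k * n ^ k + k
poly-bound P with poly-degree P
... | e , p = 3 ^ e , λ n → ≤-trans (p n) (go n)
  where
  open ≤-Reasoning
  e≤ : e ≤ 3 ^ e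
  e≤ = ≤-trans (<⇒≤ (n<2^n e)) (^-monoˡ-≤ e {2} {3} (s≤s (s≤s z≤n)))
  go : ∀ n → (2 + n) ^ e ≤ 3 ^ e * n ^ (3 ^ e) + 3 ^ e
  go zero = ≤-trans (^-monoˡ-≤ e {2} {3} (s≤s (s≤s z≤n))) (m≤n+m (3 ^ e) _)
  go n@(suc n') = begin
    (2 + n) ^ e                   ≤⟨ ^-monoˡ-≤ e (+-monoˡ-≤ n (*-monoʳ-≤ 2 {1} {n} (s≤s z≤n))) ⟩
    (2 * n + n) ^ e               ≡⟨ cong (_^ e) (+-comm (2 * n) n) ⟩
    (3 * n) ^ e                   ≡⟨ ^-distribʳ-* e 3 n ⟩
    3 ^ e * n ^ e                 ≤⟨ *-monoʳ-≤ (3 ^ e) (^-monoʳ-≤ n e≤) ⟩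
    3 ^ e * n ^ (3 ^ e)           ≤⟨ m≤m+n _ (3 ^ e) ⟩
    3 ^ e * n ^ (3 ^ e) + 3 ^ e   ∎

-- A self-delimiting code: `true` announces a bit of the first component, `false` its end. On a
-- stack, one push turns `y` into the pair of `[]` and `y`, and two pushes extend the first
-- component by a bit.
pr : Str → Str → Str
pr []      y = false ∷ y
pr (b ∷ x) y = true ∷ b ∷ pr x y

unpr : Str → Str × Str
unpr []               = [] , []
unpr (false ∷ y)      = [] , y
unpr (true ∷ [])      = [] , []
unpr (true ∷ b ∷ z)   = b ∷ proj₁ (unpr z) , proj₂ (unpr z)

unpr-pr : ∀ x y → unpr (pr x y) ≡ (x , y)
unpr-pr []      y = refl
unpr-pr (b ∷ x) y rewrite unpr-pr x y = refl

length-pr : ∀ x y → length (pr x y) ≡ suc (length x + length x + length y)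
length-pr []      y = refl
length-pr (b ∷ x) y = cong suc (trans (cong suc (length-pr x y))
  (cong (λ n → suc (n + length y)) (sym (+-suc (length x) (length x)))))

length-unpr : ∀ z → length (proj₁ (unpr z)) + length (proj₁ (unpr z)) + length (proj₂ (unpr z)) ≤ length z
length-unpr []             = z≤n
length-unpr (false ∷ y)    = n≤1+n _
length-unpr (true ∷ [])    = z≤n
length-unpr (true ∷ b ∷ z) rewrite +-suc (length (proj₁ (unpr z))) (length (proj₁ (unpr z))) =
  s≤s (s≤s (length-unpr z))

record Coded : Set₁ where
  no-eta-equality
  field
    Carrier : Set
    enc     : Carrier → Str

open Coded public

size : (X : Coded) → Carrier X → ℕ
size X a = length (enc X a)

infixr 6 _⊗_

_⊗_ : Coded → Coded → Coded
(X ⊗ Y) .Carrier = Carrier X × Carrier Y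
(X ⊗ Y) .enc p   = pr (enc X (proj₁ p)) (enc Y (proj₂ p))

str : Coded
str .Carrier = Str
str .enc x   = x

bool : Coded
bool .Carrier = Bool
bool .enc b   = [ b ]

unit : Coded
unit .Carrier = ⊤
unit .enc _   = []

void : Coded
void .Carrier = ⊥
void .enc ()

prefixed : Str → Coded → Coded
prefixed p X .Carrier = Carrier X
prefixed p X .enc a   = p ++ enc X a

Clean : ℕ → Store → Set
Clean n s = ∀ i → 0 < i → i < n → s i ≡ []

-- The argument and the value are in register 0; registers that the program does
-- not use may hold anything, which lets a caller save data there.
record FP (B : Lang) (X Y : Coded) (f : Carrier X → Carrier Y) : Set where
  field
    prog : Cmd
    regs : ℕ
    uses : Uses≤ regs prog
    det  : Det prog
    time : Poly
    out≤ : ∀ a → size Y (f a) ≤ ⟦ time ⟧ (size X a)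
    exec : ∀ a s → s 0 ≡ enc X a → Clean regs s →
           Exec B prog s (⟦ time ⟧ (size X a)) (s [ 0 ≔ enc Y (f a) ])

open FP public

FP₂ : Lang → (Str → Str → Bool) → Set
FP₂ B f = FP B (str ⊗ str) bool (λ p → f (proj₁ p) (proj₂ p))

upd-id : ∀ s {r x} → s r ≡ x → s [ r ≔ x ] ≗ s
upd-id s {r} e i with i ≟ r
... | yes refl = sym e
... | no _ = refl

upd-upd : ∀ s r x y → (s [ r ≔ x ]) [ r ≔ y ] ≗ s [ r ≔ y ]
upd-upd s r x y i with i ≟ r
... | yes _ = refl
... | no ne with i ≟ r
... | yes e = ⊥-elim (ne e)
... | no _ = refl

≗-refl : ∀ {s : Store} → s ≗ s
≗-refl i = refl

≗-sym : ∀ {s s' : Store} → s ≗ s' → s' ≗ s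
≗-sym e i = sym (e i)

≗-trans : ∀ {s s' s'' : Store} → s ≗ s' → s' ≗ s'' → s ≗ s''
≗-trans e f i = trans (e i) (f i)

clean-upd : ∀ {n s x} → Clean n s → Clean n (s [ 0 ≔ x ])
clean-upd {s = s} c i lt lt' = trans (upd-other s _ (λ { refl → n≮n 0 lt })) (c i lt lt')

clean-mono : ∀ {n n' s} → n ≤ n' → Clean n' s → Clean n s
clean-mono le c i lt lt' = c i lt (≤-trans lt' le)

cost-mono : ∀ {m n} → m ≤ n → cost m ≤ cost n
cost-mono le = +-monoʳ-≤ 4 (+-mono-≤ le le)

costP : Poly → Poly
costP P = con 4 ⊞ (P ⊞ P)

to : ∀ {A c s t s' s''} → s' ≗ s'' → Exec A c s t s' → Exec A c s t s''
to e x = weaken ≗-refl ≤-refl e x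

within : ∀ {A c s t t' s'} → t ≤ t' → Exec A c s t s' → Exec A c s t' s'
within le x = weaken ≗-refl le ≗-refl x

-- Many steps only change the type under which the same string is read, such as a pair read as a
-- string; they cost no computation.
recode : ∀ {B X Y f} → (∀ a → enc Y (f a) ≡ enc X a) → FP B X Y f
recode e .prog = skip
recode e .regs = 0
recode e .uses = tt
recode e .det  = tt
recode e .time = con 1 ⊞ var
recode {X = X} e .out≤ a = ≤-trans (≤-reflexive (cong length (e a))) (n≤1+n _)
recode e .exec a s s0 cl = weaken ≗-refl (s≤s z≤n) (≗-sym (upd-id s (trans s0 (sym (e a))))) skip

ext : ∀ {B X Y f g} → (∀ a → f a ≡ g a) → FP B X Y f → FP B X Y g
ext e F .prog = prog F
ext e F .regs = regs F
ext e F .uses = uses F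
ext e F .det  = det F
ext e F .time = time F
ext {Y = Y} e F .out≤ a = subst (λ y → size Y y ≤ _) (e a) (out≤ F a)
ext {B = B} {Y = Y} e F .exec a s s0 cl =
  subst (λ y → Exec B (prog F) s _ (s [ 0 ≔ enc Y y ])) (e a) (exec F a s s0 cl)

infixr 9 _∙_

_∙_ : ∀ {B X Y Z f g} → FP B Y Z g → FP B X Y f → FP B X Z (g ∘ f)
(G ∙ F) .prog = prog F ⨾ prog G
(G ∙ F) .regs = regs F ⊔ regs G
(G ∙ F) .uses = Uses-mono (prog F) (m≤m⊔n _ _) (uses F) , Uses-mono (prog G) (m≤n⊔m (regs F) _) (uses G)
(G ∙ F) .det  = det F , det G
(G ∙ F) .time = time F ⊞ time G ⟨ time F ⟩
_∙_ {f = f} G F .out≤ a =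
  ≤-trans (out≤ G (f a)) (≤-trans (⟦⟧-mono (time G) (out≤ F a)) (m≤n+m _ (⟦ time F ⟧ _)))
_∙_ {B = B} {X} {Y} {Z} {f} {g} G F .exec a s s0 cl =
  within (+-monoʳ-≤ (⟦ time F ⟧ (size X a)) (⟦⟧-mono (time G) (out≤ F a)))
    (seq (exec F a s s0 (clean-mono (m≤m⊔n _ _) cl))
      (to (upd-upd s 0 (enc Y (f a)) (enc Z (g (f a))))
        (exec G (f a) (s [ 0 ≔ enc Y (f a) ]) (upd-same s 0 _)
          (clean-upd {s = s} (clean-mono (m≤n⊔m (regs F) _) cl)))))

pushF : ∀ {B X Y f} b → (∀ a → enc Y (f a) ≡ b ∷ enc X a) → FP B X Y f
pushF b e .prog = push 0 b
pushF b e .regs = 1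
pushF b e .uses = s≤s z≤n
pushF b e .det  = tt
pushF b e .time = costP var
pushF {X = X} b e .out≤ a = ≤-trans (≤-reflexive (cong length (e a))) (s≤s (m≤n+m (size X a) (3 + size X a)))
pushF {X = X} {Y} {f} b e .exec a s s0 cl =
  within (≤-reflexive (cong (cost ∘ length) s0))
    (to (λ i → cong (λ x → (s [ 0 ≔ x ]) i) (trans (cong (b ∷_) s0) (sym (e a)))) push)

prefix : ∀ {B X} p → FP B X (prefixed p X) (λ a → a)
prefix []      = recode (λ _ → refl)
prefix (b ∷ p) = pushF b (λ _ → refl) ∙ prefix p

-- What follows the first bit of a code is in general the code of a value of another type, and each
-- branch continues with its own. A branch that cannot occur gets the type `void`.
data View {X X₀ X₁ X₂ Y : Coded} (f : Carrier X → Carrier Y) (f₀ : Carrier X₀ → Carrier Y)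
          (f₁ : Carrier X₁ → Carrier Y) (f₂ : Carrier X₂ → Carrier Y) (a : Carrier X) : Set where
  is[] : ∀ a' → enc X a ≡ [] → enc X₀ a' ≡ [] → enc Y (f a) ≡ enc Y (f₀ a') → View f f₀ f₁ f₂ a
  is0  : ∀ a' → enc X a ≡ false ∷ enc X₁ a' → enc Y (f a) ≡ enc Y (f₁ a') → View f f₀ f₁ f₂ a
  is1  : ∀ a' → enc X a ≡ true ∷ enc X₂ a' → enc Y (f a) ≡ enc Y (f₂ a') → View f f₀ f₁ f₂ a

popF : ∀ {B X X₀ X₁ X₂ Y f f₀ f₁ f₂} → FP B X₀ Y f₀ → FP B X₁ Y f₁ → FP B X₂ Y f₂ →
  (∀ a → View {X} {X₀} {X₁} {X₂} {Y} f f₀ f₁ f₂ a) → FP B X Y f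
popF F G H v .prog = pop 0 (prog F) (prog G) (prog H)
popF F G H v .regs = 1 ⊔ (regs F ⊔ (regs G ⊔ regs H))
popF F G H v .uses = m≤m⊔n 1 (regs F ⊔ (regs G ⊔ regs H)) ,
  Uses-mono (prog F) (≤-trans (m≤m⊔n _ _) (m≤n⊔m 1 _)) (uses F) ,
  Uses-mono (prog G) (≤-trans (≤-trans (m≤m⊔n _ _) (m≤n⊔m (regs F) _)) (m≤n⊔m 1 _)) (uses G) ,
  Uses-mono (prog H) (≤-trans (≤-trans (m≤n⊔m (regs G) _) (m≤n⊔m (regs F) _)) (m≤n⊔m 1 _)) (uses H)
popF F G H v .det  = det F , det G , det H
popF F G H v .time = costP var ⊞ (time F ⊞ (time G ⊞ time H))
popF {X = X} {X₀} {X₁} {X₂} {Y} F G H v .out≤ a with v a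
... | is[] a' e e₀ e' = ≤-trans (≤-reflexive (cong length e')) (≤-trans (out≤ F a')
        (≤-trans (⟦⟧-mono (time F) (≤-reflexive (cong length (trans e₀ (sym e)))))
          (≤-trans (m≤m+n (⟦ time F ⟧ (size X a)) (⟦ time G ⟧ (size X a) + ⟦ time H ⟧ (size X a)))
            (m≤n+m _ (cost (size X a))))))
... | is0 a' e e' = ≤-trans (≤-reflexive (cong length e')) (≤-trans (out≤ G a')
        (≤-trans (⟦⟧-mono (time G) (≤-trans (n≤1+n _) (≤-reflexive (cong length (sym e)))))
          (≤-trans (≤-trans (m≤m+n _ _) (m≤n+m _ (⟦ time F ⟧ _))) (m≤n+m _ (cost (size X a))))))
... | is1 a' e e' = ≤-trans (≤-reflexive (cong length e')) (≤-trans (out≤ H a')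
        (≤-trans (⟦⟧-mono (time H) (≤-trans (n≤1+n _) (≤-reflexive (cong length (sym e)))))
          (≤-trans (≤-trans (m≤n+m _ (⟦ time G ⟧ _)) (m≤n+m _ (⟦ time F ⟧ _))) (m≤n+m _ (cost (size X a))))))
popF {B} {X = X} {X₀} {X₁} {X₂} {Y} F G H v .exec a s s0 cl with v a
... | is[] a' e e₀ e' =
  within (+-mono-≤ (cost-mono {0} {size X a} z≤n)
           (≤-trans (⟦⟧-mono (time F) (≤-reflexive (cong length (trans e₀ (sym e)))))
             (m≤m+n (⟦ time F ⟧ (size X a)) (⟦ time G ⟧ (size X a) + ⟦ time H ⟧ (size X a)))))
    (pop[] (trans s0 e)
      (to (λ i → cong (λ y → (s [ 0 ≔ y ]) i) (sym e'))
        (exec F a' s (trans s0 (trans e (sym e₀)))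
          (clean-mono (≤-trans (m≤m⊔n _ _) (m≤n⊔m 1 _)) cl))))
... | is0 a' e e' =
  within (+-mono-≤ (≤-reflexive (cong (cost ∘ length) s0))
           (≤-trans (⟦⟧-mono (time G) (≤-trans (n≤1+n _) (≤-reflexive (cong length (sym e)))))
             (≤-trans (m≤m+n _ _) (m≤n+m _ (⟦ time F ⟧ _)))))
    (pop0 (trans s0 e)
      (to (λ i → trans (upd-upd s 0 _ _ i) (cong (λ y → (s [ 0 ≔ y ]) i) (sym e')))
        (exec G a' (s [ 0 ≔ enc X₁ a' ]) (upd-same s 0 _)
          (clean-upd {s = s} (clean-mono (≤-trans (≤-trans (m≤m⊔n _ _) (m≤n⊔m (regs F) _)) (m≤n⊔m 1 _)) cl)))))
... | is1 a' e e' =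
  within (+-mono-≤ (≤-reflexive (cong (cost ∘ length) s0))
           (≤-trans (⟦⟧-mono (time H) (≤-trans (n≤1+n _) (≤-reflexive (cong length (sym e)))))
             (≤-trans (m≤n+m _ (⟦ time G ⟧ _)) (m≤n+m _ (⟦ time F ⟧ _)))))
    (pop1 (trans s0 e)
      (to (λ i → trans (upd-upd s 0 _ _ i) (cong (λ y → (s [ 0 ≔ y ]) i) (sym e')))
        (exec H a' (s [ 0 ≔ enc X₂ a' ]) (upd-same s 0 _)
          (clean-upd {s = s} (clean-mono (≤-trans (≤-trans (m≤n⊔m (regs G) _) (m≤n⊔m (regs F) _)) (m≤n⊔m 1 _)) cl)))))

oracle : ∀ {B} → FP B str bool B
oracle .prog = query 0 (push 0 false) (push 0 true)
oracle .regs = 1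
oracle .uses = s≤s z≤n , s≤s z≤n , s≤s z≤n
oracle .det  = tt , tt
oracle .time = costP var ⊞ con 4
oracle .out≤ x = s≤s z≤n
oracle {B} .exec x s s0 cl with B x in eq
... | false = within (+-mono-≤ (≤-reflexive (cong (cost ∘ length) s0)) ≤-refl)
  (query0 (trans (cong B s0) eq) (to (upd-upd s 0 [] [ false ]) push))
... | true  = within (+-mono-≤ (≤-reflexive (cong (cost ∘ length) s0)) ≤-refl)
  (query1 (trans (cong B s0) eq) (to (upd-upd s 0 [] [ true ]) push))

-- Loops, copying and pairing of registers

≤-by : ∀ {a b} k → a + k ≡ b → a ≤ b
≤-by k refl = m≤m+n _ k

pre : ∀ {A c s₀ s t s'} → s₀ ≗ s → Exec A c s t s' → Exec A c s₀ t s'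
pre e x = weaken e ≤-refl ≗-refl x

module Loop {B : Lang} {V : Set} (r : ℕ) (c₀ c₁ : Cmd) (T : Str → V → Store) (stp : Bool → V → V)
  (N K : ℕ) (Inv : Str → V → Set)
  (top    : ∀ l v → T l v r ≡ l)
  (popped : ∀ b l v → (T (b ∷ l) v) [ r ≔ l ] ≗ T l v)
  (body   : ∀ b l v → Inv (b ∷ l) v → Exec B (if b then c₁ else c₀) (T l v) K (T l (stp b v)))
  (inv    : ∀ b l v → Inv (b ∷ l) v → Inv l (stp b v))
  (len    : ∀ l v → Inv l v → length l ≤ N)
  where

  round : ∀ b l v {t} → Inv (b ∷ l) v → Exec B (loop r c₀ c₁) (T l (stp b v)) t (T [] (foldl (flip stp) (stp b v) l)) →
          Exec B (loop r c₀ c₁) (T (b ∷ l) v) (cost (length (T (b ∷ l) v r)) + (K + t)) (T [] (foldl (flip stp) (stp b v) l))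
  round false l v i x = loop0 (top _ v) (pre (popped false l v) (body false l v i)) x
  round true  l v i x = loop1 (top _ v) (pre (popped true l v) (body true l v i)) x

  -- A loop pops register `r` from the top, so it computes a left fold. `Inv` ties the accumulator
  -- to the part still to be read, and this is what lets one `K` bound every round.
  loop-fold : ∀ l v → Inv l v →
    Exec B (loop r c₀ c₁) (T l v) (suc (length l) * (cost N + K)) (T [] (foldl (flip stp) v l))
  loop-fold [] v i = within (≤-trans (cost-mono {0} {N} z≤n) (≤-trans (m≤m+n _ K) (≤-reflexive (sym (+-identityʳ _)))))
    (loop[] (top [] v))
  loop-fold (b ∷ l) v i = within
    (≤-trans (+-monoˡ-≤ _ (cost-mono {_} {N} (subst (λ k → length k ≤ N) (sym (top (b ∷ l) v)) (len _ v i))))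
      (≤-reflexive (sym (+-assoc (cost N) K _))))
    (round b l v i (loop-fold l (stp b v) (inv b l v i)))

-- A `loop` is controlled by its register, so register `m + 1` holds a flag that a round restores
-- exactly when it has read a bit of the first component. That component ends up reversed in
-- register `m`, the second stays in register 0.
split-step split : ℕ → Cmd
split-step m = pop 0 skip skip
  (pop 0 skip (push m false ⨾ push (suc m) true) (push m true ⨾ push (suc m) true))
split m = push (suc m) true ⨾ loop (suc m) (split-step m) (split-step m)

split-uses : ∀ m → Uses≤ (suc (suc m)) (split m)
split-uses m = ≤-refl , ≤-refl , step , step
  where
  step : Uses≤ (suc (suc m)) (split-step m)
  step = s≤s z≤n , tt , tt , s≤s z≤n , tt , (n≤1+n _ , ≤-refl) , (n≤1+n _ , ≤-refl)

split-det : ∀ m → Det (split m)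
split-det m = tt , (tt , tt , tt , (tt , tt) , (tt , tt)) , (tt , tt , tt , (tt , tt) , (tt , tt))

-- Registers `m` and `m + 1` are scratch. With `m` above the registers of a called program, the
-- program meets a clean store and preserves what is saved there.
module Frame (s : Store) (m : ℕ) (0<m : 0 < m) where

  sel : ∀ {i j k : ℕ} → Dec (i ≡ 0) → Dec (i ≡ j) → Dec (i ≡ k) → Str → Str → Str → Str → Str
  sel (yes _) _       _       x y z w = x
  sel (no _)  (yes _) _       x y z w = y
  sel (no _)  (no _)  (yes _) x y z w = z
  sel (no _)  (no _)  (no _)  x y z w = w

  S : Str → Str → Str → Store
  S x y z i = sel (i ≟ 0) (i ≟ m) (i ≟ suc m) x y z (s i)

  S-m : ∀ x y z → S x y z m ≡ y
  S-m x y z with m ≟ 0 | m ≟ m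
  ... | yes e | _ = ⊥-elim (<⇒≢ 0<m (sym e))
  ... | no _ | yes _ = refl
  ... | no _ | no ne = ⊥-elim (ne refl)

  S-m1 : ∀ x y z → S x y z (suc m) ≡ z
  S-m1 x y z with suc m ≟ m | suc m ≟ suc m
  ... | yes e | _ = ⊥-elim (1+n≢n e)
  ... | no _ | yes _ = refl
  ... | no _ | no ne = ⊥-elim (ne refl)

  upd-0 : ∀ x y z x' → (S x y z) [ 0 ≔ x' ] ≗ S x' y z
  upd-0 x y z x' i with i ≟ 0 | i ≟ m | i ≟ suc m
  ... | yes _ | _     | _     = refl
  ... | no _  | yes _ | _     = refl
  ... | no _  | no _  | yes _ = refl
  ... | no _  | no _  | no _  = refl

  upd-m : ∀ x y z y' → (S x y z) [ m ≔ y' ] ≗ S x y' z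
  upd-m x y z y' i with i ≟ m | i ≟ 0
  ... | yes refl | yes refl = ⊥-elim (n≮n 0 0<m)
  ... | yes _ | no _ = refl
  ... | no _  | yes _ = refl
  ... | no _  | no _ with i ≟ suc m
  ... | yes _ = refl
  ... | no _  = refl

  upd-m1 : ∀ x y z z' → (S x y z) [ suc m ≔ z' ] ≗ S x y z'
  upd-m1 x y z z' i with i ≟ suc m | i ≟ 0 | i ≟ m
  ... | yes refl | yes () | _
  ... | yes refl | no _ | yes e = ⊥-elim (1+n≢n e)
  ... | yes _ | no _ | no _ = refl
  ... | no _ | yes _ | _ = refl
  ... | no _ | no _ | yes _ = refl
  ... | no _ | no _ | no _ = refl

  module _ {B : Lang} {N : ℕ} where
    push-0 : ∀ {b} x y z → length x ≤ N → Exec B (push 0 b) (S x y z) (cost N) (S (b ∷ x) y z)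
    push-0 x y z le = weaken ≗-refl (cost-mono le) (upd-0 x y z _) push

    push-m : ∀ {b} x y z → length y ≤ N → Exec B (push m b) (S x y z) (cost N) (S x (b ∷ y) z)
    push-m {b} x y z le = weaken ≗-refl
      (cost-mono {_} {N} (subst (λ l → length l ≤ N) (sym (S-m x y z)) le))
      (≗-trans (λ i → cong (λ l → ((S x y z) [ m ≔ b ∷ l ]) i) (S-m x y z)) (upd-m x y z _)) push

    push-m1 : ∀ {b} x y z → length z ≤ N → Exec B (push (suc m) b) (S x y z) (cost N) (S x y (b ∷ z))
    push-m1 {b} x y z le = weaken ≗-refl
      (cost-mono {_} {N} (subst (λ l → length l ≤ N) (sym (S-m1 x y z)) le))
      (≗-trans (λ i → cong (λ l → ((S x y z) [ suc m ≔ b ∷ l ]) i) (S-m1 x y z)) (upd-m1 x y z _)) push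

  -- A round of `split` consists of three pops and two pushes, a round of a copying loop of one pop
  -- and at most two pushes; six times `cost N` is enough for either.
  loopTime : ℕ → ℕ
  loopTime N = suc N * (6 * cost N)

  1≤cost : ∀ N → 1 ≤ cost N
  1≤cost N = s≤s z≤n

  loop≤ : ∀ {N K} n → n ≤ N → K ≤ 2 * cost N → suc n * (cost N + K) ≤ loopTime N
  loop≤ {N} {K} n le k = *-mono-≤ (s≤s le) (≤-trans (+-monoʳ-≤ (cost N) k)
    (*-monoˡ-≤ (cost N) {3} {6} (s≤s (s≤s (s≤s z≤n)))))

  shift : ∀ l v {N} → suc l + v ≤ N → l + suc v ≤ N
  shift l v le = ≤-trans (≤-reflexive (+-suc l v)) le

  module Moves {B : Lang} (N : ℕ) where

    move : ∀ (P : Str → Str → Store) r r' → (∀ l v → P l v r ≡ l) →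
      (∀ b l v → (P (b ∷ l) v) [ r ≔ l ] ≗ P l v) →
      (∀ b l v → length v ≤ N → Exec B (push r' b) (P l v) (cost N) (P l (b ∷ v))) →
      ∀ l v → length l + length v ≤ N →
      Exec B (loop r (push r' false) (push r' true)) (P l v) (loopTime N) (P [] (l ʳ++ v))
    move P r r' top popped pushed l v le = within
      (loop≤ (length l) (≤-trans (m≤m+n _ _) le) (m≤m+n (cost N) _))
      (Loop.loop-fold r (push r' false) (push r' true) P _∷_ N (cost N)
        (λ l v → length l + length v ≤ N) top popped
        (λ { false l v i → pushed false l v (≤-trans (m≤n+m _ _) i)
           ; true  l v i → pushed true l v (≤-trans (m≤n+m _ _) i) })
        (λ b l v i → shift (length l) (length v) i) (λ l v i → ≤-trans (m≤m+n _ _) i) l v le)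

    m1→0 : ∀ Y z x → length z + length x ≤ N →
      Exec B (loop (suc m) (push 0 false) (push 0 true)) (S x Y z) (loopTime N) (S (z ʳ++ x) Y [])
    m1→0 Y = move (λ l v → S v Y l) (suc m) 0 (λ l v → S-m1 v Y l)
      (λ b l v → upd-m1 v Y (b ∷ l) l) (λ b l v le → push-0 v Y l le)

    m→0 : ∀ Z y x → length y + length x ≤ N →
      Exec B (loop m (push 0 false) (push 0 true)) (S x y Z) (loopTime N) (S (y ʳ++ x) [] Z)
    m→0 Z = move (λ l v → S v l Z) m 0 (λ l v → S-m v l Z)
      (λ b l v → upd-m v (b ∷ l) Z l) (λ b l v le → push-0 v l Z le)

    0→m1 : ∀ Y x z → length x + length z ≤ N →
      Exec B (loop 0 (push (suc m) false) (push (suc m) true)) (S x Y z) (loopTime N) (S [] Y (x ʳ++ z))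
    0→m1 Y = move (λ l v → S l Y v) 0 (suc m) (λ l v → refl)
      (λ b l v → upd-0 (b ∷ l) Y v l) (λ b l v le → push-m1 l Y v le)

    clear : ∀ (P : Str → Store) r → (∀ l → P l r ≡ l) → (∀ b l → (P (b ∷ l)) [ r ≔ l ] ≗ P l) →
      ∀ l → length l ≤ N → Exec B (loop r skip skip) (P l) (loopTime N) (P [])
    clear P r top popped l le = within
      (loop≤ (length l) le (≤-trans (1≤cost N) (m≤m+n (cost N) _)))
      (Loop.loop-fold r skip skip (λ l (_ : ⊤) → P l) (λ _ v → v) N 1
        (λ l _ → length l ≤ N) (λ l _ → top l) (λ b l _ → popped b l)
        (λ { false l v i → skip ; true l v i → skip })
        (λ b l v i → ≤-trans (n≤1+n _) i) (λ l v i → i) l tt le)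

    spread : Cmd
    spread = loop 0 (push m false ⨾ push (suc m) false) (push m true ⨾ push (suc m) true)

    0→m,m1 : ∀ x → length x ≤ N → Exec B spread (S x [] []) (loopTime N) (S [] (x ʳ++ []) (x ʳ++ []))
    0→m,m1 x le = within (loop≤ (length x) le (≤-reflexive (cong (cost N +_) (sym (+-identityʳ (cost N))))))
      (subst (λ p → Exec B spread (S x [] []) (suc (length x) * (cost N + (cost N + cost N))) (S [] (proj₁ p) (proj₂ p)))
        (both x [] [])
        (Loop.loop-fold 0 (push m false ⨾ push (suc m) false) (push m true ⨾ push (suc m) true)
          (λ l p → S l (proj₁ p) (proj₂ p)) (λ b p → b ∷ proj₁ p , b ∷ proj₂ p) N (cost N + cost N)
          (λ l p → length l + length (proj₁ p) ≤ N × length l + length (proj₂ p) ≤ N)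
          (λ l v → refl) (λ b l v → upd-0 (b ∷ l) _ _ l)
          (λ { false l v (i , j) → both-push false l v i j ; true l v (i , j) → both-push true l v i j })
          (λ b l v i → shift (length l) (length (proj₁ v)) (proj₁ i) , shift (length l) (length (proj₂ v)) (proj₂ i))
          (λ l v i → ≤-trans (m≤m+n _ _) (proj₁ i)) x ([] , [])
          (≤-trans (≤-reflexive (+-identityʳ _)) le , ≤-trans (≤-reflexive (+-identityʳ _)) le)))
      where
      both : ∀ x (y z : Str) → foldl (λ p b → b ∷ proj₁ p , b ∷ proj₂ p) (y , z) x ≡ (x ʳ++ y , x ʳ++ z)
      both []      y z = refl
      both (b ∷ x) y z = both x (b ∷ y) (b ∷ z)
      both-push : ∀ b l (v : Str × Str) → suc (length l) + length (proj₁ v) ≤ N → suc (length l) + length (proj₂ v) ≤ N →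
        Exec B (push m b ⨾ push (suc m) b) (S l (proj₁ v) (proj₂ v)) (cost N + cost N) (S l (b ∷ proj₁ v) (b ∷ proj₂ v))
      both-push b l (y , z) i j = seq (push-m l y z (≤-trans (m≤n+m _ _) i)) (push-m1 l (b ∷ y) z (≤-trans (m≤n+m _ _) j))

    double : Cmd
    double = loop (suc m) (push 0 false ⨾ push 0 true) (push 0 true ⨾ push 0 true)

    m1⇒0 : ∀ z x → length z + length z + length x ≤ N →
      Exec B double (S x [] z) (loopTime N) (S (foldl (λ v b → true ∷ b ∷ v) x z) [] [])
    m1⇒0 z x le = within
      (loop≤ (length z) (≤-trans (≤-trans (m≤m+n _ _) (m≤m+n _ _)) le) (≤-reflexive (cong (cost N +_) (sym (+-identityʳ (cost N))))))
      (Loop.loop-fold (suc m) (push 0 false ⨾ push 0 true) (push 0 true ⨾ push 0 true)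
        (λ l v → S v [] l) (λ b v → true ∷ b ∷ v) N (cost N + cost N)
        (λ l v → length l + length l + length v ≤ N)
        (λ l v → S-m1 v [] l) (λ b l v → upd-m1 v [] (b ∷ l) l)
        (λ { false l v i → two false l v i ; true l v i → two true l v i })
        (λ b l v i → ≤-trans (≤-reflexive (move2 (length l) (length v))) i)
        (λ l v i → ≤-trans (≤-trans (m≤m+n _ _) (m≤m+n _ _)) i) z x le)
      where
      move2 : ∀ a c → a + a + suc (suc c) ≡ suc a + suc a + c
      move2 a c = solve 2 (λ a c → a :+ a :+ (κ 2 :+ c) := κ 1 :+ a :+ (κ 1 :+ a) :+ c) refl a c
      two : ∀ b l v → suc (length l) + suc (length l) + length v ≤ N →
        Exec B (push 0 b ⨾ push 0 true) (S v [] l) (cost N + cost N) (S (true ∷ b ∷ v) [] l)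
      two b l v i = seq (push-0 v [] l (≤-trans (m≤n+m _ _) i))
        (push-0 (b ∷ v) [] l (≤-trans (s≤s (m≤n+m (length v) _)) i))

  module Split {B : Lang} (N : ℕ) (1≤N : 1 ≤ N) where

    c : ℕ
    c = cost N

    pop-flag : ∀ {x y t s'' t'} s' → Exec B (split-step m) (S x y []) t s' → Exec B (loop (suc m) (split-step m) (split-step m)) s' t' s'' →
      Exec B (loop (suc m) (split-step m) (split-step m)) (S x y [ true ]) (c + (t + t')) s''
    pop-flag {x} {y} s' e f = within
      (+-monoˡ-≤ _ (cost-mono {_} {N} (subst (λ l → length l ≤ N) (sym (S-m1 x y [ true ])) 1≤N)))
      (loop1 (S-m1 x y [ true ]) (pre (upd-m1 x y [ true ] []) e) f)

    done : ∀ {x y} → Exec B (loop (suc m) (split-step m) (split-step m)) (S x y []) c (S x y [])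
    done {x} {y} = within (cost-mono {0} {N} z≤n) (loop[] (S-m1 x y []))

    nop : ∀ {s} → Exec B skip s c s
    nop = within (1≤cost N) skip

    at-end : ∀ n → c + ((c + (c + c)) + c) ≤ suc n * (6 * c)
    at-end n = ≤-trans (≤-by c (solve 1 (λ c → c :+ ((c :+ (c :+ c)) :+ c) :+ c := κ 6 :* c) refl c)) (m≤m+n _ _)

    split-loop : ∀ x y → length x + length y ≤ N →
      Exec B (loop (suc m) (split-step m) (split-step m)) (S x y [ true ]) (suc (length x) * (6 * c))
        (S (proj₂ (unpr x)) (proj₁ (unpr x) ʳ++ y) [])
    split-loop [] y le = within (≤-trans (+-monoʳ-≤ c (+-monoˡ-≤ c (+-monoʳ-≤ c (m≤m+n c c)))) (at-end 0))
      (pop-flag (S [] y []) (within (+-monoˡ-≤ c (cost-mono {0} {N} z≤n)) (pop[] refl nop)) done)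
    split-loop (false ∷ x) y le = within (≤-trans (+-monoʳ-≤ c (+-monoˡ-≤ c (+-monoʳ-≤ c (m≤m+n c c)))) (at-end (suc (length x))))
      (pop-flag (S x y []) (within (+-monoˡ-≤ c (cost-mono {suc (length x)} {N} (≤-trans (m≤m+n _ _) le)))
        (pop0 refl (pre (upd-0 (false ∷ x) y [] x) nop))) done)
    split-loop (true ∷ []) y le = within (at-end 1)
      (pop-flag (S [] y []) (within (+-mono-≤ (cost-mono {1} {N} (≤-trans (m≤m+n _ _) le)) (+-monoˡ-≤ c (cost-mono {0} {N} z≤n)))
        (pop1 refl (pre (upd-0 (true ∷ []) y [] []) (pop[] refl nop)))) done)
    split-loop (true ∷ b ∷ x) y le = within (step-time (length x))
      (pop-flag (S x (b ∷ y) [ true ])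
        (within (+-monoˡ-≤ _ (cost-mono {suc (suc (length x))} {N} (≤-trans (m≤m+n _ _) le)))
          (pop1 refl (pre (upd-0 (true ∷ b ∷ x) y [] (b ∷ x)) (bit b))))
        (split-loop x (b ∷ y) (shift (length x) (length y) (≤-trans (n≤1+n _) le))))
      where
      y≤ : length y ≤ N
      y≤ = ≤-trans (m≤n+m _ _) le
      x≤ : suc (length x) ≤ N
      x≤ = ≤-trans (≤-trans (n≤1+n _) (m≤m+n _ _)) le
      bit : ∀ b → Exec B (pop 0 skip (push m false ⨾ push (suc m) true) (push m true ⨾ push (suc m) true))
                    (S (b ∷ x) y []) (c + (c + c)) (S x (b ∷ y) [ true ])
      bit false = within (+-monoˡ-≤ _ (cost-mono {suc (length x)} {N} x≤)) (pop0 refl (pre (upd-0 (false ∷ x) y [] x)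
        (seq (push-m {N = N} x y [] y≤) (push-m1 {N = N} x (false ∷ y) [] z≤n))))
      bit true  = within (+-monoˡ-≤ _ (cost-mono {suc (length x)} {N} x≤)) (pop1 refl (pre (upd-0 (true ∷ x) y [] x)
        (seq (push-m {N = N} x y [] y≤) (push-m1 {N = N} x (true ∷ y) [] z≤n))))
      step-time : ∀ n → c + ((c + (c + (c + c))) + suc n * (6 * c)) ≤ suc (suc (suc n)) * (6 * c)
      step-time n = ≤-by (7 * c) (solve 2 (λ c n → c :+ ((c :+ (c :+ (c :+ c))) :+ (κ 1 :+ n) :* (κ 6 :* c)) :+ κ 7 :* c
                                       := (κ 3 :+ n) :* (κ 6 :* c)) refl c n)

    split-exec : ∀ x → length x ≤ N →
      Exec B (split m) (S x [] []) (c + loopTime N) (S (proj₂ (unpr x)) (proj₁ (unpr x) ʳ++ []) [])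
    split-exec x le = seq (push-m1 {N = N} x [] [] z≤n)
      (within (*-monoˡ-≤ (6 * c) (s≤s le)) (split-loop x [] (≤-trans (≤-reflexive (+-identityʳ _)) le)))

  start : ∀ {n x} → Clean n s → suc (suc m) ≤ n → s 0 ≡ x → s ≗ S x [] []
  start {n} cl le e i with i ≟ 0 | i ≟ m | i ≟ suc m
  ... | yes refl | _ | _ = e
  ... | no _ | yes refl | _ = cl m 0<m (≤-trans (n≤1+n _) le)
  ... | no _ | no _ | yes refl = cl (suc m) (s≤s z≤n) le
  ... | no _ | no _ | no _ = refl

  finish : ∀ {n x} → Clean n s → suc (suc m) ≤ n → S x [] [] ≗ s [ 0 ≔ x ]
  finish {n} cl le i with i ≟ 0 | i ≟ m | i ≟ suc m
  ... | yes refl | _ | _ = refl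
  ... | no _ | yes refl | _ = sym (cl m 0<m (≤-trans (n≤1+n _) le))
  ... | no _ | no _ | yes refl = sym (cl (suc m) (s≤s z≤n) le)
  ... | no _ | no _ | no _ = refl

  call : ∀ {B X Y f n} (F : FP B X Y f) → Clean n s → regs F ≤ m → regs F ≤ n → ∀ a y z →
    Exec B (prog F) (S (enc X a) y z) (⟦ time F ⟧ (size X a)) (S (enc Y (f a)) y z)
  call {X = X} {Y} {f} F cl le le' a y z = to (upd-0 (enc X a) y z (enc Y (f a))) (exec F a (S (enc X a) y z) refl clean)
    where
    clean : Clean (regs F) (S (enc X a) y z)
    clean i lt lt' with i ≟ 0 | i ≟ m | i ≟ suc m
    ... | yes refl | _ | _ = ⊥-elim (n≮n 0 lt)
    ... | no _ | yes refl | _ = ⊥-elim (n≮n m (≤-trans lt' le))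
    ... | no _ | no _ | yes refl = ⊥-elim (n≮n (suc m) (≤-trans lt' (≤-trans le (n≤1+n m))))
    ... | no _ | no _ | no _ = cl i lt (≤-trans lt' le')

loopP : Poly → Poly
loopP P = (con 1 ⊞ P) ⊠ (con 6 ⊠ costP P)

module Pairing {B : Lang} {X Y Z : Coded} {f : Carrier X → Carrier Y} {g : Carrier X → Carrier Z}
               (F : FP B X Y f) (G : FP B X Z g) where
  m : ℕ
  m = suc (regs F ⊔ regs G)

  F≤m : regs F ≤ m
  F≤m = ≤-trans (m≤m⊔n _ _) (n≤1+n _)

  G≤m : regs G ≤ m
  G≤m = ≤-trans (m≤n⊔m (regs F) _) (n≤1+n _)

  m≤ : m ≤ suc (suc m)
  m≤ = ≤-trans (n≤1+n _) (n≤1+n _)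

  widthP : Poly
  widthP = con 1 ⊞ (var ⊞ (time F ⊞ time F ⊞ time G))

  T : Poly
  T = loopP widthP ⊞ (loopP widthP ⊞ (time F ⊞ (loopP widthP ⊞ (loopP widthP ⊞ (time G ⊞ (costP widthP ⊞ loopP widthP))))))

  -- Each loop that moves a string reverses it. The input goes to both scratch registers, one copy
  -- being restored for `F` and the other for `G`. The value of `F` waits reversed, so the final
  -- loop meets its last bit first and builds the code of the pair from the inside on top of the
  -- value of `G`.
  ⟨_,_⟩ : FP B X (Y ⊗ Z) (λ a → f a , g a)
  ⟨_,_⟩ .prog = loop 0 (push m false ⨾ push (suc m) false) (push m true ⨾ push (suc m) true)
    ⨾ loop (suc m) (push 0 false) (push 0 true)
    ⨾ prog F
    ⨾ loop 0 (push (suc m) false) (push (suc m) true)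
    ⨾ loop m (push 0 false) (push 0 true)
    ⨾ prog G
    ⨾ push 0 false
    ⨾ loop (suc m) (push 0 false ⨾ push 0 true) (push 0 true ⨾ push 0 true)
  ⟨_,_⟩ .regs = suc (suc m)
  ⟨_,_⟩ .uses = (s≤s z≤n , (m< , ≤-refl) , (m< , ≤-refl)) , (≤-refl , s≤s z≤n , s≤s z≤n) ,
    Uses-mono (prog F) (≤-trans F≤m m≤) (uses F) , (s≤s z≤n , ≤-refl , ≤-refl) ,
    (m< , s≤s z≤n , s≤s z≤n) , Uses-mono (prog G) (≤-trans G≤m m≤) (uses G) , s≤s z≤n ,
    ≤-refl , (s≤s z≤n , s≤s z≤n) , (s≤s z≤n , s≤s z≤n)
    where
    m< : m < suc (suc m)
    m< = n≤1+n _
  ⟨_,_⟩ .det = ((tt , tt) , (tt , tt)) , (tt , tt) , det F , (tt , tt) , (tt , tt) , det G , tt , (tt , tt) , (tt , tt)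
  ⟨_,_⟩ .time = T ⊞ widthP
  ⟨_,_⟩ .out≤ a = ≤-trans (≤-reflexive (length-pr (enc Y (f a)) (enc Z (g a))))
    (≤-trans (s≤s (≤-trans (+-mono-≤ (+-mono-≤ (out≤ F a) (out≤ F a)) (out≤ G a)) (m≤n+m _ (size X a))))
      (m≤n+m _ (⟦ T ⟧ (size X a))))
  ⟨_,_⟩ .exec a s s0 cl = weaken (start cl ≤-refl s0) (m≤m+n (⟦ T ⟧ n) _) (finish cl ≤-refl)
    (seq (0→m,m1 x x≤) (seq
      (subst (λ w → Exec B (loop (suc m) (push 0 false) (push 0 true)) (S [] (x ʳ++ []) (x ʳ++ [])) (loopTime N) (S w (x ʳ++ []) []))
        (rev-rev x) (m1→0 (x ʳ++ []) (x ʳ++ []) [] (rev≤ x x≤)))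
      (seq (call F cl F≤m (≤-trans F≤m m≤) a (x ʳ++ []) [])
      (seq (0→m1 (x ʳ++ []) y [] (≤-trans (≤-reflexive (+-identityʳ _)) y≤))
      (seq (subst (λ w → Exec B (loop m (push 0 false) (push 0 true)) (S [] (x ʳ++ []) (y ʳ++ [])) (loopTime N) (S w [] (y ʳ++ [])))
        (rev-rev x) (m→0 (y ʳ++ []) (x ʳ++ []) [] (rev≤ x x≤)))
      (seq (call G cl G≤m (≤-trans G≤m m≤) a [] (y ʳ++ []))
      (seq (push-0 z [] (y ʳ++ []) z≤)
        (subst (λ w → Exec B double (S (false ∷ z) [] (y ʳ++ [])) (loopTime N) (S w [] []))
          (doubled y z) (m1⇒0 (y ʳ++ []) (false ∷ z) yz≤)))))))))
    where
    open Frame s m (s≤s z≤n)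
    n N : ℕ
    n = size X a
    N = ⟦ widthP ⟧ n
    open Moves {B} N
    x y z : Str
    x = enc X a
    y = enc Y (f a)
    z = enc Z (g a)
    x≤ : length x ≤ N
    x≤ = ≤-trans (m≤m+n n _) (n≤1+n _)
    rev-rev : ∀ x → (x ʳ++ []) ʳ++ [] ≡ x
    rev-rev x = trans (ʳ++-ʳ++ x) (++-identityʳ x)
    lenrev : ∀ x → length (x ʳ++ []) ≡ length x
    lenrev x = trans (length-ʳ++ x) (+-identityʳ _)
    rev≤ : ∀ x → length x ≤ N → length (x ʳ++ []) + 0 ≤ N
    rev≤ x le = ≤-trans (≤-reflexive (trans (+-identityʳ _) (lenrev x))) le
    sum≤ : suc (length y + length y + length z) ≤ N
    sum≤ = s≤s (≤-trans (+-mono-≤ (+-mono-≤ (out≤ F a) (out≤ F a)) (out≤ G a)) (m≤n+m _ n))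
    y≤ : length y ≤ N
    y≤ = ≤-trans (≤-trans (m≤m+n _ _) (m≤m+n _ _)) (≤-trans (n≤1+n _) sum≤)
    z≤ : length z ≤ N
    z≤ = ≤-trans (m≤n+m _ _) (≤-trans (n≤1+n _) sum≤)
    yz≤ : length (y ʳ++ []) + length (y ʳ++ []) + suc (length z) ≤ N
    yz≤ rewrite lenrev y | +-suc (length y + length y) (length z) = sum≤
    doubled : ∀ y z → foldl (λ v b → true ∷ b ∷ v) (false ∷ z) (y ʳ++ []) ≡ pr y z
    doubled y z = trans (foldl-ʳ++ (λ v b → true ∷ b ∷ v) (false ∷ z) y) (go y)
      where
      go : ∀ y → foldr (λ b v → true ∷ b ∷ v) (false ∷ z) y ≡ pr y z
      go []      = refl
      go (b ∷ y) = cong (λ v → true ∷ b ∷ v) (go y)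

open Pairing public using (⟨_,_⟩)

splitN : Poly
splitN = con 1 ⊞ var

fstF : ∀ {B X Y f} → (∀ a → proj₁ (unpr (enc X a)) ≡ enc Y (f a)) → FP B X Y f
fstF e .prog = split 1 ⨾ loop 0 skip skip ⨾ loop 1 (push 0 false) (push 0 true)
fstF e .regs = 3
fstF e .uses = split-uses 1 , (s≤s z≤n , tt , tt) , (s≤s (s≤s z≤n) , s≤s z≤n , s≤s z≤n)
fstF e .det = split-det 1 , (tt , tt) , (tt , tt)
fstF e .time = (costP splitN ⊞ loopP splitN) ⊞ (loopP splitN ⊞ loopP splitN) ⊞ var
fstF {X = X} {Y} e .out≤ a = ≤-trans (≤-reflexive (cong length (sym (e a))))
  (≤-trans (≤-trans (≤-trans (m≤m+n _ _) (m≤m+n _ _)) (length-unpr (enc X a))) (m≤n+m _ _))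
fstF {B} {X} {Y} {f} e .exec a s s0 cl =
  weaken (start cl ≤-refl s0) (m≤m+n _ _)
    (≗-trans (finish cl ≤-refl)
      (λ i → cong (λ w → (s [ 0 ≔ w ]) i) (trans (ʳ++-ʳ++ u) (trans (++-identityʳ u) (e a)))))
    (seq (split-exec x (n≤1+n _))
      (seq (clear (λ l → S l (u ʳ++ []) []) 0 (λ l → refl) (λ b l → upd-0 (b ∷ l) (u ʳ++ []) [] l) v v≤)
        (m→0 [] (u ʳ++ []) [] u≤)))
  where
  open Frame s 1 (s≤s z≤n)
  x u v : Str
  x = enc X a
  u = proj₁ (unpr x)
  v = proj₂ (unpr x)
  open Moves {B} (suc (length x))
  open Split {B} (suc (length x)) (s≤s z≤n)
  v≤ : length v ≤ suc (length x)
  v≤ = ≤-trans (m≤n+m _ _) (≤-trans (length-unpr x) (n≤1+n _))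
  u≤ : length (u ʳ++ []) + 0 ≤ suc (length x)
  u≤ rewrite +-identityʳ (length (u ʳ++ [])) | length-ʳ++ u {[]} | +-identityʳ (length u) =
    ≤-trans (≤-trans (m≤m+n _ _) (m≤m+n _ _)) (≤-trans (length-unpr x) (n≤1+n _))

sndF : ∀ {B X Y f} → (∀ a → proj₂ (unpr (enc X a)) ≡ enc Y (f a)) → FP B X Y f
sndF e .prog = split 1 ⨾ loop 1 skip skip
sndF e .regs = 3
sndF e .uses = split-uses 1 , (s≤s (s≤s z≤n) , tt , tt)
sndF e .det = split-det 1 , (tt , tt)
sndF e .time = (costP splitN ⊞ loopP splitN) ⊞ loopP splitN ⊞ var
sndF {X = X} {Y} e .out≤ a = ≤-trans (≤-reflexive (cong length (sym (e a))))
  (≤-trans (≤-trans (m≤n+m _ _) (length-unpr (enc X a))) (m≤n+m _ _))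
sndF {B} {X} {Y} {f} e .exec a s s0 cl =
  weaken (start cl ≤-refl s0) (m≤m+n _ _)
    (≗-trans (finish cl ≤-refl) (λ i → cong (λ w → (s [ 0 ≔ w ]) i) (e a)))
    (seq (split-exec x (n≤1+n _))
      (clear (λ l → S v l []) 1 (λ l → refl) (λ b l → upd-m v (b ∷ l) [] l) (u ʳ++ []) u≤))
  where
  open Frame s 1 (s≤s z≤n)
  x u v : Str
  x = enc X a
  u = proj₁ (unpr x)
  v = proj₂ (unpr x)
  open Moves {B} (suc (length x))
  open Split {B} (suc (length x)) (s≤s z≤n)
  u≤ : length (u ʳ++ []) ≤ suc (length x)
  u≤ rewrite length-ʳ++ u {[]} | +-identityʳ (length u) =
    ≤-trans (≤-trans (m≤m+n _ _) (m≤m+n _ _)) (≤-trans (length-unpr x) (n≤1+n _))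

module Folding {B : Lang} {Y : Coded} {f : Bool → Carrier Y → Carrier Y}
               (F : ∀ b → FP B Y Y (f b)) (Q : Poly)
               (bounded : ∀ y a → size Y (foldr f a y) ≤ ⟦ Q ⟧ (size (str ⊗ Y) (y , a))) where
  m : ℕ
  m = suc (regs (F false) ⊔ regs (F true))

  F≤m : ∀ b → regs (F b) ≤ m
  F≤m false = ≤-trans (m≤m⊔n _ _) (n≤1+n _)
  F≤m true  = ≤-trans (m≤n⊔m (regs (F false)) _) (n≤1+n _)

  m≤ : m ≤ suc (suc m)
  m≤ = ≤-trans (n≤1+n _) (n≤1+n _)

  bodyP T : Poly
  bodyP = time (F false) ⟨ Q ⟩ ⊞ time (F true) ⟨ Q ⟩
  T = (costP splitN ⊞ loopP splitN) ⊞ (con 1 ⊞ var) ⊠ (costP var ⊞ bodyP)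

  body≤ : ∀ b n → ⟦ time (F b) ⟧ (⟦ Q ⟧ n) ≤ ⟦ bodyP ⟧ n
  body≤ false n = m≤m+n _ _
  body≤ true  n = m≤n+m _ _

  -- `split` leaves the first component reversed, so that its last bit is popped first, in the order
  -- of a right fold. Every intermediate value is itself the fold over a suffix, to which `bounded`
  -- applies.
  foldrF : FP B (str ⊗ Y) Y (λ p → foldr f (proj₂ p) (proj₁ p))
  foldrF .prog = split m ⨾ loop m (prog (F false)) (prog (F true))
  foldrF .regs = suc (suc m)
  foldrF .uses = split-uses m ,
    (m< , Uses-mono (prog (F false)) (≤-trans (F≤m false) m≤) (uses (F false)) ,
          Uses-mono (prog (F true)) (≤-trans (F≤m true) m≤) (uses (F true)))
    where
    m< : m < suc (suc m)
    m< = n≤1+n _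
  foldrF .det = split-det m , (det (F false) , det (F true))
  foldrF .time = T ⊞ Q
  foldrF .out≤ (y , a) = ≤-trans (bounded y a) (m≤n+m _ (⟦ T ⟧ (size (str ⊗ Y) (y , a))))
  foldrF .exec (y , a) s s0 cl = weaken (start cl ≤-refl s0) (m≤m+n (⟦ T ⟧ n) _) (finish cl ≤-refl)
    (seq
      (subst (λ p → Exec B (split m) (S (pr y (enc Y a)) [] []) (cost (suc n) + loopTime (suc n)) (S (proj₂ p) (proj₁ p ʳ++ []) []))
        (unpr-pr y (enc Y a)) (split-exec (pr y (enc Y a)) (n≤1+n n)))
      (within (*-monoˡ-≤ (cost n + ⟦ bodyP ⟧ n) (s≤s len-y))
        (subst (λ w → Exec B (loop m (prog (F false)) (prog (F true))) (S (enc Y a) (y ʳ++ []) [])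
                        (suc (length (y ʳ++ [])) * (cost n + ⟦ bodyP ⟧ n)) (S (enc Y w) [] []))
          (foldl-ʳ++ (flip f) a y)
          (Loop.loop-fold m (prog (F false)) (prog (F true)) (λ l v → S (enc Y v) l []) f n (⟦ bodyP ⟧ n) Inv
            (λ l v → S-m (enc Y v) l []) (λ b l v → upd-m (enc Y v) (b ∷ l) [] l)
            (λ { false l v i → body false l v i ; true l v i → body true l v i })
            (λ { b l v (y' , e , e') → b ∷ y' , e , cong (f b) e' })
            (λ { l v (y' , e , e') → ≤-trans (m≤m+n _ (length y')) (≤-trans (≤-reflexive (trans (sym (length-ʳ++ l)) (cong length e))) y≤n) })
            (y ʳ++ []) a ([] , trans (ʳ++-ʳ++ y) (++-identityʳ y) , refl)))))
    where
    open Frame s m (s≤s z≤n)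
    n : ℕ
    n = size (str ⊗ Y) (y , a)
    open Split {B} (suc n) (s≤s z≤n)
    n≡ : n ≡ suc (length y + length y + size Y a)
    n≡ = length-pr y (enc Y a)
    y≤n : length y ≤ n
    y≤n = ≤-trans (≤-trans (m≤m+n _ _) (≤-trans (m≤m+n _ _) (n≤1+n _))) (≤-reflexive (sym n≡))
    len-y : length (y ʳ++ []) ≤ n
    len-y rewrite length-ʳ++ y {[]} | +-identityʳ (length y) = y≤n
    -- y' is the part of y already folded; l is the rest, last bit first.
    Inv : Str → Carrier Y → Set
    Inv l v = ∃ λ y' → l ʳ++ y' ≡ y × v ≡ foldr f a y'
    small : ∀ {l v} → Inv l v → size Y v ≤ ⟦ Q ⟧ n
    small {l} (y' , e , refl) = ≤-trans (bounded y' a) (⟦⟧-mono Q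
      (≤-trans (≤-reflexive (length-pr y' (enc Y a)))
        (≤-trans (s≤s (+-monoˡ-≤ (size Y a) (+-mono-≤ y'≤ y'≤))) (≤-reflexive (sym n≡)))))
      where
      y'≤ : length y' ≤ length y
      y'≤ = ≤-trans (m≤n+m _ (length l)) (≤-reflexive (trans (sym (length-ʳ++ l)) (cong length e)))
    body : ∀ b l v → Inv (b ∷ l) v → Exec B (prog (F b)) (S (enc Y v) l []) (⟦ bodyP ⟧ n) (S (enc Y (f b v)) l [])
    body b l v i = within (≤-trans (⟦⟧-mono (time (F b)) (small {b ∷ l} {v} i)) (body≤ b n))
      (call (F b) cl (F≤m b) (≤-trans (F≤m b) m≤) v l [])

open Folding public using (foldrF)

idF : ∀ {B X} → FP B X X (λ a → a)
idF = recode (λ _ → refl)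

fst : ∀ {B X Y} → FP B (X ⊗ Y) X proj₁
fst {X = X} {Y} = fstF (λ { (a , b) → cong proj₁ (unpr-pr (enc X a) (enc Y b)) })

snd : ∀ {B X Y} → FP B (X ⊗ Y) Y proj₂
snd {X = X} {Y} = sndF (λ { (a , b) → cong proj₂ (unpr-pr (enc X a) (enc Y b)) })

unprF : ∀ {B} → FP B str (str ⊗ str) unpr
unprF = ⟨ fstF (λ _ → refl) , sndF (λ _ → refl) ⟩

prF : ∀ {B} → FP B (str ⊗ str) str (λ p → pr (proj₁ p) (proj₂ p))
prF = recode (λ _ → refl)

-- A pushed `false` makes any code the code of a pair with empty first component, and `fstF` returns
-- that component.
bang : ∀ {B X} → FP B X unit (λ _ → tt)
bang {X = X} = fstF {X = prefixed [ false ] X} (λ _ → refl) ∙ pushF false (λ _ → refl)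

const : ∀ {B X} (Y : Coded) (y : Carrier Y) → FP B X Y (λ _ → y)
const Y y = recode {X = prefixed (enc Y y) unit} (λ _ → sym (++-identityʳ (enc Y y))) ∙ prefix (enc Y y) ∙ bang

absurd : ∀ {B Y} {f : ⊥ → Carrier Y} → FP B void Y f
absurd .prog = skip
absurd .regs = 0
absurd .uses = tt
absurd .det  = tt
absurd .time = con 0
absurd .out≤ ()
absurd .exec ()

-- Case distinction on encodings

drop1 : ∀ {B X} b → FP B (prefixed [ b ] X) X (λ a → a)
drop1 {X = X} false = popF {X₀ = void} {X} {void} {f₀ = ⊥-elim} {f₂ = ⊥-elim} absurd idF absurd
  (λ a → is0 a refl refl)
drop1 {X = X} true  = popF {X₀ = void} {void} {X} {f₀ = ⊥-elim} {f₁ = ⊥-elim} absurd absurd idF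
  (λ a → is1 a refl refl)

-- The code of such a pair is `true`, the bit, `false` and then the code of the second component;
-- hence the three nested pops.
caseB : ∀ {B X Z f g} → FP B X Z f → FP B X Z g →
        FP B (bool ⊗ X) Z (λ p → if proj₁ p then f (proj₂ p) else g (proj₂ p))
caseB {B} {X} {Z} {f} {g} F G =
  popF {X₀ = void} {void} {R} {f₀ = ⊥-elim} {f₁ = ⊥-elim} absurd absurd
    (popF {X = R} {void} {prefixed [ false ] X} {prefixed [ false ] X} {f₀ = ⊥-elim}
      absurd (G ∙ drop1 false) (F ∙ drop1 false)
      (λ { (false , a) → is0 a refl refl ; (true , a) → is1 a refl refl }))
    (λ { (b , a) → is1 (b , a) refl refl })
  where
  R : Coded
  R = record { Carrier = Bool × Carrier X ; enc = λ p → proj₁ p ∷ false ∷ enc X (proj₂ p) }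

ifF : ∀ {B X Z c f g} → FP B X bool c → FP B X Z f → FP B X Z g →
      FP B X Z (λ a → if c a then f a else g a)
ifF C F G = caseB F G ∙ ⟨ C , idF ⟩

notF : ∀ {B X f} → FP B X bool f → FP B X bool (λ a → not (f a))
notF {f = f} F = ext (λ a → lemma (f a)) (ifF F (const bool false) (const bool true))
  where
  lemma : ∀ b → (if b then false else true) ≡ not b
  lemma false = refl
  lemma true  = refl

andF : ∀ {B X f g} → FP B X bool f → FP B X bool g → FP B X bool (λ a → f a ∧ g a)
andF {f = f} {g} F G = ext (λ a → lemma (f a) (g a)) (ifF F G (const bool false))
  where
  lemma : ∀ b c → (if b then c else false) ≡ b ∧ c
  lemma false c = refl
  lemma true  c = refl

orF : ∀ {B X f g} → FP B X bool f → FP B X bool g → FP B X bool (λ a → f a ∨ g a)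
orF {f = f} {g} F G = ext (λ a → lemma (f a) (g a)) (ifF F (const bool true) G)
  where
  lemma : ∀ b c → (if b then true else c) ≡ b ∨ c
  lemma false c = refl
  lemma true  c = refl

xorF : ∀ {B X f g} → FP B X bool f → FP B X bool g → FP B X bool (λ a → f a xor g a)
xorF {f = f} {g} F G = ext (λ a → lemma (f a) (g a)) (ifF F (notF G) G)
  where
  lemma : ∀ b c → (if b then not c else c) ≡ b xor c
  lemma false c = refl
  lemma true  c = refl

strCase : ∀ {A C : Set} → (A → C) → (Bool → Str × A → C) → Str × A → C
strCase f g ([] , a)    = f a
strCase f g (b ∷ s , a) = g b (s , a)

caseStr : ∀ {B X Z f g} → FP B X Z f → (∀ b → FP B (str ⊗ X) Z (g b)) → FP B (str ⊗ X) Z (strCase f g)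
caseStr {B} {X} {Z} {f} {g} F G =
  popF {X₀ = void} {X} {R} {f₀ = ⊥-elim} absurd F
    (popF {X = R} {void} {str ⊗ X} {str ⊗ X} {f = λ p → g (proj₁ p) (proj₂ p)} {f₀ = ⊥-elim} absurd (G false) (G true)
      (λ { (false , a) → is0 a refl refl ; (true , a) → is1 a refl refl }))
    (λ { ([] , a) → is0 a refl refl ; (b ∷ s , a) → is1 (b , (s , a)) refl refl })
  where
  R : Coded
  R = record { Carrier = Bool × (Str × Carrier X) ; enc = λ p → proj₁ p ∷ enc (str ⊗ X) (proj₂ p) }

unary : ∀ {n} → Fin n → Str
unary zero    = [ false ]
unary (suc i) = true ∷ unary i

finC : ℕ → Coded
finC n .Carrier = Fin n
finC n .enc     = unary

caseFin : ∀ {B X Z} n {f : Fin n → Carrier X → Carrier Z} → (∀ i → FP B X Z (f i)) →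
          FP B (finC n ⊗ X) Z (λ p → f (proj₁ p) (proj₂ p))
caseFin {X = X} zero F = popF {X₀ = void} {void} {void} {f₀ = ⊥-elim} {⊥-elim} {⊥-elim} absurd absurd absurd (λ { (() , _) })
caseFin {X = X} {Z} (suc n) {f} F =
  popF {X₀ = void} {void} {R} {f₀ = ⊥-elim} {f₁ = ⊥-elim} absurd absurd
    (popF {X = R} {void} {prefixed [ false ] X} {finC n ⊗ X} {f = λ p → f (proj₁ p) (proj₂ p)} {f₀ = ⊥-elim}
      absurd (F zero ∙ drop1 false) (caseFin n (λ i → F (suc i)))
      (λ { (zero , a) → is0 a refl refl ; (suc i , a) → is1 (i , a) refl refl }))
    (λ { (zero , a) → is1 (zero , a) refl refl ; (suc i , a) → is1 (suc i , a) refl refl })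
  where
  R : Coded
  R = record { Carrier = Fin (suc n) × Carrier X ; enc = λ { (zero , a) → false ∷ false ∷ enc X a
                                                          ; (suc i , a) → true ∷ enc (finC n ⊗ X) (i , a) } }

finite : ∀ {A} → Finite A → Coded
finite {A} F .Carrier = A
finite F     .enc a   = unary (Finite.index F a)

caseFinite : ∀ {B X Z A} (F : Finite A) {f : A → Carrier X → Carrier Z} → (∀ a → FP B X Z (f a)) →
             FP B (finite F ⊗ X) Z (λ p → f (proj₁ p) (proj₂ p))
caseFinite {X = X} {Z} F {f} G =
  ext (λ p → cong (λ a → f a (proj₂ p)) (Finite.element-index F (proj₁ p)))
    (caseFin {X = X} {Z} (Finite.size F) {λ i → f (Finite.element F i)} (λ i → G (Finite.element F i)) ∙
      recode {X = finite F ⊗ X} {finC (Finite.size F) ⊗ X} {λ p → Finite.index F (proj₁ p) , proj₂ p} (λ _ → refl))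

encList : (Y : Coded) → List (Carrier Y) → Str
encList Y []      = []
encList Y (y ∷ l) = pr (enc Y y) (encList Y l)

listC : Coded → Coded
listC Y .Carrier = List (Carrier Y)
listC Y .enc     = encList Y

consF : ∀ {B Y} → FP B (Y ⊗ listC Y) (listC Y) (λ p → proj₁ p ∷ proj₂ p)
consF = recode (λ _ → refl)

listCase : ∀ {A C D : Set} → (A → C) → ((D × List D) × A → C) → List D × A → C
listCase f g ([] , a)    = f a
listCase f g (y ∷ l , a) = g ((y , l) , a)

caseList : ∀ {B Y X Z f g} → FP B X Z f → FP B ((Y ⊗ listC Y) ⊗ X) Z g → FP B (listC Y ⊗ X) Z (listCase f g)
caseList {B} {Y} {X} {Z} {f} {g} F G =
  popF {X₀ = void} {X} {R} {f₀ = ⊥-elim} absurd F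
    -- The popped bit shows that the list is nonempty, but it is also the first bit of the code of
    -- head and tail, and is pushed back.
    (G ∙ pushF {X = R} {(Y ⊗ listC Y) ⊗ X} {λ p → p} true starts)
    (λ { ([] , a) → is0 a refl refl ; (y ∷ l , a) → is1 ((y , l) , a) (starts ((y , l) , a)) refl })
  where
  R : Coded
  R = record { Carrier = Carrier ((Y ⊗ listC Y) ⊗ X) ; enc = λ p → drop 1 (enc ((Y ⊗ listC Y) ⊗ X) p) }
  starts : ∀ p → enc ((Y ⊗ listC Y) ⊗ X) p ≡ true ∷ enc R p
  starts ((y , l) , a) with enc Y y
  ... | []    = refl
  ... | _ ∷ _ = refl

foldrF+ : ∀ {B Y f} k → (∀ b → FP B Y Y (f b)) → (∀ b a → size Y (f b a) ≤ k + size Y a) →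
          FP B (str ⊗ Y) Y (λ p → foldr f (proj₂ p) (proj₁ p))
foldrF+ {B} {Y} {f} k F grow = foldrF F (con k ⊠ var ⊞ var) bounded
  where
  open ≤-Reasoning
  total : ∀ y a → size Y (foldr f a y) ≤ k * length y + size Y a
  total []      a = m≤n+m _ _
  total (b ∷ y) a = begin
    size Y (f b (foldr f a y))          ≤⟨ grow b _ ⟩
    k + size Y (foldr f a y)            ≤⟨ +-monoʳ-≤ k (total y a) ⟩
    k + (k * length y + size Y a)       ≡⟨ sym (+-assoc k _ _) ⟩
    k + k * length y + size Y a         ≡⟨ cong (_+ size Y a) (sym (*-suc k (length y))) ⟩
    k * suc (length y) + size Y a       ∎
  bounded : ∀ y a → size Y (foldr f a y) ≤ ⟦ con k ⊠ var ⊞ var ⟧ (size (str ⊗ Y) (y , a))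
  bounded y a = begin
    size Y (foldr f a y)       ≤⟨ total y a ⟩
    k * length y + size Y a    ≤⟨ +-mono-≤ (*-monoʳ-≤ k y≤) a≤ ⟩
    k * n + n                  ∎
    where
    n : ℕ
    n = size (str ⊗ Y) (y , a)
    y≤ : length y ≤ n
    y≤ = ≤-trans (≤-trans (m≤m+n _ _) (≤-trans (m≤m+n _ _) (n≤1+n _))) (≤-reflexive (sym (length-pr y (enc Y a))))
    a≤ : size Y a ≤ n
    a≤ = ≤-trans (≤-trans (m≤n+m _ (length y + length y)) (n≤1+n _)) (≤-reflexive (sym (length-pr y (enc Y a))))

appendF : ∀ {B} → FP B (str ⊗ str) str (λ p → proj₁ p ++ proj₂ p)
appendF = ext (λ p → lemma (proj₁ p) (proj₂ p)) (foldrF+ {f = _∷_} 1 (λ b → pushF b (λ _ → refl)) (λ _ _ → ≤-refl))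
  where
  lemma : ∀ (y a : Str) → foldr _∷_ a y ≡ y ++ a
  lemma []      a = refl
  lemma (b ∷ y) a = cong (b ∷_) (lemma y a)

mapF : ∀ {B} (Y : Coded) (e : Bool → Carrier Y) → FP B str (listC Y) (map e)
mapF Y e = ext lemma
  (foldrF+ {f = λ b l → e b ∷ l} (suc (s + s)) (λ b → consF ∙ ⟨ const Y (e b) , idF ⟩) grow ∙ ⟨ idF , const (listC Y) [] ⟩)
  where
  s : ℕ
  s = size Y (e false) ⊔ size Y (e true)
  e≤ : ∀ b → size Y (e b) ≤ s
  e≤ false = m≤m⊔n _ _
  e≤ true  = m≤n⊔m (size Y (e false)) _
  grow : ∀ b l → size (listC Y) (e b ∷ l) ≤ suc (s + s) + size (listC Y) l
  grow b l = ≤-trans (≤-reflexive (length-pr (enc Y (e b)) (enc (listC Y) l)))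
    (s≤s (+-monoˡ-≤ _ (+-mono-≤ (e≤ b) (e≤ b))))
  lemma : ∀ y → foldr (λ b l → e b ∷ l) [] y ≡ map e y
  lemma []      = refl
  lemma (b ∷ y) = cong (e b ∷_) (lemma y)

dropF : ∀ {B} → FP B (str ⊗ str) str (λ p → drop (length (proj₁ p)) (proj₂ p))
dropF = ext (λ p → lemma (proj₁ p) (proj₂ p)) 
  (foldrF+ {f = λ _ → drop 1} 0 (λ _ → tailF) (λ { _ [] → ≤-refl ; _ (_ ∷ w) → n≤1+n _ }))
  where
  tailF : ∀ {B} → FP B str str (drop 1)
  tailF = ext tail (caseStr {X = unit} {f = λ _ → []} {g = λ _ → proj₁} (const str []) (λ _ → fst) ∙ ⟨ idF , bang ⟩)
    where
    tail : ∀ w → strCase {⊤} (λ _ → []) (λ _ → proj₁) (w , tt) ≡ drop 1 w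
    tail []      = refl
    tail (_ ∷ w) = refl
  lemma : ∀ (y w : Str) → foldr (λ _ → drop 1) w y ≡ drop (length y) w
  lemma []      w = refl
  lemma (_ ∷ y) w = trans (cong (drop 1) (lemma y w)) (trans (drop-drop (length y) 1 w) (cong (λ n → drop n w) (+-comm (length y) 1)))

isEmpty : Str → Bool
isEmpty []      = true
isEmpty (_ ∷ _) = false

isEmptyF : ∀ {B} → FP B str bool isEmpty
isEmptyF = ext lemma
  (caseStr {X = unit} {f = λ _ → true} {g = λ _ _ → false} (const bool true) (λ _ → const bool false) ∙ ⟨ idF , bang ⟩)
  where
  lemma : ∀ w → strCase {⊤} (λ _ → true) (λ _ _ → false) (w , tt) ≡ isEmpty w
  lemma []      = refl
  lemma (_ ∷ w) = refl

-- Unary numbers and polynomial clocks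

ones : ℕ → Str
ones n = replicate n true

ones-+ : ∀ m n → ones m ++ ones n ≡ ones (m + n)
ones-+ zero    n = refl
ones-+ (suc m) n = cong (true ∷_) (ones-+ m n)

-- Multiplication of unary numbers. The step of a fold takes no parameter, so the string to be
-- repeated travels in the accumulator.
repeatF : ∀ {B} → FP B (str ⊗ str) str (λ p → foldr (λ _ acc → proj₂ p ++ acc) [] (proj₁ p))
repeatF = ext (λ p → cong proj₁ (lemma (proj₁ p) (proj₂ p)))
  (fst ∙ foldrF {Y = str ⊗ str} {f = λ _ p → proj₂ p ++ proj₁ p , proj₂ p} (λ _ → ⟨ appendF ∙ ⟨ snd , fst ⟩ , snd ⟩) Q bounded
       ∙ ⟨ fst , ⟨ const str [] , snd ⟩ ⟩)
  where
  f : Bool → Str × Str → Str × Str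
  f _ p = proj₂ p ++ proj₁ p , proj₂ p
  Q : Poly
  Q = con 1 ⊞ ((var ⊠ var ⊞ var) ⊞ (var ⊠ var ⊞ var) ⊞ var)
  lemma : ∀ y c → foldr f ([] , c) y ≡ (foldr (λ _ acc → c ++ acc) [] y , c)
  lemma []      c = refl
  lemma (_ ∷ y) c rewrite lemma y c = refl
  keep : ∀ y p → proj₂ (foldr f p y) ≡ proj₂ p
  keep []      p = refl
  keep (_ ∷ y) p = keep y p
  len : ∀ y p → length (proj₁ (foldr f p y)) ≡ length y * length (proj₂ p) + length (proj₁ p)
  len []      p = refl
  len (_ ∷ y) p = trans (length-++ (proj₂ (foldr f p y)))
    (trans (cong₂ _+_ (cong length (keep y p)) (len y p)) (sym (+-assoc (length (proj₂ p)) _ _)))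
  bounded : ∀ y p → size (str ⊗ str) (foldr f p y) ≤ ⟦ Q ⟧ (size (str ⊗ str ⊗ str) (y , p))
  bounded y p@(a , c) = begin
    size (str ⊗ str) (foldr f p y)    ≡⟨ length-pr (proj₁ (foldr f p y)) _ ⟩
    suc (length (proj₁ (foldr f p y)) + length (proj₁ (foldr f p y)) + length (proj₂ (foldr f p y)))
      ≤⟨ s≤s (+-mono-≤ (+-mono-≤ acc≤ acc≤) (≤-trans (≤-reflexive (cong length (keep y p))) c≤)) ⟩
    ⟦ Q ⟧ n ∎
    where
    open ≤-Reasoning
    n : ℕ
    n = size (str ⊗ str ⊗ str) (y , p)
    n≡ : n ≡ suc (length y + length y + suc (length a + length a + length c))
    n≡ = trans (length-pr y (pr a c)) (cong (λ k → suc (length y + length y + k)) (length-pr a c))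
    y≤ : length y ≤ n
    y≤ = ≤-trans (≤-trans (≤-trans (m≤m+n _ _) (m≤m+n _ _)) (n≤1+n _)) (≤-reflexive (sym n≡))
    inner : ∀ {k} → k ≤ length a + length a + length c → k ≤ n
    inner le = ≤-trans (≤-trans le (≤-trans (n≤1+n _) (m≤n+m _ (suc (length y + length y))))) (≤-reflexive (sym n≡))
    a≤ : length a ≤ n
    a≤ = inner (≤-trans (m≤m+n _ _) (m≤m+n _ _))
    c≤ : length c ≤ n
    c≤ = inner (m≤n+m _ _)
    acc≤ : length (proj₁ (foldr f p y)) ≤ n * n + n
    acc≤ = ≤-trans (≤-reflexive (len y p)) (+-mono-≤ (*-mono-≤ y≤ c≤) a≤)

repeat-ones : ∀ m n → foldr (λ _ acc → ones n ++ acc) [] (ones m) ≡ ones (m * n)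
repeat-ones zero    n = refl
repeat-ones (suc m) n = trans (cong (ones n ++_) (repeat-ones m n)) (ones-+ n (m * n))

onesF : ∀ {B} P → FP B str str (λ x → ones (⟦ P ⟧ (length x)))
onesF (con c)   = const str (ones c)
onesF var       = ext lemma (foldrF+ {f = λ _ a → true ∷ a} 1 (λ _ → pushF true (λ _ → refl)) (λ _ _ → ≤-refl) ∙ ⟨ idF , const str [] ⟩)
  where
  lemma : ∀ x → foldr (λ _ a → true ∷ a) [] x ≡ ones (length x)
  lemma []      = refl
  lemma (_ ∷ x) = cong (true ∷_) (lemma x)
onesF (P ⊞ Q)   = ext (λ x → ones-+ (⟦ P ⟧ (length x)) (⟦ Q ⟧ (length x))) (appendF ∙ ⟨ onesF P , onesF Q ⟩)
onesF (P ⊠ Q)   = ext (λ x → repeat-ones (⟦ P ⟧ (length x)) (⟦ Q ⟧ (length x))) (repeatF ∙ ⟨ onesF P , onesF Q ⟩)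
onesF (P ⟨ Q ⟩) = ext (λ x → cong (λ k → ones (⟦ P ⟧ k)) (length-replicate (⟦ Q ⟧ (length x)))) (onesF P ∙ onesF Q)

-- Simulation of oracle machines

_×ᶠ_ : ∀ {A B} → Finite A → Finite B → Finite (A × B)
F ×ᶠ G = record
  { size = Finite.size F * Finite.size G
  ; index = λ p → combine (Finite.index F (proj₁ p)) (Finite.index G (proj₂ p))
  ; element = λ i → Finite.element F (proj₁ (remQuot {Finite.size F} (Finite.size G) i)) ,
                    Finite.element G (proj₂ (remQuot {Finite.size F} (Finite.size G) i))
  ; element-index = λ p → cong₂ _,_
      (trans (cong (Finite.element F ∘ proj₁) (remQuot-combine (Finite.index F (proj₁ p)) _)) (Finite.element-index F _))
      (trans (cong (Finite.element G ∘ proj₂) (remQuot-combine (Finite.index F (proj₁ p)) _)) (Finite.element-index G _)) }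

retract : ∀ {A B : Set} (f : A → B) (g : B → A) → (∀ a → g (f a) ≡ a) → Finite B → Finite A
retract f g gf F = record
  { size = Finite.size F ; index = Finite.index F ∘ f ; element = g ∘ Finite.element F
  ; element-index = λ a → trans (cong g (Finite.element-index F (f a))) (gf a) }

ctrlFinite : ∀ n → Finite (Ctrl n)
ctrlFinite n = retract f g (λ { (st p) → refl ; acc → refl ; rej → refl ; (ask p q) → refl })
  (finFinite (suc n) ⊎ᶠ finFinite 2 ⊎ᶠ (finFinite (suc n) ×ᶠ finFinite (suc n)))
  where
  f : Ctrl n → Fin (suc n) ⊎ Fin 2 ⊎ (Fin (suc n) × Fin (suc n))
  f (st p)    = inj₁ p
  f acc       = inj₂ (inj₁ zero)
  f rej       = inj₂ (inj₁ (suc zero))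
  f (ask p q) = inj₂ (inj₂ (p , q))
  g : Fin (suc n) ⊎ Fin 2 ⊎ (Fin (suc n) × Fin (suc n)) → Ctrl n
  g (inj₁ p)                   = st p
  g (inj₂ (inj₁ zero))         = acc
  g (inj₂ (inj₁ (suc zero)))   = rej
  g (inj₂ (inj₂ (p , q)))      = ask p q

maxFin : ∀ {n} (f : Fin n → ℕ) → ∃ λ m → ∀ i → f i ≤ m
maxFin {zero}  f = 0 , λ ()
maxFin {suc n} f with maxFin (f ∘ suc)
... | m , h = f zero ⊔ m , λ { zero → m≤m⊔n _ _ ; (suc i) → ≤-trans (h i) (m≤n⊔m (f zero) m) }

length-unary : ∀ {n} (i : Fin n) → length (unary i) ≤ n
length-unary zero    = s≤s z≤n
length-unary (suc i) = s≤s (length-unary i)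

isAcc : ∀ {n} → Ctrl n → Bool
isAcc (st _)    = false
isAcc acc       = true
isAcc rej       = false
isAcc (ask _ _) = false

module Simulate (N : OTM) where
  open OTM N
  open Run N

  -- Nondeterminism is resolved by a string of choices: the i-th action (from
  -- 0) of a list is selected by i bits 'false' followed by one bit 'true'.
  pick : List (Action nQ g) → Conf → Str → Conf × Str
  pick []       c w           = c , []
  pick (a ∷ as) c []          = c , []
  pick (a ∷ as) c (true ∷ w)  = apply c a , w
  pick (a ∷ as) c (false ∷ w) = pick as c w

  step : (Str → Bool) → Conf × Str → Conf × Str
  step O (config (st p) l h r q , w)      = pick (δ p h) (config (st p) l h r q) w
  step O (config acc l h r q , w)         = config acc l h r q , w
  step O (config rej l h r q , w)         = config rej l h r q , w
  step O (config (ask p₁ p₀) l h r q , w) = config (st (if O q then p₁ else p₀)) l h r [] , w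

  steps : (Str → Bool) → ℕ → Conf × Str → Conf × Str
  steps O zero    s = s
  steps O (suc n) s = step O (steps O n s)

  accepting : Conf → Bool
  accepting c = isAcc (Config.ctrl c)

  -- The string `w` is both the sequence of choices and, through its length, the clock of the
  -- simulation.
  runAcc : (Str → Bool) → Str → Str → Bool
  runAcc O x w = accepting (proj₁ (steps O (length w) (initial x , w)))

  accepting-sound : ∀ {A} c → accepting c ≡ true → Accepts A c
  accepting-sound (config acc l h r q) e = here refl

  pick-back : ∀ {A p l h r q} as w → (∀ {a} → a ∈ as → a ∈ δ p h) →
    Accepts A (proj₁ (pick as (config (st p) l h r q) w)) → Accepts A (config (st p) l h r q)
  pick-back []       w           sub x = x
  pick-back (a ∷ as) []          sub x = x
  pick-back {p = p} {l} {h} {r} {q} (a ∷ as) (true ∷ w) sub x =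
    there (∈-map⁺ (apply (config (st p) l h r q)) (sub (here refl))) x
  pick-back (a ∷ as) (false ∷ w) sub x = pick-back as w (sub ∘ there) x

  -- A simulated step is a step of the machine or leaves the configuration as it is, when choices
  -- have run out or the machine has halted. Acceptance is pulled back in either case, so an
  -- accepting simulation is sound for every string of choices.
  step-back : ∀ {A} s → Accepts A (proj₁ (step A s)) → Accepts A (proj₁ s)
  step-back (config (st p) l h r q , w)      x = pick-back (δ p h) w (λ i → i) x
  step-back (config acc l h r q , w)         x = x
  step-back (config rej l h r q , w)         x = x
  step-back (config (ask p₁ p₀) l h r q , w) x = there (here refl) x

  steps-back : ∀ {A} n s → Accepts A (proj₁ (steps A n s)) → Accepts A (proj₁ s)
  steps-back zero    s x = x
  steps-back {A} (suc n) s x = steps-back n s (step-back (steps A n s) x)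

  runAcc-sound : ∀ A x w → runAcc A x w ≡ true → Accepts A (initial x)
  runAcc-sound A x w e = steps-back (length w) _ (accepting-sound _ e)

  steps-+ : ∀ O m n s → steps O (m + n) s ≡ steps O m (steps O n s)
  steps-+ O zero    n s = refl
  steps-+ O (suc m) n s = cong (step O) (steps-+ O m n s)

  step-acc : ∀ O s → accepting (proj₁ s) ≡ true → step O s ≡ s
  step-acc O (config acc l h r q , w) e = refl

  steps-acc : ∀ O n s → accepting (proj₁ s) ≡ true → steps O n s ≡ s
  steps-acc O zero    s e = refl
  steps-acc O (suc n) s e = trans (cong (step O) (steps-acc O n s e)) (step-acc O s e)

  degree : ∃ λ d → ∀ p h → length (δ p h) ≤ d
  degree with maxFin (λ p → proj₁ (maxFin (λ h → length (δ p h))))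
  ... | d , le = d , λ p h → ≤-trans (proj₂ (maxFin (λ h → length (δ p h))) h) (le p)

  d : ℕ
  d = proj₁ degree

  selector : ∀ {a} (as : List (Action nQ g)) → a ∈ as → ∃ λ v →
    length v ≤ length as × (length as ≤ 1 → v ≡ ones (length v)) × (∀ c z → pick as c (v ++ z) ≡ (apply c a , z))
  selector (a ∷ as) (here refl) = [ true ] , s≤s z≤n , (λ _ → refl) , λ c z → refl
  selector (a ∷ as) (there i) with selector as i
  ... | v , le , _ , e = false ∷ v , s≤s le , (λ { (s≤s h) → ⊥-elim (nonempty i (n≤0⇒n≡0 h)) }) , e
    where
    nonempty : ∀ {a} {as : List (Action nQ g)} → a ∈ as → length as ≢ 0
    nonempty (here _)  ()
    nonempty (there _) ()

  -- `leads` tolerates any continuation `z`, so that certificates can be padded to the length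
  -- required of a clock. `forced` makes the certificate of a deterministic run computable, since
  -- only its length is left open.
  record Certificate (A : Lang) (t : ℕ) (c : Conf) : Set where
    field
      choices : Str
      count   : ℕ
      short   : length choices ≤ t * d
      quick   : count ≤ t
      forced  : Deterministic → choices ≡ ones (length choices)
      leads   : ∀ z → accepting (proj₁ (steps A count (c , choices ++ z))) ≡ true

  open Certificate

  extend : ∀ {A t c c'} v → length v ≤ d → (Deterministic → v ≡ ones (length v)) →
    (∀ z → step A (c , v ++ z) ≡ (c' , z)) → Certificate A t c' → Certificate A (suc t) c
  extend v le f e C .choices = v ++ choices C
  extend v le f e C .count   = suc (count C)
  extend v le f e C .short   = ≤-trans (≤-reflexive (length-++ v)) (+-mono-≤ le (short C))
  extend v le f e C .quick   = s≤s (quick C)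
  extend v le f e C .forced D = trans (cong₂ _++_ (f D) (forced C D))
    (trans (ones-+ (length v) (length (choices C))) (cong ones (sym (length-++ v))))
  extend {A} {c = c} v le f e C .leads z = subst (λ s → accepting (proj₁ s) ≡ true) (sym path) (leads C z)
    where
    path : steps A (suc (count C)) (c , (v ++ choices C) ++ z) ≡ steps A (count C) (_ , choices C ++ z)
    path = trans (cong (λ n → steps A n (c , (v ++ choices C) ++ z)) (+-comm 1 (count C)))
      (trans (steps-+ A (count C) 1 _)
        (cong (steps A (count C)) (trans (cong (λ w → step A (c , w)) (++-assoc v (choices C) z)) (e (choices C ++ z)))))

  certify : ∀ {A} t c → HaltsWithin A t c → Accepts A c → Certificate A t c
  certify t c h (here e) = record
    { choices = [] ; count = 0 ; short = z≤n ; quick = z≤n ; forced = λ _ → refl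
    ; leads = λ z → subst (λ k → isAcc k ≡ true) (sym e) refl }
  certify {A} zero c h (there i x) with successors A c | h | i
  ... | .[] | refl | ()
  certify (suc t) (config (st p) l h r q) H (there i x) with ∈-map⁻ _ i
  ... | a , j , refl with selector (δ p h) j
  ... | v , le , ones≡ , e = extend v (≤-trans le (proj₂ degree p h)) (λ D → ones≡ (D p h))
          (λ z → e _ z) (certify t _ (All.lookup H i) x)
  certify (suc t) (config (ask p₁ p₀) l h r q) (H ∷ []) (there (here refl) x) =
    extend [] z≤n (λ _ → refl) (λ z → refl) (certify t _ H x)

  runAcc-certified : ∀ {A t} x (C : Certificate A t (initial x)) z → count C ≤ length (choices C ++ z) →
    runAcc A x (choices C ++ z) ≡ true
  runAcc-certified {A} x C z le with m≤n⇒∃[o]m+o≡n le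
  ... | o , eq = trans (cong (accepting ∘ proj₁)
      (trans (cong (λ n → steps A n s) (trans (sym eq) (+-comm (count C) o)))
        (trans (steps-+ A o (count C) s) (steps-acc A o _ (leads C z)))))
      (leads C z)
    where
    s : Conf × Str
    s = initial x , choices C ++ z

  qlen : Conf × Str → ℕ
  qlen s = length (Config.qry (proj₁ s))

  qlen-apply : ∀ c a → length (Config.qry (apply c a)) ≤ suc (length (Config.qry c))
  qlen-apply (config _ l _ r q) (c , b , mv , w) = ≤-trans (≤-reflexive (cong length (moved mv l b r _))) (appended w)
    where
    moved : ∀ mv l b r c → Config.qry (moveTape mv l b r c) ≡ Config.qry c
    moved moveL []      b r       c = refl
    moved moveL (_ ∷ _) b r       c = refl
    moved moveR l       b []      c = refl
    moved moveR l       b (_ ∷ _) c = refl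
    moved stay  l       b r       c = refl
    appended : ∀ w → length (appendQ q w) ≤ suc (length q)
    appended nothing  = n≤1+n _
    appended (just b) = ≤-reflexive (trans (length-++ q) (+-comm (length q) 1))

  qlen-pick : ∀ as c w → length (Config.qry (proj₁ (pick as c w))) ≤ suc (length (Config.qry c))
  qlen-pick []       c w           = n≤1+n _
  qlen-pick (a ∷ as) c []          = n≤1+n _
  qlen-pick (a ∷ as) c (true ∷ w)  = qlen-apply c a
  qlen-pick (a ∷ as) c (false ∷ w) = qlen-pick as c w

  qlen-step : ∀ O s → qlen (step O s) ≤ suc (qlen s)
  qlen-step O (config (st p) l h r q , w)      = qlen-pick (δ p h) _ w
  qlen-step O (config acc l h r q , w)         = n≤1+n _
  qlen-step O (config rej l h r q , w)         = n≤1+n _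
  qlen-step O (config (ask p₁ p₀) l h r q , w) = z≤n

  qlen-steps : ∀ O n s → qlen (steps O n s) ≤ n + qlen s
  qlen-steps O zero    s = ≤-refl
  qlen-steps O (suc n) s = ≤-trans (qlen-step O (steps O n s)) (s≤s (qlen-steps O n s))

  step-agree : ∀ O O' s → O (Config.qry (proj₁ s)) ≡ O' (Config.qry (proj₁ s)) → step O s ≡ step O' s
  step-agree O O' (config (st p) l h r q , w)      e = refl
  step-agree O O' (config acc l h r q , w)         e = refl
  step-agree O O' (config rej l h r q , w)         e = refl
  step-agree O O' (config (ask p₁ p₀) l h r q , w) e = cong (λ b → config (st (if b then p₁ else p₀)) l h r [] , w) e

  steps-agree : ∀ O O' n s → (∀ q → length q ≤ n + qlen s → O q ≡ O' q) → steps O n s ≡ steps O' n s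
  steps-agree O O' zero    s h = refl
  steps-agree O O' (suc n) s h = trans
    (step-agree O O' (steps O n s) (h _ (≤-trans (qlen-steps O n s) (n≤1+n _))))
    (cong (step O') (steps-agree O O' n s (λ q le → h q (≤-trans le (n≤1+n _)))))

  qlen-initial : ∀ x → length (Config.qry (initial x)) ≡ 0
  qlen-initial []      = refl
  qlen-initial (_ ∷ _) = refl

  -- A step lengthens the query by at most one bit, so a run of `length w` steps asks nothing longer
  -- than `w`. This permits an oracle to be replaced by one that is right on short strings only.
  runAcc-agree : ∀ O O' x w → (∀ q → length q ≤ length w → O q ≡ O' q) → runAcc O x w ≡ runAcc O' x w
  runAcc-agree O O' x w h = cong (accepting ∘ proj₁) (steps-agree O O' (length w) (initial x , w)
    (λ q le → h q (≤-trans le (≤-reflexive (trans (cong (length w +_) (qlen-initial x)) (+-identityʳ _))))))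

  C Y L U T : Coded
  C = finite (ctrlFinite nQ)
  Y = finC (suc (suc (suc g)))
  L = listC Y
  U = L ⊗ L ⊗ str ⊗ str ⊗ str
  T = C ⊗ Y ⊗ U

  toT : (Conf × Str) × Str → Carrier T
  toT ((config c l h r q , w) , x) = c , h , l , r , q , w , x

  fromT : Carrier T → (Conf × Str) × Str
  fromT (c , h , l , r , q , w , x) = (config c l h r q , w) , x

  -- The input `x` is carried along unchanged because the simulated oracle may depend on it: the
  -- query `q` is answered by `O q x`.
  SimC : Coded
  SimC .Carrier = (Conf × Str) × Str
  SimC .enc s   = enc T (toT s)

  conf : ∀ (p : Ctrl nQ) h → Carrier U → (Conf × Str) × Str
  conf p h (l , r , q , w , x) = (config p l h r q , w) , x

  build : ∀ {B X c h l r q w x} → FP B X C c → FP B X Y h → FP B X L l → FP B X L r → FP B X str q →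
    FP B X str w → FP B X str x → FP B X SimC (λ a → (config (c a) (l a) (h a) (r a) (q a) , w a) , x a)
  build c h l r q w x = recode {X = T} {f = fromT} (λ _ → refl) ∙ ⟨ c , ⟨ h , ⟨ l , ⟨ r , ⟨ q , ⟨ w , x ⟩ ⟩ ⟩ ⟩ ⟩ ⟩

  appendQF : ∀ {B X q} wr → FP B X str q → FP B X str (λ a → appendQ (q a) wr)
  appendQF nothing  q = q
  appendQF (just b) q = appendF ∙ ⟨ q , const str [ b ] ⟩

  applyF : ∀ {B} (p : Ctrl nQ) h a → FP B U SimC (λ { (l , r , q , w , x) → (apply (config p l h r q) a , w) , x })
  applyF p h (c' , b , stay , wr) =
    build (const C c') (const Y b) fst (fst ∙ snd) (appendQF wr (fst ∙ snd ∙ snd)) (fst ∙ snd ∙ snd ∙ snd) (snd ∙ snd ∙ snd ∙ snd)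
  applyF p h (c' , b , moveL , wr) = ext (λ { ([] , _) → refl ; (_ ∷ _ , _) → refl })
    (caseList {X = L ⊗ str ⊗ str ⊗ str}
      (build (const C c') (const Y blank) (const L []) (consF ∙ ⟨ const Y b , fst ⟩)
        (appendQF wr (fst ∙ snd)) (fst ∙ snd ∙ snd) (snd ∙ snd ∙ snd))
      (build (const C c') (fst ∙ fst) (snd ∙ fst) (consF ∙ ⟨ const Y b , fst ∙ snd ⟩)
        (appendQF wr (fst ∙ snd ∙ snd)) (fst ∙ snd ∙ snd ∙ snd) (snd ∙ snd ∙ snd ∙ snd)))
  applyF p h (c' , b , moveR , wr) = ext (λ { (_ , [] , _) → refl ; (_ , _ ∷ _ , _) → refl })
    (caseList {X = L ⊗ str ⊗ str ⊗ str}
      (build (const C c') (const Y blank) (consF ∙ ⟨ const Y b , fst ⟩) (const L [])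
        (appendQF wr (fst ∙ snd)) (fst ∙ snd ∙ snd) (snd ∙ snd ∙ snd))
      (build (const C c') (fst ∙ fst) (consF ∙ ⟨ const Y b , fst ∙ snd ⟩) (snd ∙ fst)
        (appendQF wr (fst ∙ snd ∙ snd)) (fst ∙ snd ∙ snd ∙ snd) (snd ∙ snd ∙ snd ∙ snd))
      ∙ ⟨ fst ∙ snd , ⟨ fst , snd ∙ snd ⟩ ⟩)

  pickU : (p : Fin (suc nQ)) (h : Sym g) → List (Action nQ g) → Carrier U → (Conf × Str) × Str
  pickU p h as (l , r , q , w , x) = pick as (config (st p) l h r q) w , x

  pickF : ∀ {B} p h as → FP B U SimC (pickU p h as)
  pickF p h [] =
    build (const C (st p)) (const Y h) fst (fst ∙ snd) (fst ∙ snd ∙ snd) (const str []) (snd ∙ snd ∙ snd ∙ snd)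
  pickF p h (a ∷ as) = ext (λ { (l , r , q , [] , x) → refl ; (l , r , q , true ∷ w , x) → refl ; (l , r , q , false ∷ w , x) → refl })
    (caseStr {X = U} {g = λ b → choice b ∘ rest}
      (build (const C (st p)) (const Y h) fst (fst ∙ snd) (fst ∙ snd ∙ snd) (const str []) (snd ∙ snd ∙ snd ∙ snd))
      (λ { false → pickF p h as ∙ restF ; true → applyF (st p) h a ∙ restF })
      ∙ ⟨ fst ∙ snd ∙ snd ∙ snd , idF ⟩)
    where
    rest : Str × Carrier U → Carrier U
    rest (w , l , r , q , _ , x) = l , r , q , w , x
    restF : ∀ {B} → FP B (str ⊗ U) U rest
    restF = ⟨ fst ∙ snd , ⟨ fst ∙ snd ∙ snd , ⟨ fst ∙ snd ∙ snd ∙ snd , ⟨ fst , snd ∙ snd ∙ snd ∙ snd ∙ snd ⟩ ⟩ ⟩ ⟩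
    choice : Bool → Carrier U → (Conf × Str) × Str
    choice false u = pickU p h as u
    choice true (l , r , q , w , x) = (apply (config (st p) l h r q) a , w) , x

  stepWith : (Str → Str → Bool) → (Conf × Str) × Str → (Conf × Str) × Str
  stepWith O (s , x) = step (λ q → O q x) s , x

  stepT : (Str → Str → Bool) → Ctrl nQ → Carrier (Y ⊗ U) → (Conf × Str) × Str
  stepT O c (h , u) = stepWith O (conf c h u)

  stepTF : ∀ {B O} → FP₂ B O → ∀ c → FP B (Y ⊗ U) SimC (stepT O c)
  stepTF F (st p) = caseFin _ (λ h → pickF p h (δ p h))
  stepTF F acc = build (const C acc) fst (fst ∙ snd) (fst ∙ snd ∙ snd) (fst ∙ snd ∙ snd ∙ snd)
    (fst ∙ snd ∙ snd ∙ snd ∙ snd) (snd ∙ snd ∙ snd ∙ snd ∙ snd)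
  stepTF F rej = build (const C rej) fst (fst ∙ snd) (fst ∙ snd ∙ snd) (fst ∙ snd ∙ snd ∙ snd)
    (fst ∙ snd ∙ snd ∙ snd ∙ snd) (snd ∙ snd ∙ snd ∙ snd ∙ snd)
  stepTF {O = O} F (ask p₁ p₀) = ext (λ { (h , l , r , q , w , x) → lemma (O q x) })
    (ifF (F ∙ ⟨ fst ∙ snd ∙ snd ∙ snd , snd ∙ snd ∙ snd ∙ snd ∙ snd ⟩) (next p₁) (next p₀))
    where
    next : ∀ {B} p → FP B (Y ⊗ U) SimC (λ { (h , l , r , q , w , x) → (config (st p) l h r [] , w) , x })
    next p = build (const C (st p)) fst (fst ∙ snd) (fst ∙ snd ∙ snd) (const str [])
      (fst ∙ snd ∙ snd ∙ snd ∙ snd) (snd ∙ snd ∙ snd ∙ snd ∙ snd)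
    lemma : ∀ b {l h r w x} →
      _≡_ {A = (Conf × Str) × Str} (if b then ((config (st p₁) l h r [] , w) , x) else ((config (st p₀) l h r [] , w) , x))
      ((config (st (if b then p₁ else p₀)) l h r [] , w) , x)
    lemma false = refl
    lemma true  = refl

  stepF : ∀ {B O} → FP₂ B O → FP B SimC SimC (stepWith O)
  stepF F = caseFinite (ctrlFinite nQ) (stepTF F) ∙ recode {Y = T} {toT} (λ _ → refl)

  -- Agrees with the length of the code up to the factor `K`, but grows additively: a step adds at
  -- most one cell and one query bit. A bound of the code by a constant factor per step would become
  -- exponential over a run.
  measure : (Conf × Str) × Str → ℕ
  measure ((config c l h r q , w) , x) = length l + length r + length q + length w + length x

  measure-moved : ∀ mv l b r c' q → let c = moveTape mv l b r (config c' l b r q) in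
    length (Config.left c) + length (Config.right c) ≤ suc (length l + length r)
  measure-moved moveL []      b r       c' q = ≤-refl
  measure-moved moveL (_ ∷ l) b r       c' q = ≤-trans (≤-reflexive (+-suc (length l) (length r))) (n≤1+n _)
  measure-moved moveR l       b []      c' q = ≤-refl
  measure-moved moveR l       b (_ ∷ r) c' q = s≤s (+-monoʳ-≤ (length l) (n≤1+n (length r)))
  measure-moved stay  l       b r       c' q = n≤1+n _

  measure-apply : ∀ p l h r q a w x →
    measure ((apply (config p l h r q) a , w) , x) ≤ 2 + measure ((config p l h r q , w) , x)
  measure-apply p l h r q a@(c' , b , mv , wr) w x = +-monoˡ-≤ (length x) (+-monoˡ-≤ (length w)
    (≤-trans (+-mono-≤ (measure-moved mv l b r c' (appendQ q wr)) (qlen-apply (config p l h r q) a))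
      (≤-reflexive (cong suc (+-suc (length l + length r) (length q))))))

  measure-shrink : ∀ c (w w' : Str) x → length w' ≤ length w → measure ((c , w') , x) ≤ measure ((c , w) , x)
  measure-shrink c w w' x le = +-monoˡ-≤ (length x) (+-monoʳ-≤ _ le)

  measure-pick : ∀ p l h r q as w x →
    measure (pick as (config p l h r q) w , x) ≤ 2 + measure ((config p l h r q , w) , x)
  measure-pick p l h r q []       w           x = ≤-trans (measure-shrink (config p l h r q) w [] x z≤n) (m≤n+m _ 2)
  measure-pick p l h r q (a ∷ as) []          x = m≤n+m _ 2
  measure-pick p l h r q (a ∷ as) (true ∷ w)  x = ≤-trans (measure-apply p l h r q a w x)
    (+-monoʳ-≤ 2 (measure-shrink (config p l h r q) (true ∷ w) w x (n≤1+n _)))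
  measure-pick p l h r q (a ∷ as) (false ∷ w) x = ≤-trans (measure-pick p l h r q as w x)
    (+-monoʳ-≤ 2 (measure-shrink (config p l h r q) (false ∷ w) w x (n≤1+n _)))

  measure-step : ∀ O s → measure (stepWith O s) ≤ 2 + measure s
  measure-step O ((config (st p) l h r q , w) , x)      = measure-pick (st p) l h r q (δ p h) w x
  measure-step O ((config acc l h r q , w) , x)         = m≤n+m _ 2
  measure-step O ((config rej l h r q , w) , x)         = m≤n+m _ 2
  measure-step O ((config (ask p₁ p₀) l h r q , w) , x) =
    ≤-trans (+-monoˡ-≤ (length x) (+-monoˡ-≤ (length w) (+-monoʳ-≤ (length l + length r) z≤n))) (m≤n+m _ 2)

  measure-steps : ∀ O (y : Str) s → measure (foldr (λ _ → stepWith O) s y) ≤ 2 * length y + measure s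
  measure-steps O []      s = ≤-refl
  measure-steps O (b ∷ y) s = ≤-trans (measure-step O (foldr (λ _ → stepWith O) s y))
    (≤-trans (+-monoʳ-≤ 2 (measure-steps O y s))
      (≤-reflexive (solve 2 (λ y m → κ 2 :+ (κ 2 :* y :+ m) := κ 2 :* (κ 1 :+ y) :+ m) refl (length y) (measure s))))

  len≤enc : ∀ l → length l ≤ size L l
  len≤enc []      = z≤n
  len≤enc (a ∷ l) = ≤-trans (s≤s (≤-trans (len≤enc l) (m≤n+m _ _))) (≤-reflexive (sym (length-pr (unary a) (enc L l))))

  σ D K : ℕ
  σ = suc (suc (suc g))
  D = suc (σ + σ)
  K = 6 + (Finite.size (ctrlFinite nQ) + Finite.size (ctrlFinite nQ)) + (σ + σ) + (D + D)

  enc≤len : ∀ l → size L l ≤ D * length l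
  enc≤len []      = z≤n
  enc≤len (a ∷ l) = begin
    size L (a ∷ l)                                            ≡⟨ length-pr (unary a) (enc L l) ⟩
    suc (length (unary a) + length (unary a) + size L l)      ≤⟨ s≤s (+-mono-≤ (+-mono-≤ (length-unary a) (length-unary a)) (enc≤len l)) ⟩
    D + D * length l                                          ≡⟨ sym (*-suc D (length l)) ⟩
    D * suc (length l)                                        ∎
    where open ≤-Reasoning

  size-T : ∀ c h l r q w x → size T (c , h , l , r , q , w , x) ≡
    (6 + (size C c + size C c) + (size Y h + size Y h)) + (size L l + size L l) + (size L r + size L r)
      + (length q + length q) + (length w + length w) + length x
  size-T c h l r q w x
    rewrite length-pr (enc C c) (enc (Y ⊗ U) (h , l , r , q , w , x))
          | length-pr (enc Y h) (enc U (l , r , q , w , x))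
          | length-pr (enc L l) (pr (enc L r) (pr q (pr w x)))
          | length-pr (enc L r) (pr q (pr w x))
          | length-pr q (pr w x)
          | length-pr w x
    = solve 7 (λ c h l r q w x →
        κ 1 :+ (c :+ c :+ (κ 1 :+ (h :+ h :+ (κ 1 :+ (l :+ l :+ (κ 1 :+ (r :+ r :+ (κ 1 :+ (q :+ q :+ (κ 1 :+ (w :+ w :+ x)))))))))))
        := (κ 6 :+ (c :+ c) :+ (h :+ h)) :+ (l :+ l) :+ (r :+ r) :+ (q :+ q) :+ (w :+ w) :+ x) refl
        (size C c) (size Y h) (size L l) (size L r) (length q) (length w) (length x)

  size≤measure : ∀ s → size SimC s ≤ K * suc (measure s)
  size≤measure ((config c l h r q , w) , x) = begin
    size T (c , h , l , r , q , w , x)    ≡⟨ size-T c h l r q w x ⟩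
    (6 + (size C c + size C c) + (size Y h + size Y h)) + (size L l + size L l) + (size L r + size L r)
      + (length q + length q) + (length w + length w) + length x
      ≤⟨ +-mono-≤ (+-mono-≤ (+-mono-≤ (+-mono-≤ (+-mono-≤ base (list≤ l)) (list≤ r)) (two q)) (two w)) (one x) ⟩
    K + K * length l + K * length r + K * length q + K * length w + K * length x
      ≡⟨ solve 6 (λ k l r q w x → k :+ k :* l :+ k :* r :+ k :* q :+ k :* w :+ k :* x :=
                                  k :* (κ 1 :+ (l :+ r :+ q :+ w :+ x))) refl K (length l) (length r) (length q) (length w) (length x) ⟩
    K * suc (length l + length r + length q + length w + length x) ∎
    where
    open ≤-Reasoning
    c≤ : size C c ≤ Finite.size (ctrlFinite nQ)
    c≤ = length-unary (Finite.index (ctrlFinite nQ) c)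
    base : 6 + (size C c + size C c) + (size Y h + size Y h) ≤ K
    base = ≤-trans (+-mono-≤ (+-monoʳ-≤ 6 (+-mono-≤ c≤ c≤)) (+-mono-≤ (length-unary h) (length-unary h))) (m≤m+n _ _)
    list≤ : ∀ l → size L l + size L l ≤ K * length l
    list≤ l = ≤-trans (+-mono-≤ (enc≤len l) (enc≤len l))
      (≤-trans (≤-reflexive (sym (*-distribʳ-+ (length l) D D)))
        (*-monoˡ-≤ (length l) {D + D} {K}
          (m≤n+m (D + D) (6 + (Finite.size (ctrlFinite nQ) + Finite.size (ctrlFinite nQ)) + (σ + σ)))))
    two : ∀ (q : Str) → length q + length q ≤ K * length q
    two q = ≤-trans (≤-reflexive (cong (length q +_) (sym (+-identityʳ (length q))))) (*-monoˡ-≤ (length q) {2} {K} (s≤s (s≤s z≤n)))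
    one : ∀ (q : Str) → length q ≤ K * length q
    one q = ≤-trans (m≤m+n _ _) (two q)

  measure≤size : ∀ s → measure s ≤ size SimC s
  measure≤size ((config c l h r q , w) , x) = ≤-trans
    (+-monoˡ-≤ (length x) (+-mono-≤ (+-mono-≤ (+-mono-≤
      (≤-trans (≤-trans (len≤enc l) (m≤m+n _ _)) (m≤n+m _ (6 + (size C c + size C c) + (size Y h + size Y h))))
      (≤-trans (len≤enc r) (m≤m+n _ _))) (m≤m+n _ _)) (m≤m+n _ _)))
    (≤-reflexive (sym (size-T c h l r q w x)))

  simF : ∀ {B O} → FP₂ B O →
    FP B (str ⊗ SimC) SimC (λ p → foldr (λ _ → stepWith O) (proj₂ p) (proj₁ p))
  simF {B} {O} F = foldrF (λ _ → stepF F) (con K ⊠ (con 1 ⊞ (con 2 ⊠ var ⊞ var))) bounded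
    where
    bounded : ∀ y s → size SimC (foldr (λ _ → stepWith O) s y) ≤ K * suc (2 * size (str ⊗ SimC) (y , s) + size (str ⊗ SimC) (y , s))
    bounded y s = ≤-trans (size≤measure (foldr (λ _ → stepWith O) s y))
      (*-monoʳ-≤ K (s≤s (≤-trans (measure-steps O y s) (+-mono-≤ (*-monoʳ-≤ 2 y≤) (≤-trans (measure≤size s) s≤)))))
      where
      y≤ : length y ≤ size (str ⊗ SimC) (y , s)
      y≤ = ≤-trans (≤-trans (≤-trans (m≤m+n _ _) (m≤m+n _ _)) (n≤1+n _)) (≤-reflexive (sym (length-pr y (enc SimC s))))
      s≤ : size SimC s ≤ size (str ⊗ SimC) (y , s)
      s≤ = ≤-trans (≤-trans (m≤n+m _ (length y + length y)) (n≤1+n _)) (≤-reflexive (sym (length-pr y (enc SimC s))))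

  startF : ∀ {B} → FP B (str ⊗ str) SimC (λ { (w , x) → (initial x , w) , x })
  startF = ext (λ { (w , []) → refl ; (w , b ∷ x) → refl })
    (caseStr {X = str ⊗ str}
      {f = λ { (w , x) → (config (st zero) [] blank [] [] , w) , x }}
      {g = λ { b (y , w , x) → (config (st zero) [] (encBit b) (map encBit y) [] , w) , x }}
      (build (const C (st zero)) (const Y blank) (const L []) (const L []) (const str []) fst snd)
      (λ b → build (const C (st zero)) (const Y (encBit b)) (const L []) (mapF Y encBit ∙ fst) (const str []) (fst ∙ snd) (snd ∙ snd))
      ∙ ⟨ snd , idF ⟩)

  acceptF : ∀ {B} → FP B SimC bool (λ s → accepting (proj₁ (proj₁ s)))
  acceptF = caseFinite (ctrlFinite nQ) {f = λ c _ → isAcc c} (λ c → const bool (isAcc c)) ∙ recode {Y = T} {toT} (λ _ → refl)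

  abstract
    runF : ∀ {B} {O : Str → Str → Bool} → FP₂ B O →
      FP B (str ⊗ str) bool (λ p → runAcc (λ q → O q (proj₂ p)) (proj₂ p) (proj₁ p))
    runF {O = O} F = ext (λ p → cong (accepting ∘ proj₁ ∘ proj₁) (iter (proj₁ p) _ (proj₂ p)))
      (acceptF ∙ simF {O = O} F ∙ ⟨ fst , startF ⟩)
      where
      iter : ∀ (y : Str) (s : Conf × Str) (x : Str) → foldr (λ _ → stepWith O) (s , x) y ≡ (steps (λ q → O q x) (length y) s , x)
      iter []      s x = refl
      iter (b ∷ y) s x = cong (stepWith O) (iter y s x)

-- Certificates for nondeterministic polynomial time

≡-from-⇔ : ∀ {a b : Bool} → (a ≡ true → b ≡ true) → (b ≡ true → a ≡ true) → a ≡ b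
≡-from-⇔ {false} {false} f g = refl
≡-from-⇔ {false} {true}  f g = g refl
≡-from-⇔ {true}  {false} f g = sym (f refl)
≡-from-⇔ {true}  {true}  f g = refl

reverseF : ∀ {B} → FP B str str reverse
reverseF = ext lemma (foldrF+ {f = λ b x → x ++ [ b ]} 1 (λ b → appendF ∙ ⟨ idF , const str [ b ] ⟩)
    (λ b x → ≤-reflexive (trans (length-++ x) (+-comm (length x) 1))) ∙ ⟨ idF , const str [] ⟩)
  where
  lemma : ∀ x → foldr (λ b x → x ++ [ b ]) [] x ≡ reverse x
  lemma []      = refl
  lemma (b ∷ x) = trans (cong (_++ [ b ]) (lemma x)) (sym (unfold-reverse b x))

-- From programs to whole machines

module Machine (R : ℕ) (0<R : 0 < R) (c : Cmd) (u : Uses≤ R c) where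

  nStates : ℕ
  nStates = Finite.size (St-finite c)

  open Compile R nStates

  inj : St c → State
  inj q = suc (Finite.index (St-finite c) q)

  δ : State → Cell → List Act
  -- The head starts on the first input symbol; the blank cell to its left becomes the resting
  -- position.
  δ zero    a = left (inj (entry c)) a
  δ (suc i) a = instr c inj zero (Finite.element (St-finite c) i) a

  code : ∀ p a → δ (inj p) a ≡ instr c inj zero p a
  code p a = cong (λ q → instr c inj zero q a) (Finite.element-index (St-finite c) p)

  machine : OTM
  machine = record { nQ = nStates ; g = 3 ^ R ; δ = δ }

  deterministic : Det c → Run.Deterministic machine
  deterministic D zero    a = ≤-refl
  deterministic D (suc i) a = instr-det c inj zero D _ a

  -- The first input symbol lies at the bottom of the stack, hence the reversal, which programs for
  -- whole languages undo with `reverseF`.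
  input : Str → Store
  input x zero    = reverse x
  input x (suc _) = []

  module _ (A : Lang) where
    open Sound R nStates δ A hiding (M)
    open Run machine

    rep-input : ∀ x → Rep (map encBit x) (input x)
    rep-input x zero    lt i = trans (go x i) (cong (λ y → idx y i) (sym (reverse-involutive x)))
      where
      go : ∀ x i → get R 0 (nth (map encBit x) i) ≡ idx x i
      go []      i       = get-blank R 0
      go (b ∷ x) zero    = get-input R b lt
      go (b ∷ x) (suc i) = go x i
    rep-input x (suc r) lt i = go x i
      where
      go : ∀ x i → get R (suc r) (nth (map encBit x) i) ≡ nothing
      go []      i       = get-blank R (suc r)
      go (b ∷ x) zero    = get-input-other R r b
      go (b ∷ x) (suc i) = go x i

    begins : ∀ x {t b} → Ready (inj (entry c)) (input x) t b → Good (suc t) b (initial x)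
    begins []      rd = Good-step refl (from rd (blank ∷ []) (λ r lt i → trans (blanks r i) (rep-input [] r lt i)))
      where
      blanks : ∀ r i → get R r (nth (blank ∷ []) i) ≡ get R r (nth [] i)
      blanks r zero    = refl
      blanks r (suc i) = refl
    begins (b ∷ x) rd = Good-step refl (from rd (map encBit (b ∷ x)) (rep-input (b ∷ x)))

    decides : ∀ {L} (P : Poly) → (∀ x → Ready (inj (entry c)) (input x) (⟦ P ⟧ (length x)) (L x)) →
              PolyTime A × Decides A L
    decides {L} P rd with poly-bound (con 1 ⊞ P)
    ... | k , le = (k , λ x → halts-mono (initial x) (le (length x)) (Good.halts (begins x (rd x)))) ,
                   λ x → Good.only (begins x (rd x)) , Good.does (begins x (rd x))

verdict : Cmd
verdict = pop 0 (halt false) (halt false) (halt true)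

module Verdict (R nQ : ℕ) (0<R : 0 < R) (δ : Fin (suc nQ) → Sym (3 ^ R) → List (Action nQ (3 ^ R))) (A : Lang) where
  open Sound R nQ δ A
  open Compile R nQ

  -- The time is `cost 1` for popping the only bit, plus one step of `halt`.
  verdict-ready : (inj : St verdict → State) (e : State) → (∀ p a → δ (inj p) a ≡ instr verdict inj e p a) →
    ∀ {s b} → s 0 ≡ [ b ] → Ready (inj (entry verdict)) s 7 b
  verdict-ready inj e code {s} {false} eq = retime (inj (inj₁ zero)) s false (cong (λ n → cost n + 1) (cong length eq))
    (pop-ready-∷ (inj ∘ inj₁) (inj (inj₂ (inj₁ zero))) (inj (inj₂ (inj₂ (inj₁ zero)))) (inj (inj₂ (inj₂ (inj₂ zero))))
      (λ p a → code (inj₁ p) a) 0<R eq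
      (halt-ready false (inj ∘ inj₂ ∘ inj₂ ∘ inj₁) e (λ p a → code (inj₂ (inj₂ (inj₁ p))) a)))
  verdict-ready inj e code {s} {true} eq = retime (inj (inj₁ zero)) s true (cong (λ n → cost n + 1) (cong length eq))
    (pop-ready-∷ (inj ∘ inj₁) (inj (inj₂ (inj₁ zero))) (inj (inj₂ (inj₂ (inj₁ zero)))) (inj (inj₂ (inj₂ (inj₂ zero))))
      (λ p a → code (inj₁ p) a) 0<R eq
      (halt-ready true (inj ∘ inj₂ ∘ inj₂ ∘ inj₂) e (λ p a → code (inj₂ (inj₂ (inj₂ p))) a)))

abstract
  FP⇒P : ∀ {B L} → FP B str bool L → P^ B L
  FP⇒P {B} {L} F = machine , deterministic (det G , tt , tt , tt) , decides B (time G ⊞ con 7) ready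
    where
    G : FP B str bool (L ∘ reverse)
    G = F ∙ reverseF
    R : ℕ
    R = suc (regs G)
    c : Cmd
    c = prog G ⨾ verdict
    open Machine R (s≤s z≤n) c (Uses-mono (prog G) (n≤1+n _) (uses G) , s≤s z≤n , tt , tt , tt)
    open Compile R nStates
    open Sound R nStates δ B
    open Verdict R nStates (s≤s z≤n) δ B
    ready : ∀ x → Ready (inj (entry c)) (input x) (⟦ time G ⊞ con 7 ⟧ (length x)) (L x)
    ready x = subst (λ n → Ready (inj (entry c)) (input x) (⟦ time G ⟧ n + 7) (L x)) (length-reverse x)
      (sound (prog G) (inj ∘ inj₁) (inj (inj₂ (entry verdict))) (code ∘ inj₁) (Uses-mono (prog G) (n≤1+n _) (uses G))
        (exec G (reverse x) (input x) refl (λ { (suc i) lt lt' → refl }))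
        (subst (λ y → Ready (inj (inj₂ (entry verdict))) (input x [ 0 ≔ [ L y ] ]) 7 (L x)) (sym (reverse-involutive x))
          (verdict-ready (inj ∘ inj₂) zero (λ p a → code (inj₂ p) a) {b = L x} refl)))

-- The disjunction has the shape of the computation tree, in which `choose` joins two outcomes; `ζ`
-- grows at the front because guessed bits are pushed on a stack.
anyGuess : ℕ → (Str → Bool) → Str → Bool
anyGuess zero    β ζ = β ζ
anyGuess (suc n) β ζ = anyGuess n β (false ∷ ζ) ∨ anyGuess n β (true ∷ ζ)

anyGuess-sound : ∀ n β ζ → anyGuess n β ζ ≡ true → ∃ λ ζ' → β ζ' ≡ true
anyGuess-sound zero    β ζ e = ζ , e
anyGuess-sound (suc n) β ζ e with anyGuess n β (false ∷ ζ) in eq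
... | true  = anyGuess-sound n β (false ∷ ζ) eq
... | false = anyGuess-sound n β (true ∷ ζ) e

anyGuess-complete : ∀ (y : Str) β ζ → β (y ʳ++ ζ) ≡ true → anyGuess (length y) β ζ ≡ true
anyGuess-complete []          β ζ e = e
anyGuess-complete (false ∷ y) β ζ e rewrite anyGuess-complete y β (false ∷ ζ) e = refl
anyGuess-complete (true ∷ y)  β ζ e rewrite anyGuess-complete y β (true ∷ ζ) e = ∨-zeroʳ _

module Guessing {B : Lang} {V : Str × Str → Bool} (F : FP B (str ⊗ str) bool V) (P : Poly)
  (pre' : FP B str (str ⊗ str) (λ x → ones (⟦ P ⟧ (length (reverse x))) , reverse x)) where

  m R : ℕ
  m = suc (regs pre' ⊔ regs F)
  R = suc (suc m)

  -- A bit followed by `true` extends the first component of the pair in register 0, so the guesses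
  -- build `pr ζ x` in place. Register `m`, filled with ones by `pre'`, counts them.
  guess : Cmd
  guess = choose (push 0 false) (push 0 true) ⨾ push 0 true

  c₁ c₂ c₃ : Cmd
  c₃ = loop m guess guess ⨾ (prog F ⨾ verdict)
  c₂ = push 0 false ⨾ c₃
  c₁ = split m ⨾ c₂

  c : Cmd
  c = prog pre' ⨾ c₁

  m< : m < R
  m< = n≤1+n _

  pre≤ : regs pre' ≤ m
  pre≤ = ≤-trans (m≤m⊔n (regs pre') (regs F)) (n≤1+n _)

  F≤ : regs F ≤ m
  F≤ = ≤-trans (m≤n⊔m (regs pre') _) (n≤1+n _)

  m≤ : m ≤ R
  m≤ = ≤-trans (n≤1+n _) (n≤1+n _)

  uses-guess : Uses≤ R guess
  uses-guess = (s≤s z≤n , s≤s z≤n) , s≤s z≤n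

  uses-F : Uses≤ R (prog F)
  uses-F = Uses-mono (prog F) (≤-trans F≤ m≤) (uses F)

  uses-pre : Uses≤ R (prog pre')
  uses-pre = Uses-mono (prog pre') (≤-trans pre≤ m≤) (uses pre')

  open Machine R (s≤s z≤n) c
    (uses-pre , split-uses m , s≤s z≤n , (m< , uses-guess , uses-guess) , uses-F , s≤s z≤n , tt , tt , tt)
  open Compile R nStates
  open Sound R nStates δ B hiding (M)
  open Verdict R nStates (s≤s z≤n) δ B

  module _ (x : Str) where
    n p N : ℕ
    n = length x
    p = ⟦ P ⟧ n
    N = suc (p + p + n)

    β : Str → Bool
    β ζ = V (ζ , x)

    open Frame (λ _ → []) m (s≤s z≤n)

    finalTime roundTime : ℕ
    finalTime = ⟦ time F ⟧ N + 7
    roundTime = cost N + suc (cost N + cost N)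

    injL : St (loop m guess guess) → State
    injL = inj ∘ inj₂ ∘ inj₂ ∘ inj₂ ∘ inj₁

    injV : St (prog F ⨾ verdict) → State
    injV = inj ∘ inj₂ ∘ inj₂ ∘ inj₂ ∘ inj₂

    final : ∀ ζ → length ζ ≡ p → Ready (injV (entry (prog F ⨾ verdict))) (S (pr ζ x) [] []) finalTime (β ζ)
    final ζ e = subst (λ k → Ready (injV (entry (prog F ⨾ verdict))) (S (pr ζ x) [] []) (⟦ time F ⟧ k + 7) (β ζ))
      (trans (length-pr ζ x) (cong (λ k → suc (k + k + n)) e))
      (sound (prog F) (injV ∘ inj₁) (injV (inj₂ (entry verdict))) (code ∘ inj₂ ∘ inj₂ ∘ inj₂ ∘ inj₂ ∘ inj₁) uses-F
        (call {n = regs F} F (λ _ _ _ → refl) F≤ ≤-refl (ζ , x) [] [])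
        (verdict-ready (injV ∘ inj₂) zero (λ p a → code (inj₂ (inj₂ (inj₂ (inj₂ (inj₂ p))))) a) {b = β ζ} refl))

    guess-ready : ∀ (i : St guess → State) e → (∀ p a → δ (i p) a ≡ instr guess i e p a) →
      ∀ ζ l {t b₀ b₁} → suc (suc (length (pr ζ x))) ≤ N →
      Ready e (S (pr (false ∷ ζ) x) l []) t b₀ → Ready e (S (pr (true ∷ ζ) x) l []) t b₁ →
      Ready (i (entry guess)) (S (pr ζ x) l []) (suc (cost N + cost N) + t) (b₀ ∨ b₁)
    guess-ready i e codeG ζ l {t} {b₀} {b₁} le r₀ r₁ =
      choose-ready (push 0 false) (push 0 true) (i ∘ inj₁) (i (inj₂ zero)) (λ p a → codeG (inj₁ p) a)
        (branch₁ false (inj₁ ∘ inj₂ ∘ inj₁) (λ p a → codeG (inj₁ (inj₂ (inj₁ p))) a) r₀)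
        (branch₁ true (inj₁ ∘ inj₂ ∘ inj₂) (λ p a → codeG (inj₁ (inj₂ (inj₂ p))) a) r₁)
      where
      branch₁ : ∀ b (j : Fin 3 → St guess) → (∀ p a → δ (i (j p)) a ≡ pushTr 0 b (i ∘ j) (i (inj₂ zero)) p a) → ∀ {β'} →
        Ready e (S (pr (b ∷ ζ) x) l []) t β' → Ready (i (j zero)) (S (pr ζ x) l []) (cost N + cost N + t) β'
      branch₁ b j codeP {β'} r = retime (i (j zero)) (S (pr ζ x) l []) β' (sym (+-assoc (cost N) (cost N) t))
        (sound (push 0 b) (i ∘ j) (i (inj₂ zero)) codeP (s≤s z≤n)
          (push-0 {B} {N} (pr ζ x) l [] (≤-trans (n≤1+n _) (≤-trans (n≤1+n _) le)))
          (sound (push 0 true) (i ∘ inj₂) e (λ p a → codeG (inj₂ p) a) (s≤s z≤n)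
            (push-0 {B} {N} (b ∷ pr ζ x) l [] (≤-trans (n≤1+n _) le)) r))

    guesses : ∀ l ζ → length l + length ζ ≡ p →
      Ready (injL (inj₁ zero)) (S (pr ζ x) l []) (length l * roundTime + (cost 0 + finalTime)) (anyGuess (length l) β ζ)
    guesses [] ζ e = pop-ready-[] (injL ∘ inj₁) (injV (entry (prog F ⨾ verdict))) (injL (inj₂ (inj₁ (entry guess))))
      (injL (inj₂ (inj₂ (entry guess)))) (λ p a → code (inj₂ (inj₂ (inj₂ (inj₁ (inj₁ p))))) a) m<
      {S (pr ζ x) [] []} (S-m (pr ζ x) [] []) (final ζ e)
    guesses (b ∷ l) ζ e = Ready-mono time≤
      (pop-ready-∷ (injL ∘ inj₁) (injV (entry (prog F ⨾ verdict))) (injL (inj₂ (inj₁ (entry guess))))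
        (injL (inj₂ (inj₂ (entry guess)))) (λ p a → code (inj₂ (inj₂ (inj₂ (inj₁ (inj₁ p))))) a) m<
        {S (pr ζ x) (b ∷ l) []} {b = b} {l} (S-m (pr ζ x) (b ∷ l) []) (popped b))
      where
      e' : length l + suc (length ζ) ≡ p
      e' = trans (+-suc (length l) (length ζ)) e
      rest : ∀ {t} → Ready (injL (inj₁ zero)) (S (pr (false ∷ ζ) x) l []) t (anyGuess (length l) β (false ∷ ζ)) →
             Ready (injL (inj₁ zero)) (S (pr (true ∷ ζ) x) l []) t (anyGuess (length l) β (true ∷ ζ)) →
             (i : St guess → State) → (∀ p a → δ (i p) a ≡ instr guess i (injL (inj₁ zero)) p a) →
             Ready (i (entry guess)) ((S (pr ζ x) (b ∷ l) []) [ m ≔ l ]) (suc (cost N + cost N) + t) (anyGuess (length (b ∷ l)) β ζ)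
      rest r₀ r₁ i codeG .from T rep =
        from (guess-ready i (injL (inj₁ zero)) codeG ζ l room r₀ r₁) T
          (Rep-cong {T} (upd-m (pr ζ x) (b ∷ l) [] l) rep)
        where
        room : suc (suc (length (pr ζ x))) ≤ N
        room = ≤-trans (≤-reflexive (cong (λ k → suc (suc k)) (length-pr ζ x)))
          (s≤s (≤-trans (≤-reflexive (cong (λ k → suc (k + n)) (sym (+-suc (length ζ) (length ζ)))))
            (+-monoˡ-≤ n (+-mono-≤ ζ< ζ<))))
          where
          ζ< : suc (length ζ) ≤ p
          ζ< = ≤-trans (m≤n+m _ (length l)) (≤-reflexive e')
      popped : ∀ b' → Ready (popExit b' (injL (inj₂ (inj₁ (entry guess)))) (injL (inj₂ (inj₂ (entry guess)))))
                 ((S (pr ζ x) (b ∷ l) []) [ m ≔ l ]) (suc (cost N + cost N) + (length l * roundTime + (cost 0 + finalTime)))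
                 (anyGuess (length (b ∷ l)) β ζ)
      popped false = rest (guesses l (false ∷ ζ) e') (guesses l (true ∷ ζ) e') (injL ∘ inj₂ ∘ inj₁)
        (λ p a → code (inj₂ (inj₂ (inj₂ (inj₁ (inj₂ (inj₁ p)))))) a)
      popped true  = rest (guesses l (false ∷ ζ) e') (guesses l (true ∷ ζ) e') (injL ∘ inj₂ ∘ inj₂)
        (λ p a → code (inj₂ (inj₂ (inj₂ (inj₁ (inj₂ (inj₂ p)))))) a)
      l≤N : length (b ∷ l) ≤ N
      l≤N = ≤-trans (m≤m+n _ (length ζ)) (≤-trans (≤-reflexive e) (≤-trans (≤-trans (m≤m+n p p) (m≤m+n _ n)) (n≤1+n _)))
      time≤ : cost (length (S (pr ζ x) (b ∷ l) [] m)) + (suc (cost N + cost N) + (length l * roundTime + (cost 0 + finalTime)))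
              ≤ length (b ∷ l) * roundTime + (cost 0 + finalTime)
      time≤ = ≤-trans (+-monoˡ-≤ _ (cost-mono (≤-trans (≤-reflexive (cong length (S-m (pr ζ x) (b ∷ l) []))) l≤N)))
        (≤-reflexive (solve 4 (λ c d r f → c :+ (d :+ (r :+ f)) := (c :+ d) :+ r :+ f) refl
          (cost N) (suc (cost N + cost N)) (length l * roundTime) (cost 0 + finalTime)))

  WP TP : Poly
  WP = con 1 ⊞ (P ⊞ P ⊞ var)
  TP = time pre' ⊞ ((costP WP ⊞ loopP WP) ⊞ (costP WP ⊞
    (P ⊠ (costP WP ⊞ (con 1 ⊞ (costP WP ⊞ costP WP))) ⊞ (con 4 ⊞ (time F ⟨ WP ⟩ ⊞ con 7)))))

  ready : ∀ x → Ready (inj (entry c)) (input x) (⟦ TP ⟧ (length x)) (anyGuess (⟦ P ⟧ (length x)) (λ ζ → V (ζ , x)) [])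
  ready x = subst (λ k → Ready (inj (entry c)) (input x) (⟦ time pre' ⟧ k + rest) b) (length-reverse x)
    (sound (prog pre') (inj ∘ inj₁) (inj (inj₂ (entry c₁))) (code ∘ inj₁) uses-pre
      (exec pre' (reverse x) (input x) refl (λ { (suc i) lt lt' → refl }))
      (start₁ (sound (split m) (inj ∘ inj₂ ∘ inj₁) (inj (inj₂ (inj₂ (entry c₂)))) (code ∘ inj₂ ∘ inj₁) (split-uses m)
        split′
        (sound (push 0 false) (inj ∘ inj₂ ∘ inj₂ ∘ inj₁) (inj (inj₂ (inj₂ (inj₂ (entry c₃))))) (code ∘ inj₂ ∘ inj₂ ∘ inj₁) (s≤s z≤n)
          (push-0 {B} {N x} x (ones (p x) ʳ++ []) [] x≤N)
          guesses′))))
    where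
    open Frame (λ _ → []) m (s≤s z≤n)
    open Split {B} (N x) (s≤s z≤n) using (split-exec)
    b : Bool
    b = anyGuess (p x) (β x) []
    loopT rest : ℕ
    loopT = p x * roundTime x + (cost 0 + finalTime x)
    rest = (cost (N x) + loopTime (N x)) + (cost (N x) + loopT)
    x≤N : length x ≤ N x
    x≤N = ≤-trans (m≤n+m _ _) (n≤1+n _)
    start₁ : ∀ {q} → Ready q (S (pr (ones (p x)) x) [] []) rest b →
      Ready q (input x [ 0 ≔ pr (ones (⟦ P ⟧ (length (reverse (reverse x))))) (reverse (reverse x)) ]) rest b
    start₁ rd .from T rep = from rd T (Rep-cong {T} same rep)
      where
      same : input x [ 0 ≔ pr (ones (⟦ P ⟧ (length (reverse (reverse x))))) (reverse (reverse x)) ] ≗ S (pr (ones (p x)) x) [] []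
      same i rewrite reverse-involutive x with i ≟ m | i ≟ suc m
      same zero    | _     | _     = refl
      same (suc i) | yes _ | _     = refl
      same (suc i) | no _  | yes _ = refl
      same (suc i) | no _  | no _  = refl
    split′ : Exec B (split m) (S (pr (ones (p x)) x) [] []) (cost (N x) + loopTime (N x)) (S x (ones (p x) ʳ++ []) [])
    split′ = subst (λ w → Exec B (split m) (S (pr (ones (p x)) x) [] []) (cost (N x) + loopTime (N x)) (S (proj₂ w) (proj₁ w ʳ++ []) []))
      (unpr-pr (ones (p x)) x)
      (split-exec (pr (ones (p x)) x) (≤-reflexive (trans (length-pr (ones (p x)) x) (cong (λ k → suc (k + k + length x)) (length-replicate (p x))))))
    len : length (ones (p x) ʳ++ []) ≡ p x
    len = trans (length-ʳ++ (ones (p x))) (trans (+-identityʳ _) (length-replicate (p x)))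
    guesses′ : Ready (inj (inj₂ (inj₂ (inj₂ (entry c₃))))) (S (false ∷ x) (ones (p x) ʳ++ []) []) loopT b
    guesses′ = subst (λ k → Ready (inj (inj₂ (inj₂ (inj₂ (entry c₃))))) (S (false ∷ x) (ones (p x) ʳ++ []) [])
                              (k * roundTime x + (cost 0 + finalTime x)) (anyGuess k (β x) [])) len
      (guesses x (ones (p x) ʳ++ []) [] (trans (+-identityʳ _) len))

  guess-NP : ∀ {L} → (∀ x → anyGuess (⟦ P ⟧ (length x)) (λ ζ → V (ζ , x)) [] ≡ L x) → NP^ B L
  guess-NP {L} e = machine , decides B TP (λ x → subst (Ready (inj (entry c)) (input x) (⟦ TP ⟧ (length x))) (e x) (ready x))

-- Unlike completeness, soundness does not bound the length of the certificate:
-- closure properties then need no length checks.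
record NPC (B : Lang) (L : Lang) : Set where
  field
    test     : Str → Str → Bool
    verify   : FP₂ B test
    bound    : Poly
    sound    : ∀ w x → test w x ≡ true → L x ≡ true
    complete : ∀ x → L x ≡ true → ∃ λ w → length w ≤ ⟦ bound ⟧ (length x) × test w x ≡ true

open NPC public

abstract
  -- The machine guesses strings of one length, while certificates are only bounded in length. The
  -- guess is therefore read as a pair of certificate and padding: with `b` the bound, its length
  -- `1 + 2b` is reached from every certificate of length at most `b`.
  NPC⇒NP : ∀ {B L} → NPC B L → NP^ B L
  NPC⇒NP {B} {L} V = Guessing.guess-NP {V = λ p → test V (proj₁ (unpr (proj₁ p))) (proj₂ p)}
    (verify V ∙ ⟨ fst ∙ unprF ∙ fst , snd ⟩) guessP (⟨ onesF guessP , idF ⟩ ∙ reverseF)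
    (λ x → ≡-from-⇔ (only x) (does x))
    where
    guessP : Poly
    guessP = con 1 ⊞ (bound V ⊞ bound V)
    β : Str → Str → Bool
    β x ζ = test V (proj₁ (unpr ζ)) x
    only : ∀ x → anyGuess (⟦ guessP ⟧ (length x)) (β x) [] ≡ true → L x ≡ true
    only x e with anyGuess-sound (⟦ guessP ⟧ (length x)) (β x) [] e
    ... | ζ , t = sound V _ x t
    does : ∀ x → L x ≡ true → anyGuess (⟦ guessP ⟧ (length x)) (β x) [] ≡ true
    does x e with complete V x e
    ... | w , le , t = subst (λ k → anyGuess k (β x) [] ≡ true) (trans (length-reverse ζ) lenζ)
      (anyGuess-complete (reverse ζ) (β x) [] (trans (cong (β x) (trans (ʳ++-defn (reverse ζ)) (trans (cong (_++ []) (reverse-involutive ζ)) (++-identityʳ ζ))))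
        (trans (cong (λ q → test V (proj₁ q) x) (unpr-pr w pad′)) t)))
      where
      b : ℕ
      b = ⟦ bound V ⟧ (length x)
      pad′ ζ : Str
      pad′ = ones ((b + b) ∸ (length w + length w))
      ζ = pr w pad′
      lenζ : length ζ ≡ suc (b + b)
      lenζ = trans (length-pr w pad′) (cong suc (trans (cong (length w + length w +_) (length-replicate ((b + b) ∸ (length w + length w))))
        (m+[n∸m]≡n (+-mono-≤ le le))))

module Runs (N : OTM) (A : Lang) (halting : Run.PolyTime N A) where
  open Simulate N using (runAcc; runAcc-certified; certify; d; Certificate; module Certificate)
  open Certificate

  -- Each of the `t` steps spends at most `d` bits of choice; `t` further bits make sure that the
  -- clock reaches the accepting step.
  timeP runsP : Poly
  timeP = con (proj₁ halting) ⊠ pow (proj₁ halting) ⊞ con (proj₁ halting)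
  runsP = timeP ⊠ con d ⊞ timeP

  module _ (x : Str) (acc : Run.Accepts N A (Run.initial N x)) where
    t : ℕ
    t = ⟦ timeP ⟧ (length x)

    C : Certificate A t (Run.initial N x)
    C = certify t (Run.initial N x)
      (subst (λ e → Run.HaltsWithin N A (proj₁ halting * e + proj₁ halting) (Run.initial N x))
        (sym (⟦pow⟧ (proj₁ halting) (length x))) (proj₂ halting x)) acc

    some-run : ∃ λ w → length w ≤ ⟦ runsP ⟧ (length x) × runAcc A x w ≡ true
    some-run = choices C ++ ones t ,
      ≤-trans (≤-reflexive (trans (length-++ (choices C)) (cong (length (choices C) +_) (length-replicate t))))
        (+-monoˡ-≤ t (short C)) ,
      runAcc-certified x C (ones t)
        (≤-trans (quick C) (≤-trans (≤-reflexive (sym (length-replicate t)))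
          (≤-trans (m≤n+m _ (length (choices C))) (≤-reflexive (sym (length-++ (choices C)))))))

    -- In a deterministic run each choice takes the first action, coded by a single `true`. A string
    -- of ones therefore serves as certificate and padding at once and can be written down without a
    -- search.
    only-run : Run.Deterministic N → runAcc A x (ones (⟦ runsP ⟧ (length x))) ≡ true
    only-run D = subst (λ w → runAcc A x w ≡ true) all-ones (runAcc-certified x C z
      (≤-trans (quick C) (≤-trans (m≤n+m t (t * d))
        (≤-reflexive (sym (trans (cong length all-ones) (length-replicate (⟦ runsP ⟧ (length x)))))))))
      where
      z : Str
      z = ones (⟦ runsP ⟧ (length x) ∸ length (choices C))
      all-ones : choices C ++ z ≡ ones (⟦ runsP ⟧ (length x))
      all-ones = trans (cong (_++ z) (forced C D)) (trans (ones-+ (length (choices C)) _)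
        (cong ones (m+[n∸m]≡n (≤-trans (short C) (m≤m+n (t * d) t)))))

abstract
  NP⇒NPC : ∀ {A B L} → FP B str bool A → NP^ A L → NPC B L
  NP⇒NPC {A} F (N , halting , dec) = record
    { test = λ w x → runAcc A x w
    ; verify = runF (F ∙ fst)
    ; bound = runsP
    ; sound = λ w x e → proj₁ (dec x) (runAcc-sound A x w e)
    ; complete = λ x e → some-run x (proj₂ (dec x) e) }
    where
    open Simulate N using (runAcc; runF; runAcc-sound)
    open Runs N A halting

abstract
  P⇒FP : ∀ {A B L} → FP B str bool A → P^ A L → FP B str bool L
  P⇒FP {A} F (N , D , halting , dec) = ext
    (λ x → ≡-from-⇔ (λ e → proj₁ (dec x) (runAcc-sound A x (ones (⟦ runsP ⟧ (length x))) e))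
                    (λ e → only-run x (proj₂ (dec x) e) D))
    (runF (F ∙ fst) ∙ ⟨ onesF runsP , idF ⟩)
    where
    open Simulate N using (runF; runAcc-sound)
    open Runs N A halting

-- Bounded quantification and closure properties of certificates

∧-elim : ∀ {a b} → a ∧ b ≡ true → a ≡ true × b ≡ true
∧-elim {true} {true} e = refl , refl

∨-elim : ∀ {a b} → a ∨ b ≡ true → a ≡ true ⊎ b ≡ true
∨-elim {true}  e = inj₁ refl
∨-elim {false} e = inj₂ e

∨-introʳ : ∀ a {b} → b ≡ true → a ∨ b ≡ true
∨-introʳ a refl = ∨-zeroʳ a

∨-introˡ : ∀ {a} b → a ≡ true → a ∨ b ≡ true
∨-introˡ b refl = refl

xor-false : ∀ {a b} → a xor b ≡ false → a ≡ b
xor-false {false} {false} e = refl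
xor-false {true}  {true}  e = refl

xor-refl : ∀ a → a xor a ≡ false
xor-refl false = refl
xor-refl true  = refl

anyUpTo : ℕ → (Str → Bool) → Bool
anyUpTo zero    β = β []
anyUpTo (suc n) β = β [] ∨ (anyUpTo n (β ∘ (false ∷_)) ∨ anyUpTo n (β ∘ (true ∷_)))

anyUpTo-sound : ∀ n β → anyUpTo n β ≡ true → ∃ λ w → length w ≤ n × β w ≡ true
anyUpTo-sound zero    β e = [] , z≤n , e
anyUpTo-sound (suc n) β e with ∨-elim {β []} e
... | inj₁ h = [] , z≤n , h
... | inj₂ h with ∨-elim {anyUpTo n (β ∘ (false ∷_))} h
... | inj₁ i = let w , le , t = anyUpTo-sound n _ i in false ∷ w , s≤s le , t
... | inj₂ i = let w , le , t = anyUpTo-sound n _ i in true ∷ w , s≤s le , t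

anyUpTo-complete : ∀ n β w → length w ≤ n → β w ≡ true → anyUpTo n β ≡ true
anyUpTo-complete zero    β []          le       t = t
anyUpTo-complete (suc n) β []          le       t = ∨-introˡ _ t
anyUpTo-complete (suc n) β (false ∷ w) (s≤s le) t =
  ∨-introʳ (β []) (∨-introˡ _ (anyUpTo-complete n _ w le t))
anyUpTo-complete (suc n) β (true ∷ w)  (s≤s le) t =
  ∨-introʳ (β []) (∨-introʳ (anyUpTo n _) (anyUpTo-complete n _ w le t))

anyUpTo-none : ∀ n β w → anyUpTo n β ≡ false → length w ≤ n → β w ≡ false
anyUpTo-none n β w e le with β w in eq
... | false = refl
... | true  = trans (sym (anyUpTo-complete n β w le eq)) e

anyUpTo-cong : ∀ n {β β'} → (∀ w → length w ≤ n → β w ≡ β' w) → anyUpTo n β ≡ anyUpTo n β'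
anyUpTo-cong zero    h = h [] z≤n
anyUpTo-cong (suc n) h = cong₂ _∨_ (h [] z≤n)
  (cong₂ _∨_ (anyUpTo-cong n (λ w le → h (false ∷ w) (s≤s le))) (anyUpTo-cong n (λ w le → h (true ∷ w) (s≤s le))))

-- Oracle calls are not substituted in the program: it is compiled to a machine over `A`, and this
-- machine is simulated with its queries answered by `F`.
relativize : ∀ {A B L} → FP B str bool A → FP A str bool L → FP B str bool L
relativize F G = P⇒FP F (FP⇒P G)

relativize₂ : ∀ {A B} {f : Str → Str → Bool} → FP B str bool A →
  FP₂ A f → FP₂ B f
relativize₂ {f = f} F G = ext (λ p → cong (λ q → f (proj₁ q) (proj₂ q)) (unpr-pr (proj₁ p) (proj₂ p)))
  (relativize F (G ∙ unprF) ∙ prF)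

NPC-relativize : ∀ {A B L} → FP B str bool A → NPC A L → NPC B L
NPC-relativize F V = record
  { test = test V ; verify = relativize₂ F (verify V) ; bound = bound V ; sound = sound V ; complete = complete V }

NPC-ext : ∀ {B L L'} → (∀ x → L x ≡ L' x) → NPC B L → NPC B L'
NPC-ext e V = record
  { test = test V ; verify = verify V ; bound = bound V
  ; sound = λ w x t → trans (sym (e x)) (sound V w x t) ; complete = λ x t → complete V x (trans (e x) t) }

NPC-∘ : ∀ {B L f} → FP B str str f → NPC B L → NPC B (L ∘ f)
NPC-∘ {f = f} F V = record
  { test = λ w x → test V w (f x) ; verify = verify V ∙ ⟨ fst , F ∙ snd ⟩ ; bound = bound V ⟨ time F ⟩
  ; sound = λ w x → sound V w (f x)
  ; complete = λ x e → let w , le , t = complete V (f x) e in w , ≤-trans le (⟦⟧-mono (bound V) (out≤ F x)) , t }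

FP⇒NPC : ∀ {B L} → FP B str bool L → NPC B L
FP⇒NPC {L = L} F = record
  { test = λ _ → L ; verify = F ∙ snd ; bound = con 0 ; sound = λ _ _ e → e ; complete = λ x e → [] , z≤n , e }

NPC-∧ : ∀ {B L M} → NPC B L → NPC B M → NPC B (λ x → L x ∧ M x)
NPC-∧ V V' = record
  { test = λ w x → test V (proj₁ (unpr w)) x ∧ test V' (proj₂ (unpr w)) x
  ; verify = andF (verify V ∙ ⟨ fst ∙ unprF ∙ fst , snd ⟩) (verify V' ∙ ⟨ snd ∙ unprF ∙ fst , snd ⟩)
  ; bound = con 1 ⊞ (bound V ⊞ bound V ⊞ bound V')
  ; sound = λ w x e → let a , b = ∧-elim e in cong₂ _∧_ (sound V _ x a) (sound V' _ x b)
  ; complete = λ x e → let a , b = ∧-elim e ; w , le , t = complete V x a ; w' , le' , t' = complete V' x b in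
      pr w w' , ≤-trans (≤-reflexive (length-pr w w')) (s≤s (+-mono-≤ (+-mono-≤ le le) le')) ,
      trans (cong (λ p → test V (proj₁ p) x ∧ test V' (proj₂ p) x) (unpr-pr w w')) (cong₂ _∧_ t t') }

NPC-∨ : ∀ {B L M} → NPC B L → NPC B M → NPC B (λ x → L x ∨ M x)
NPC-∨ {L = L} V V' = record
  { test = λ w x → test V w x ∨ test V' w x
  ; verify = orF (verify V) (verify V')
  ; bound = bound V ⊞ bound V'
  ; sound = λ w x e → only w x (∨-elim {test V w x} e)
  ; complete = λ x e → does x (∨-elim e) }
  where
  only : ∀ w x → test V w x ≡ true ⊎ test V' w x ≡ true → _
  only w x (inj₁ t) = ∨-introˡ _ (sound V w x t)
  only w x (inj₂ t) = ∨-introʳ (L x) (sound V' w x t)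
  does : ∀ x → L x ≡ true ⊎ _ → _
  does x (inj₁ t) = let w , le , t' = complete V x t in w , ≤-trans le (m≤m+n _ _) , ∨-introˡ _ t'
  does x (inj₂ t) = let w , le , t' = complete V' x t in w , ≤-trans le (m≤n+m _ _) , ∨-introʳ (test V w x) t'

-- The witness becomes part of the certificate. Its length must be tested, since the quantifier
-- ranges over bounded strings and soundness has to cover certificates of any length.
NPC-∃ : ∀ {B W clk} → FP B str str clk → NPC B W → NPC B (λ x → anyUpTo (length (clk x)) (λ z → W (pr z x)))
NPC-∃ {B} {W} {clk} F V = record
  { test = λ w x → fits w x ∧ test V (proj₂ (unpr w)) (pr (proj₁ (unpr w)) x)
  ; verify = andF (isEmptyF ∙ dropF ∙ ⟨ F ∙ snd , fst ∙ unprF ∙ fst ⟩)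
                  (verify V ∙ ⟨ snd ∙ unprF ∙ fst , prF ∙ ⟨ fst ∙ unprF ∙ fst , snd ⟩ ⟩)
  ; bound = con 1 ⊞ (time F ⊞ time F ⊞ bound V ⟨ con 1 ⊞ (time F ⊞ time F ⊞ var) ⟩)
  ; sound = λ w x e → let a , b = ∧-elim e in
      anyUpTo-complete (length (clk x)) _ (proj₁ (unpr w)) (fits⇒≤ _ _ a) (sound V _ _ b)
  ; complete = does }
  where
  fits : Str → Str → Bool
  fits w x = isEmpty (drop (length (clk x)) (proj₁ (unpr w)))
  fits⇒≤ : ∀ n (z : Str) → isEmpty (drop n z) ≡ true → length z ≤ n
  fits⇒≤ n       []      e = z≤n
  fits⇒≤ (suc n) (_ ∷ z) e = s≤s (fits⇒≤ n z e)
  ≤⇒fits : ∀ n (z : Str) → length z ≤ n → isEmpty (drop n z) ≡ true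
  ≤⇒fits zero    []      le       = refl
  ≤⇒fits (suc n) []      le       = refl
  ≤⇒fits (suc n) (_ ∷ z) (s≤s le) = ≤⇒fits n z le
  does : ∀ x → anyUpTo (length (clk x)) (λ z → W (pr z x)) ≡ true → _
  does x e with anyUpTo-sound (length (clk x)) _ e
  ... | z , le , t with complete V (pr z x) t
  ... | w , le' , t' = pr z w ,
    ≤-trans (≤-reflexive (length-pr z w)) (s≤s (+-mono-≤ (+-mono-≤ z≤ z≤)
      (≤-trans le' (⟦⟧-mono (bound V) (≤-trans (≤-reflexive (length-pr z x)) (s≤s (+-monoˡ-≤ _ (+-mono-≤ z≤ z≤)))))))) ,
    trans (cong (λ p → isEmpty (drop (length (clk x)) (proj₁ p)) ∧ test V (proj₂ p) (pr (proj₁ p) x)) (unpr-pr z w))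
      (cong₂ _∧_ (≤⇒fits (length (clk x)) z le) t')
    where
    z≤ : length z ≤ ⟦ time F ⟧ (length x)
    z≤ = ≤-trans le (out≤ F x)

NPC-∃FP : ∀ {B clk} (f : Str → Str → Bool) → FP B str str clk → FP₂ B f →
  NPC B (λ x → anyUpTo (length (clk x)) (λ z → f z x))
NPC-∃FP {clk = clk} f F G = NPC-ext
  (λ x → anyUpTo-cong (length (clk x)) (λ z _ → cong (λ p → f (proj₁ p) (proj₂ p)) (unpr-pr z x)))
  (NPC-∃ {W = λ y → f (proj₁ (unpr y)) (proj₂ (unpr y))} F (FP⇒NPC (G ∙ unprF)))

NPC-∃-poly : ∀ {B} P (f : Str → Str → Bool) → FP₂ B f →
  NPC B (λ x → anyUpTo (⟦ P ⟧ (length x)) (λ z → f z x))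
NPC-∃-poly P f G = NPC-ext
  (λ x → cong (λ n → anyUpTo n (λ z → f z x)) (length-replicate (⟦ P ⟧ (length x))))
  (NPC-∃FP f (onesF P) G)

-- The polynomial hierarchy

tagged : Lang → Lang → Lang
tagged A B []          = false
tagged A B (true ∷ x)  = A x
tagged A B (false ∷ x) = B x

tagged-fst : ∀ {A B} → FP (tagged A B) str bool A
tagged-fst = oracle ∙ pushF {f = true ∷_} true (λ _ → refl)

tagged-snd : ∀ {A B} → FP (tagged A B) str bool B
tagged-snd = oracle ∙ pushF {f = false ∷_} false (λ _ → refl)

tagged-case : ∀ {A X} {f g : Str × Carrier X → Bool} → FP A (str ⊗ X) bool f → FP A (str ⊗ X) bool g →
  FP A (str ⊗ X) bool (strCase (λ _ → false) (λ b → if b then f else g))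
tagged-case F G = caseStr (const bool false) (λ { false → G ; true → F })

tagged-FP : ∀ {A B C} → FP C str bool A → FP C str bool B → FP C str bool (tagged A B)
tagged-FP {A} {B} F G = ext cases (tagged-case (F ∙ fst) (G ∙ fst) ∙ ⟨ idF , bang ⟩)
  where
  cases : ∀ x → strCase {⊤} (λ _ → false) (λ b → if b then A ∘ proj₁ else B ∘ proj₁) (x , tt) ≡ tagged A B x
  cases []          = refl
  cases (true ∷ x)  = refl
  cases (false ∷ x) = refl

tagged-NPC : ∀ {A B C} → NPC C A → NPC C B → NPC C (tagged A B)
tagged-NPC {A} {B} {C} V W = record
  { test = λ w → tagged (test V w) (test W w)
  ; verify = ext (λ p → cases (proj₁ p) (proj₂ p))
      (tagged-case (verify V ∙ ⟨ snd , fst ⟩) (verify W ∙ ⟨ snd , fst ⟩) ∙ ⟨ snd , fst ⟩)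
  ; bound = bound V ⊞ bound W
  ; sound = λ { w (true ∷ x) e → sound V w x e ; w (false ∷ x) e → sound W w x e }
  ; complete = λ { (true ∷ x) e → let w , le , t = complete V x e in
                     w , ≤-trans le (≤-trans (⟦⟧-mono (bound V) (n≤1+n _)) (m≤m+n _ _)) , t
                 ; (false ∷ x) e → let w , le , t = complete W x e in
                     w , ≤-trans le (≤-trans (⟦⟧-mono (bound W) (n≤1+n _)) (m≤n+m _ _)) , t } }
  where
  cases : ∀ w x → strCase {Str} (λ _ → false) (λ b → if b then (λ p → test V (proj₂ p) (proj₁ p)) else (λ p → test W (proj₂ p) (proj₁ p)))
            (x , w) ≡ tagged (test V w) (test W w) x
  cases w []          = refl
  cases w (true ∷ x)  = refl
  cases w (false ∷ x) = refl

∅∈P : P ∅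
∅∈P = FP⇒P (const bool false)

-- Together with `Σ-above` this levels out the definition of the hierarchy, whose first level has no
-- oracle from the level below. Going down, the empty language plays the oracle in P; going up, the
-- verifier computes the answers of such an oracle itself.
Σ-below : ∀ j {A} → Σp (suc j) A → ∃ λ B → Σp j B × NPC B A
Σ-below zero    N           = ∅ , ∅∈P , NP⇒NPC oracle N
Σ-below (suc j) (B , σ , N) = B , σ , NP⇒NPC oracle N

Σ-above : ∀ j {A B} → Σp j B → NPC B A → Σp (suc j) A
Σ-above zero    σ V = NPC⇒NP (NPC-relativize (P⇒FP (const bool false) σ) V)
Σ-above (suc j) σ V = _ , σ , NPC⇒NP V

-- The join is the tagged union. It stays on the level because the oracles one level down can be
-- joined first, and this recursion ends at P.
Σ-join : ∀ j {A B} → Σp j A → Σp j B → ∃ λ C → Σp j C × FP C str bool A × FP C str bool B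
Σ-join zero    σ τ = _ , FP⇒P (tagged-FP (P⇒FP (const bool false) σ) (P⇒FP (const bool false) τ)) , tagged-fst , tagged-snd
Σ-join (suc j) σ τ with Σ-below j σ | Σ-below j τ
... | A , α , V | B , β , W with Σ-join j α β
... | C , γ , F , G =
  _ , Σ-above j γ (tagged-NPC (NPC-relativize F V) (NPC-relativize G W)) , tagged-fst , tagged-snd

DIFF-map : ∀ {C D : Class} {f : Str → Str} → (∀ {L} → C L → D (L ∘ f)) → ∀ m {L} → DIFF m C L → DIFF m D (L ∘ f)
DIFF-map h zero          c = h c
DIFF-map h (suc zero)    c = h c
DIFF-map {f = f} h (suc (suc m)) (L₁ , L₂ , c , d , e) = L₁ ∘ f , L₂ ∘ f , h c , DIFF-map h (suc m) d , λ x → e (f x)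

DIFF-ext : ∀ {C : Class} → (∀ {L L'} → (∀ x → L x ≡ L' x) → C L → C L') → ∀ m {L L'} →
           (∀ x → L x ≡ L' x) → DIFF m C L → DIFF m C L'
DIFF-ext h zero          e c = h e c
DIFF-ext h (suc zero)    e c = h e c
DIFF-ext h (suc (suc m)) e (L₁ , L₂ , c , d , e') = L₁ , L₂ , c , d , λ x → trans (sym (e x)) (e' x)

DIFF-oracle : ∀ j m {L} → DIFF (suc m) (Σp (suc j)) L → ∃ λ A → Σp j A × DIFF (suc m) (NPC A) L
DIFF-oracle j zero    σ = Σ-below j σ
DIFF-oracle j (suc m) (L₁ , L₂ , σ , τ , e) with Σ-below j σ | DIFF-oracle j m τ
... | A , α , V | B , β , W with Σ-join j α β
... | C , γ , F , G = C , γ , L₁ , L₂ , NPC-relativize F V , DIFF-map {f = λ x → x} (NPC-relativize G) (suc m) W , e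

-- With an oracle for all levels, negation is free and the nested difference is just a Boolean
-- combination of answers.
DIFF-decide : ∀ j m {L} → DIFF (suc m) (Σp j) L → ∃ λ A → Σp j A × FP A str bool L
DIFF-decide j zero    σ = _ , σ , oracle
DIFF-decide j (suc m) (L₁ , L₂ , σ , τ , e) with DIFF-decide j m τ
... | A , α , F with Σ-join j σ α
... | B , β , G , H = B , β , ext (λ x → sym (e x)) (andF G (notF (relativize H F)))

-- The collapse

-- `H` simulates the machine with `O(·, x)` in place of `A`, and is a verifiable language whether or
-- not the answers are right. The answers matter only for the comparison with `L`, and then only up
-- to the length of a certificate.
NP-replace : ∀ {A B L} {O : Str → Str → Bool} → FP₂ B O → NP^ A L →
  ∃ λ r → ∃ λ H → NPC B H × (∀ x → (∀ q → length q ≤ ⟦ r ⟧ (length x) → A q ≡ O q x) → H x ≡ L x)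
NP-replace {A} {B} {L} {O} F (N , halting , dec) = runsP , H , V , agree
  where
  open Simulate N using (runAcc; runF; runAcc-sound; runAcc-agree)
  open Runs N A halting
  sim : Str → Str → Bool
  sim w x = runAcc (λ q → O q x) x w
  H : Lang
  H x = anyUpTo (⟦ runsP ⟧ (length x)) (λ w → sim w x)
  V : NPC B H
  V = NPC-∃-poly runsP sim (runF F)
  agree : ∀ x → (∀ q → length q ≤ ⟦ runsP ⟧ (length x) → A q ≡ O q x) → H x ≡ L x
  agree x h = ≡-from-⇔ only does
    where
    sim≡ : ∀ w → length w ≤ ⟦ runsP ⟧ (length x) → runAcc A x w ≡ sim w x
    sim≡ w le = runAcc-agree A (λ q → O q x) x w (λ q le' → h q (≤-trans le' le))
    only : H x ≡ true → L x ≡ true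
    only e with anyUpTo-sound (⟦ runsP ⟧ (length x)) (λ w → sim w x) e
    ... | w , le , t = proj₁ (dec x) (runAcc-sound A x w (trans (sim≡ w le) t))
    does : L x ≡ true → H x ≡ true
    does e with some-run x (proj₂ (dec x) e)
    ... | w , le , t = anyUpTo-complete (⟦ runsP ⟧ (length x)) (λ w → sim w x) w le (trans (sym (sim≡ w le)) t)

DIFF-replace : ∀ {A B} {O : Str → Str → Bool} → FP₂ B O →
  ∀ m {L} → DIFF (suc m) (NPC A) L →
  ∃ λ r → ∃ λ H → DIFF (suc m) (NPC B) H × (∀ x → (∀ q → length q ≤ ⟦ r ⟧ (length x) → A q ≡ O q x) → H x ≡ L x)
DIFF-replace F zero    V = NP-replace F (NPC⇒NP V)
DIFF-replace F (suc m) (L₁ , L₂ , V , W , e) with NP-replace F (NPC⇒NP V) | DIFF-replace F m W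
... | r₁ , H₁ , V₁ , h₁ | r₂ , H₂ , V₂ , h₂ = r₁ ⊞ r₂ , (λ x → H₁ x ∧ not (H₂ x)) , (H₁ , H₂ , V₁ , V₂ , λ x → refl) ,
  λ x h → trans (cong₂ (λ a b → a ∧ not b) (h₁ x (λ q le → h q (≤-trans le (m≤m+n _ _))))
                                          (h₂ x (λ q le → h q (≤-trans le (m≤n+m _ _))))) (sym (e x))

-- If E is constant on the witnesses of x, its value can be read off by
-- existentially quantifying each level of E over the witnesses that satisfy
-- all previous levels: only witnesses with maximal level survive.
module Tower {B : Lang} (P : Poly) where

  Witnesses : Lang → Str → Str → Set
  Witnesses W x z = length z ≤ ⟦ P ⟧ (length x) × W (pr z x) ≡ true

  some : Lang → Lang
  some W x = anyUpTo (⟦ P ⟧ (length x)) (λ z → W (pr z x))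

  someC : ∀ {W} → NPC B W → NPC B (some W)
  someC V = NPC-ext (λ x → cong (λ n → anyUpTo n _) (length-replicate (⟦ P ⟧ (length x)))) (NPC-∃ (onesF P) V)

  -- `G` is a second source of the value `true`. It is added to the first level only: where it
  -- holds, all witnesses lie outside `E₂`, so the inner tower evaluates to `false` and subtracts
  -- nothing. `G` and witnesses may coexist, provided that they agree on the value `e`.
  tower : ∀ m {E W G} → DIFF (suc m) (NPC B) E → NPC B W → NPC B G → ∃ λ L → DIFF (suc m) (NPC B) L ×
    (∀ x e → (∀ z → Witnesses W x z → E (pr z x) ≡ e) → (G x ≡ true → e ≡ true) →
             (e ≡ true → G x ≡ true ⊎ ∃ (Witnesses W x)) → L x ≡ e)
  tower zero {E} {W} {G} D V U = _ , NPC-∨ U (someC (NPC-∧ V D)) , λ x e const-e G⇒e e⇒ →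
    ≡-from-⇔
      (λ t → case-or t G⇒e (λ t' → let z , le , t'' = anyUpTo-sound _ _ t' ; w , f = ∧-elim t'' in
        trans (sym (const-e z (le , w))) f))
      (λ t → found x e const-e t (e⇒ t))
    where
    case-or : ∀ {a b : Bool} {R : Set} → a ∨ b ≡ true → (a ≡ true → R) → (b ≡ true → R) → R
    case-or {true}  t f g = f refl
    case-or {false} t f g = g t
    found : ∀ x e → (∀ z → Witnesses W x z → E (pr z x) ≡ e) → e ≡ true → G x ≡ true ⊎ ∃ (Witnesses W x) →
      G x ∨ some (λ y → W y ∧ E y) x ≡ true
    found x e const-e t (inj₁ g) = ∨-introˡ _ g
    found x e const-e t (inj₂ (z , le , w)) =
      ∨-introʳ (G x) (anyUpTo-complete _ _ z le (cong₂ _∧_ w (trans (const-e z (le , w)) t)))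
  tower (suc m) {E} {W} {G} (E₁ , E₂ , V₁ , D , eq) V U
    with tower m {E₂} {λ y → W y ∧ E₁ y} {λ _ → false} D (NPC-∧ V V₁) (FP⇒NPC (const bool false))
  ... | L₂ , D₂ , spec = _ , (_ , L₂ , NPC-∨ U (someC (NPC-∧ V V₁)) , D₂ , λ x → refl) , value
    where
    first : Lang
    first x = G x ∨ some (λ y → W y ∧ E₁ y) x
    value : ∀ x e → (∀ z → Witnesses W x z → E (pr z x) ≡ e) → (G x ≡ true → e ≡ true) →
            (e ≡ true → G x ≡ true ⊎ ∃ (Witnesses W x)) → first x ∧ not (L₂ x) ≡ e
    value x true const-e G⇒e e⇒ = cong₂ _∧_ (reached (e⇒ refl)) (cong not none)
      where
      both : ∀ z → Witnesses W x z → E₁ (pr z x) ≡ true × not (E₂ (pr z x)) ≡ true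
      both z w = ∧-elim (trans (sym (eq (pr z x))) (const-e z w))
      none : L₂ x ≡ false
      none = spec x false
        (λ { z (le , w) → trans (sym (not-involutive _)) (cong not (proj₂ (both z (le , proj₁ (∧-elim w))))) }) (λ ()) (λ ())
      reached : G x ≡ true ⊎ ∃ (Witnesses W x) → first x ≡ true
      reached (inj₁ g) = ∨-introˡ _ g
      reached (inj₂ (z , le , w)) =
        ∨-introʳ (G x) (anyUpTo-complete _ _ z le (cong₂ _∧_ w (proj₁ (both z (le , w)))))
    value x false const-e G⇒e e⇒ with G x
    ... | true  = ⊥-elim (true≢false (G⇒e refl))
      where
      true≢false : false ≢ true
      true≢false ()
    ... | false with some (λ y → W y ∧ E₁ y) x in s
    ... | false = refl
    -- A witness survives in `E₁`. All survivors lie outside `E`, hence in `E₂`, so the inner tower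
    -- has the constant value `true` and removes `x`.
    ... | true  = cong not (spec x true flipped (λ ()) (λ _ → inj₂ (anyUpTo-sound _ _ s)))
      where
      flipped : ∀ z → Witnesses (λ y → W y ∧ E₁ y) x z → E₂ (pr z x) ≡ true
      flipped z (le , w) = let a , b = ∧-elim w in
        second (E₁ (pr z x)) (E₂ (pr z x)) b (trans (sym (eq (pr z x))) (const-e z (le , a)))
        where
        second : ∀ a b → a ≡ true → a ∧ not b ≡ false → b ≡ true
        second true true _ _ = refl

-- The prefix set and its self-reduction

module Prefixes {B₀ A : Lang} (V : NPC B₀ A) where

  width : Str → Str → ℕ
  width q u = ⟦ bound V ⟧ (length q) ∸ length u

  -- S ⟨q, u⟩: the certificate prefix u extends to a certificate of q ∈ A.
  ext? : Str → Str → Bool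
  ext? q u = anyUpTo (width q u) (λ w → test V (u ++ w) q)

  S : Lang
  S z = ext? (proj₁ (unpr z)) (proj₂ (unpr z))

  S-pr : ∀ q u → S (pr q u) ≡ ext? q u
  S-pr q u = cong (λ p → ext? (proj₁ p) (proj₂ p)) (unpr-pr q u)

  clock : Str × Str → Str
  clock p = drop (length (proj₂ p)) (ones (⟦ bound V ⟧ (length (proj₁ p))))

  clockF : ∀ {B} → FP B (str ⊗ str) str clock
  clockF = dropF ∙ ⟨ snd , onesF (bound V) ∙ fst ⟩

  length-clock : ∀ q u → length (clock (q , u)) ≡ width q u
  length-clock q u = trans (length-drop (length u) (ones (⟦ bound V ⟧ (length q))))
    (cong (_∸ length u) (length-replicate (⟦ bound V ⟧ (length q))))

  S-NPC : NPC B₀ S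
  S-NPC = NPC-ext (λ z → cong (λ n → anyUpTo n (λ w → test V (proj₂ (unpr z) ++ w) (proj₁ (unpr z))))
      (length-clock (proj₁ (unpr z)) (proj₂ (unpr z))))
    (NPC-∃FP (λ w z → test V (proj₂ (unpr z) ++ w) (proj₁ (unpr z))) (clockF ∙ unprF)
      (verify V ∙ ⟨ appendF ∙ ⟨ snd ∙ unprF ∙ snd , fst ⟩ , fst ∙ unprF ∙ snd ⟩))

  A≡S : ∀ q → A q ≡ ext? q []
  A≡S q = ≡-from-⇔
    (λ e → let w , le , t = complete V q e in anyUpTo-complete (⟦ bound V ⟧ (length q)) _ w le t)
    (λ e → let w , le , t = anyUpTo-sound (⟦ bound V ⟧ (length q)) _ e in sound V w q t)

  -- The recursive description of S; checking a candidate for S against it at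
  -- one place needs no quantifier.
  local : (Str → Bool) → Str → Str → Bool
  local D q u = test V u q ∨ (not (isEmpty (clock (q , u))) ∧ (D (u ++ [ false ]) ∨ D (u ++ [ true ])))

  local-end : ∀ D q u → width q u ≡ 0 → local D q u ≡ test V u q
  local-end D q u e = trans (cong (λ b → test V u q ∨ (not b ∧ (D (u ++ [ false ]) ∨ D (u ++ [ true ]))))
      (empty (clock (q , u)) (trans (length-clock q u) e))) (∨-identityʳ (test V u q))
    where
    empty : ∀ (y : Str) → length y ≡ 0 → isEmpty y ≡ true
    empty [] e = refl

  local-inner : ∀ D q u n → width q u ≡ suc n → local D q u ≡ test V u q ∨ (D (u ++ [ false ]) ∨ D (u ++ [ true ]))
  local-inner D q u n e = cong (λ b → test V u q ∨ (not b ∧ (D (u ++ [ false ]) ∨ D (u ++ [ true ]))))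
      (nonempty (clock (q , u)) (trans (length-clock q u) e))
    where
    nonempty : ∀ (y : Str) → length y ≡ suc n → isEmpty y ≡ false
    nonempty (_ ∷ _) e = refl

  width-∷ʳ : ∀ q u b {n} → width q u ≡ suc n → width q (u ++ [ b ]) ≡ n
  width-∷ʳ q u b e = trans (cong (⟦ bound V ⟧ (length q) ∸_) (length-++ u))
    (trans (sym (∸-+-assoc (⟦ bound V ⟧ (length q)) (length u) 1)) (cong (_∸ 1) e))

  ext?-local : ∀ q u → ext? q u ≡ local (ext? q) q u
  ext?-local q u with width q u in e
  ... | zero  = trans (cong (λ w → test V w q) (++-identityʳ u)) (sym (local-end (ext? q) q u e))
  ... | suc n = trans (cong₂ _∨_ (cong (λ w → test V w q) (++-identityʳ u)) (cong₂ _∨_ (side false) (side true)))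
                      (sym (local-inner (ext? q) q u n e))
    where
    side : ∀ b → anyUpTo n (λ w → test V (u ++ b ∷ w) q) ≡ ext? q (u ++ [ b ])
    side b = trans (anyUpTo-cong n (λ w _ → cong (λ v → test V v q) (sym (++-assoc u [ b ] w))))
      (cong (λ k → anyUpTo k (λ w → test V ((u ++ [ b ]) ++ w) q)) (sym (width-∷ʳ q u b e)))

  width-< : ∀ q u {n} → width q u ≡ suc n → length u < ⟦ bound V ⟧ (length q)
  width-< q u e = m∸n≢0⇒n<m (λ e' → 1+n≢0 (trans (sym e) e'))

  -- The recursion is followed from the longest prefixes downwards: at width 0 only `test` is
  -- consulted, and a one-bit extension lowers the width by one. Agreement at places of polynomial
  -- length thus pins down `D` without any reference to `ext?`.
  unique : ∀ (D : Str → Bool) q → (∀ u → length u ≤ ⟦ bound V ⟧ (length q) → D u ≡ local D q u) →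
    ∀ n u → width q u ≡ n → length u ≤ ⟦ bound V ⟧ (length q) → D u ≡ ext? q u
  unique D q h zero    u e le = trans (h u le) (trans (local-end D q u e)
    (sym (trans (ext?-local q u) (local-end (ext? q) q u e))))
  unique D q h (suc n) u e le = trans (h u le) (trans (local-inner D q u n e)
    (trans (cong (test V u q ∨_) (cong₂ _∨_ (side false) (side true)))
      (sym (trans (ext?-local q u) (local-inner (ext? q) q u n e)))))
    where
    side : ∀ b → D (u ++ [ b ]) ≡ ext? q (u ++ [ b ])
    side b = unique D q h n (u ++ [ b ]) (width-∷ʳ q u b e)
      (≤-trans (≤-reflexive (trans (length-++ u) (+-comm (length u) 1))) (width-< q u e))

module Hardness {B₀ A B : Lang} (V : NPC B₀ A) (B₀F : FP B str bool B₀) {C : Lang} (CF : FP B str bool C) (r : Poly) where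
  open Prefixes V

  D : Str → Str → Str → Bool
  D x q u = C (pr (pr q u) x)

  -- `ℓ` bounds `pr q u` for a query `q` of length at most `r` and a prefix `u` of a certificate.
  -- The two extra bits of `ℓ'` pay for extending `u` by one bit, and for pairing the components of
  -- a string that need not have been a pair.
  ℓ ℓ' : Poly
  ℓ = con 1 ⊞ (r ⊞ r ⊞ bound V ⟨ r ⟩)
  ℓ' = con 2 ⊞ ℓ

  inconsistent : Str → Str → Str → Bool
  inconsistent q u x = D x q u xor local (D x q) q u

  inconsistentF : ∀ {X q u x} → FP B X str q → FP B X str u → FP B X str x →
                  FP B X bool (λ a → inconsistent (q a) (u a) (x a))
  inconsistentF {X} {q} {u} {x} Q U Y = xorF (DF U)
    (orF (relativize₂ B₀F (verify V) ∙ ⟨ U , Q ⟩)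
      (andF (notF (isEmptyF ∙ clockF ∙ ⟨ Q , U ⟩)) (orF (DF (longer false)) (DF (longer true)))))
    where
    DF : ∀ {v} → FP B X str v → FP B X bool (λ a → D (x a) (q a) (v a))
    DF U' = CF ∙ prF ∙ ⟨ prF ∙ ⟨ Q , U' ⟩ , Y ⟩
    longer : ∀ b → FP B X str (λ a → u a ++ [ b ])
    longer b = appendF ∙ ⟨ U , const str [ b ] ⟩

  -- The matrix mentions `C` and the verifier but not `S`, so it is computable with the oracle `B`,
  -- and the quantifier is the only source of nondeterminism.
  I : Lang
  I x = anyUpTo (⟦ ℓ ⟧ (length x)) (λ z → inconsistent (proj₁ (unpr z)) (proj₂ (unpr z)) x)

  I-NPC : NPC B I
  I-NPC = NPC-∃-poly ℓ (λ z x → inconsistent (proj₁ (unpr z)) (proj₂ (unpr z)) x)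
    (inconsistentF (fst ∙ unprF ∙ fst) (snd ∙ unprF ∙ fst) snd)

  -- Membership in `A` is membership in `S` with the empty prefix; for a fixed short `q`, local
  -- consistency of `D` at every prefix up to the bound brings `unique` into play.
  hard : ∀ x → I x ≡ false → ∀ q → length q ≤ ⟦ r ⟧ (length x) → A q ≡ D x q []
  hard x e q le = trans (A≡S q) (sym (unique (D x q) q consistent (⟦ bound V ⟧ (length q)) [] refl z≤n))
    where
    consistent : ∀ u → length u ≤ ⟦ bound V ⟧ (length q) → D x q u ≡ local (D x q) q u
    consistent u le' = xor-false (trans (cong (λ p → inconsistent (proj₁ p) (proj₂ p) x) (sym (unpr-pr q u)))
      (anyUpTo-none (⟦ ℓ ⟧ (length x)) (λ z → inconsistent (proj₁ (unpr z)) (proj₂ (unpr z)) x) (pr q u) e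
        (≤-trans (≤-reflexive (length-pr q u))
          (s≤s (+-mono-≤ (+-mono-≤ le le) (≤-trans le' (⟦⟧-mono (bound V) le)))))))

  -- For a pair of `z` and `x` this says that `z` is a witness of the easiness of `x`.
  W : Lang
  W y = S (proj₁ (unpr y)) xor C y

  W-pr : ∀ z x → W (pr z x) ≡ S z xor C (pr z x)
  W-pr z x = cong (λ p → S (proj₁ p) xor C (pr z x)) (unpr-pr z x)

  W-pr-pr : ∀ q u x → W (pr (pr q u) x) ≡ ext? q u xor D x q u
  W-pr-pr q u x = trans (W-pr (pr q u) x) (cong (_xor D x q u) (S-pr q u))

  -- If S and D agreed at u and at both one-bit extensions of u, then D would
  -- inherit the recursive description of S at u.
  disagree : ∀ q u x → inconsistent q u x ≡ true → ∃ λ v → length v ≤ suc (length u) × W (pr (pr q v) x) ≡ true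
  disagree q u x e = search (at u) (at (u ++ [ false ])) (at (u ++ [ true ])) refl refl refl
    where
    at : Str → Bool
    at v = ext? q v xor D x q v
    found : ∀ v → length v ≤ suc (length u) → at v ≡ true → ∃ λ v → length v ≤ suc (length u) × W (pr (pr q v) x) ≡ true
    found v le t = v , le , trans (W-pr-pr q v x) t
    one-more : ∀ b → length (u ++ [ b ]) ≤ suc (length u)
    one-more b = ≤-reflexive (trans (length-++ u) (+-comm (length u) 1))
    inherits : at u ≡ false → at (u ++ [ false ]) ≡ false → at (u ++ [ true ]) ≡ false → inconsistent q u x ≡ false
    inherits e₀ e₁ e₂ = trans (cong (_xor local (D x q) q u) same) (xor-refl (local (D x q) q u))
      where
      agree : ∀ v → at v ≡ false → ext? q v ≡ D x q v
      agree v = xor-false {ext? q v}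
      same : D x q u ≡ local (D x q) q u
      same = trans (sym (agree u e₀)) (trans (ext?-local q u)
        (cong (λ b → test V u q ∨ (not (isEmpty (clock (q , u))) ∧ b)) 
          (cong₂ _∨_ (agree (u ++ [ false ]) e₁) (agree (u ++ [ true ]) e₂))))
    search : ∀ a b c → at u ≡ a → at (u ++ [ false ]) ≡ b → at (u ++ [ true ]) ≡ c →
             ∃ λ v → length v ≤ suc (length u) × W (pr (pr q v) x) ≡ true
    search true  _     _     e₀ e₁ e₂ = found u (n≤1+n _) e₀
    search false true  _     e₀ e₁ e₂ = found (u ++ [ false ]) (one-more false) e₁
    search false false true  e₀ e₁ e₂ = found (u ++ [ true ]) (one-more true) e₂
    search false false false e₀ e₁ e₂ with trans (sym e) (inherits e₀ e₁ e₂)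
    ... | ()

  easy : ∀ x → I x ≡ true → ∃ λ z → length z ≤ ⟦ ℓ' ⟧ (length x) × W (pr z x) ≡ true
  easy x e = from-place (anyUpTo-sound (⟦ ℓ ⟧ (length x)) _ e)
    where
    from-place : (∃ λ z → length z ≤ ⟦ ℓ ⟧ (length x) × inconsistent (proj₁ (unpr z)) (proj₂ (unpr z)) x ≡ true) →
                 ∃ λ z → length z ≤ ⟦ ℓ' ⟧ (length x) × W (pr z x) ≡ true
    from-place (z , le , t) with disagree (proj₁ (unpr z)) (proj₂ (unpr z)) x t
    ... | v , v≤ , w = pr (proj₁ (unpr z)) v , fits , w
      where
      q≤ : ℕ
      q≤ = length (proj₁ (unpr z)) + length (proj₁ (unpr z))
      fits : length (pr (proj₁ (unpr z)) v) ≤ ⟦ ℓ' ⟧ (length x)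
      fits = ≤-trans (≤-reflexive (length-pr (proj₁ (unpr z)) v))
        (s≤s (≤-trans (+-monoʳ-≤ q≤ v≤) (≤-trans (≤-reflexive (+-suc q≤ _)) (s≤s (≤-trans (length-unpr z) le)))))

-- Complementation inside the difference hierarchy

module Collapse (j m : ℕ) where

  -- With `k = j + 2` these are Σ_{k-1} and Σ_k; the oracles taken from `Σp j` below belong to level
  -- `k - 2`.
  Σ₁ Σ₂ : Class
  Σ₁ = Σp (suc j)
  Σ₂ = Σp (suc (suc j))

  Complement : Lang → Set
  Complement L = DIFF (suc m) Σ₂ (λ x → not (L x))

  symmetric-difference : ∀ {B₀ A L} (V : NPC B₀ A) → Σp j B₀ → DIFF (suc m) Σ₂ L →
    (Σ₁ 𝚫 DIFF (suc m) Σ₂) (λ y → Prefixes.S V (proj₁ (unpr y)) xor L (proj₂ (unpr y)))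
  symmetric-difference {L = L} V β LD = Prefixes.S V ∘ proj₁ ∘ unpr , L ∘ proj₂ ∘ unpr ,
    Σ-above j β (NPC-∘ (fst ∙ unprF) (Prefixes.S-NPC V)) ,
    DIFF-map {f = proj₂ ∘ unpr} (λ { (A , α , N) → A , α , NPC⇒NP (NPC-∘ (snd ∙ unprF) (NP⇒NPC oracle N)) }) (suc m) LD ,
    λ y → refl

  module _ {A B₀ B C L E : Lang} (V : NPC B₀ A) (β₀ : Σp j B₀) (β : Σp j B) (B₀F : FP B str bool B₀) (CF : FP B str bool C)
    (split-L : ∀ y → Prefixes.S V (proj₁ (unpr y)) xor L (proj₂ (unpr y)) ≡ C y xor E y)
    {r : Poly} {H : Lang} (HD : DIFF (suc m) (NPC B) H)
    (H≡L : ∀ x → (∀ q → length q ≤ ⟦ r ⟧ (length x) → A q ≡ C (pr (pr q []) x)) → H x ≡ L x) where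
    open Hardness V B₀F CF r
    open Prefixes V using (S; S-NPC)

    -- Where the local test succeeds, the simulation uses correct answers and `H` is `L`. Where it
    -- fails, `H` may be wrong, and the first factor discards it.
    G : Lang
    G x = not (I x) ∧ not (H x)

    -- Both sides of `split-L` have the same parity. A witness makes `S` and `C` differ, so `L` and
    -- `E` must differ as well, whichever witness was taken.
    constant : ∀ x z → length z ≤ ⟦ ℓ' ⟧ (length x) × W (pr z x) ≡ true → E (pr z x) ≡ not (L x)
    constant x z (le , w) = bits (S z) (C (pr z x)) (E (pr z x)) (L x) (trans (sym (W-pr z x)) w)
      (trans (cong (λ p → S (proj₁ p) xor L (proj₂ p)) (sym (unpr-pr z x))) (split-L (pr z x)))
      where
      bits : ∀ s c e l → s xor c ≡ true → s xor l ≡ c xor e → e ≡ not l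
      bits false true e l _ h = trans (sym (not-involutive e)) (cong not (sym h))
      bits true false e l _ h = sym h

    G-sound : ∀ x → G x ≡ true → not (L x) ≡ true
    G-sound x e = trans (cong not (sym (H≡L x (hard x (trans (sym (not-involutive (I x))) (cong not (proj₁ (∧-elim e))))))))
      (proj₂ (∧-elim {not (I x)} e))

    covered : ∀ x → not (L x) ≡ true → G x ≡ true ⊎ ∃ (λ z → length z ≤ ⟦ ℓ' ⟧ (length x) × W (pr z x) ≡ true)
    covered x e = by (I x) refl
      where
      by : ∀ b → I x ≡ b → G x ≡ true ⊎ ∃ (λ z → length z ≤ ⟦ ℓ' ⟧ (length x) × W (pr z x) ≡ true)
      by true  i = inj₂ (easy x i)
      by false i = inj₁ (cong₂ _∧_ (cong not i) (trans (cong not (H≡L x (hard x i))) e))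

    build : ∀ {F} → Σ₁ F → DIFF (suc m) (NPC F) E → FP F str bool W → FP F str bool G → Complement L
    build {F} φ ED WF GF = DIFF-map {f = λ x → x} (λ X → F , φ , NPC⇒NP X) (suc m)
        (DIFF-ext NPC-ext (suc m) (λ x → proj₂ (proj₂ T) x (not (L x)) (constant x) (G-sound x) (covered x)) (proj₁ (proj₂ T)))
      where
      T : ∃ λ M → DIFF (suc m) (NPC F) M × (∀ x e →
            (∀ z → Tower.Witnesses {F} ℓ' W x z → E (pr z x) ≡ e) → (G x ≡ true → e ≡ true) →
            (e ≡ true → G x ≡ true ⊎ ∃ (Tower.Witnesses {F} ℓ' W x)) → M x ≡ e)
      T = Tower.tower ℓ' m ED (FP⇒NPC WF) (FP⇒NPC GF)

    -- The tower needs one oracle for everything: for the levels of `E`, for `S` and `C` in `W`, and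
    -- for `I` and `H` in `G`. `W` and `G` contain negations, so they are decided by this oracle and
    -- not merely verified.
    assemble : (∃ λ F → Σ₁ F × DIFF (suc m) (NPC F) E) → (∃ λ F → Σ₁ F × FP F str bool H) → Complement L
    assemble (F₀ , φ₀ , ED) (F₁ , φ₁ , HF) =
      let F₂ , φ₂ , F₁F , IF = Σ-join (suc j) φ₁ (Σ-above j β I-NPC)
          F₃ , φ₃ , SF , CF′ = Σ-join (suc j) (Σ-above j β₀ S-NPC) (Σ-above j β (FP⇒NPC CF))
          F₄ , φ₄ , F₂F , F₃F = Σ-join (suc j) φ₂ φ₃
          F , φ , F₄F , F₀F = Σ-join (suc j) φ₄ φ₀
      in build φ (DIFF-map {f = λ x → x} (NPC-relativize F₀F) (suc m) ED)
        (xorF (relativize F₄F (relativize F₃F SF) ∙ fst ∙ unprF) (relativize F₄F (relativize F₃F CF′)))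
        (andF (notF (relativize F₄F (relativize F₂F IF)))
              (notF (relativize F₄F (relativize F₂F (relativize F₁F HF)))))

  module _ (hyp : ∀ L → (Σ₁ 𝚫 DIFF (suc m) Σ₂) L → (Δp (suc j) 𝚫 DIFF (suc m) Σ₂) L) where

    complement : ∀ {L} → DIFF (suc m) Σ₂ L → Complement L
    complement {L} LD =
      let A , α , LA = DIFF-oracle (suc j) m LD
          B₀ , β₀ , V = Σ-below j α
          C , E , (B₁ , β₁ , C∈P) , ED , eq = hyp _ (symmetric-difference V β₀ LD)
          B , β , B₀F , B₁F = Σ-join j β₀ β₁
          CF = P⇒FP B₁F C∈P
          -- An oracle of level `k - 1` gives way to `C`, which is computed with `B` of level
          -- `k - 2`. So `H` is a difference of Σ_{k-1} languages only, and a Σ_{k-1} oracle decides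
          -- it together with its complement.
          r , H , HD , H≡L = DIFF-replace {O = λ q x → C (pr (pr q []) x)}
            (CF ∙ prF ∙ ⟨ prF ∙ ⟨ fst , const str [] ⟩ , snd ⟩) m LA
      in assemble V β₀ β B₀F CF eq {r} HD H≡L (DIFF-oracle (suc j) m ED)
           (DIFF-decide (suc j) m (DIFF-map {f = λ x → x} (Σ-above j β) (suc m) HD))

theorem2p4 : (m k : ℕ) → 0 < m → 1 < k →
    (Δp (k ∸ 1) 𝚫 DIFF m (Σp k)) ≐ (Σp (k ∸ 1) 𝚫 DIFF m (Σp k)) →
    DIFF m (Σp k) ≐ coDIFF m (Σp k)
theorem2p4 (suc m) (suc zero)    0<m (s≤s ())
theorem2p4 (suc m) (suc (suc j)) 0<m 1<k eq L =
  complement hyp , λ D → DIFF-ext Σ₂-ext (suc m) (λ x → not-involutive (L x)) (complement hyp D)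
  where
  open Collapse j m
  hyp : ∀ M → (Σ₁ 𝚫 DIFF (suc m) Σ₂) M → (Δp (suc j) 𝚫 DIFF (suc m) Σ₂) M
  hyp M = proj₂ (eq M)
  Σ₂-ext : ∀ {M M'} → (∀ x → M x ≡ M' x) → Σ₂ M → Σ₂ M'
  Σ₂-ext e (A , α , N) = A , α , NPC⇒NP (NPC-ext e (NP⇒NPC oracle N))
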